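{- Let $n$ be an odd positive integer and let $r,s$ be integers with $r,s\geq 1$ (so $rs\neq 0$) and $r+s=\frac{n-1}{2}$. Then an $HW(n;r,s;3,7)$ exists if and only if $n\equiv 21\pmod{42}$, except possibly when $n=21$ and $r\in\{2,4,6\}$.
   Context: A 2-factor of a graph $G$ is a spanning 2-regular subgraph; a $C_k$-factor is a 2-factor all of whose components are cycles of length $k$. A 2-factorization of $G$ is a partition of the edge set of $G$ into 2-factors. For odd $n$, an $HW(n;r,s;m,k)$ is a 2-factorization of the complete graph $K_n$ into $r+s=\frac{n-1}{2}$ 2-factors, of which exactly $r$ are $C_m$-factors and exactly $s$ are $C_k$-factors. -}

module Defs where

open import Data.Nat using (ℕ; zero; suc; _≤_; _<_)
open import Data.Nat.DivMod using (_mod_)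
open import Data.Fin using (Fin; toℕ)
open import Data.Product using (Σ; Σ-syntax; _×_; _,_)
open import Data.Sum using (_⊎_)
open import Relation.Binary.PropositionalEquality using (_≡_; _≢_)
open import Function.Bundles using (_⤖_; _⇔_; Bijection)

Graph : ℕ → Set₁
Graph n = Fin n → Fin n → Set

next : ∀ {k} → Fin k → Fin k
next {suc m} j = suc (toℕ j) mod suc m

-- A family of t vertex-disjoint k-cycles covering all n vertices is a
-- bijection σ : Fin t × Fin k ⤖ Fin n; cycle i is σ(i,0),σ(i,1),…,σ(i,k-1).
-- Directed cycle edge x → y: y follows x on some cycle.
CycleArc : ∀ {n t k} → (Fin t × Fin k) ⤖ Fin n → Fin n → Fin n → Set
CycleArc σ x y = Σ[ i ∈ _ ] Σ[ j ∈ _ ]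
  (Bijection.to σ (i , j) ≡ x × Bijection.to σ (i , next j) ≡ y)

CFactor : (n k : ℕ) → Graph n → Set
CFactor n k F =
  3 ≤ k × Σ[ t ∈ ℕ ] Σ[ σ ∈ (Fin t × Fin k) ⤖ Fin n ]
    (∀ x y → F x y ⇔ (CycleArc σ x y ⊎ CycleArc σ y x))

ColourClass : ∀ {n f} → (Fin n → Fin n → Fin f) → Fin f → Graph n
ColourClass col c x y = x ≢ y × col x y ≡ c

-- HW(n; r, s; m, k): a partition of E(K_n) into r+s 2-factors, r of them
-- C_m-factors and s of them C_k-factors.  The partition is encoded as a
-- symmetric colouring of the edges with r+s colours; colours 0..r-1 are the
-- C_m-factors and colours r..r+s-1 are the C_k-factors.
HW : (n r s m k : ℕ) → Set
HW n r s m k =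
  Σ[ col ∈ (Fin n → Fin n → Fin (r Data.Nat.+ s)) ]
    ((∀ x y → col x y ≡ col y x) ×
     (∀ c → (toℕ c < r → CFactor n m (ColourClass col c))
          × (r ≤ toℕ c → CFactor n k (ColourClass col c))))

{-# OPTIONS --safe #-}
-- Necessity is a divisibility argument. For existence let n = 21 v with v = 2 t + 1. A resolvable 3-GDD of type
-- 3^v (a KTS(3v) without one parallel class) is inflated by 7: each of its 3 t classes turns into copies of
-- K_{7,7,7}, which have a factorization with τ triangle factors and 7 − τ heptagon factors for τ ∈ {0,1,3,5,7},
-- and the groups turn into copies of K₂₁, which have one with κ and 10 − κ for κ ∈ {0,1,3,5,7,8,9,10}; three
-- classes and the groups together already realize every r ≤ 30. The 3-GDDs are constructed by strong induction
-- on t: Kirkman frames of type 6⁴ and 6⁵ are placed on the blocks of a TD(5, m), gcd (m, 6) = 1, one of whose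
-- groups is truncated to h points, so that t = 4 m + h, and the groups are filled in with smaller designs. The
-- finitely many t not reached in this way come from direct products, from a TD(5, 9), and from starters over
-- the integers modulo v found by computer search.
module Submission where

open import Defs
open import Algebra.Bundles using (CommutativeRing)
open import Data.Bool as Bool using (Bool; true; false; if_then_else_; _∧_; _∨_)
open import Data.Empty using (⊥)
open import Data.Fin as Fin using (Fin; zero; suc; toℕ; fromℕ<; inject≤; _↑ˡ_; _↑ʳ_; splitAt)
open import Data.Fin.Patterns
open import Data.Fin.Permutation using (↔⇒≡)
import Data.Fin.Properties as Fin
open import Data.List using (List; []; _∷_; length; lookup; filter; allFin)
open import Data.List.Membership.Propositional using (_∈_)
open import Data.List.Membership.Propositional.Properties using (∈-filter⁺; ∈-filter⁻; ∈-allFin; ∈-lookup)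
open import Data.List.Relation.Unary.All as All using (All; []; _∷_)
open import Data.List.Relation.Unary.AllPairs using (_∷_)
open import Data.List.Relation.Unary.Any using (index)
open import Data.List.Relation.Unary.Any.Properties using (lookup-index)
open import Data.List.Relation.Unary.Unique.Propositional using (Unique)
open import Data.List.Relation.Unary.Unique.Propositional.Properties using (allFin⁺; filter⁺)
open import Data.Maybe as Maybe using (Maybe; just; nothing; maybe; fromMaybe)
import Data.Maybe.Properties as Maybe
open import Data.Nat as ℕ using (ℕ; zero; suc; _+_; _*_; _∸_; _≤_; _<_; z≤n; s≤s; _%_; _/_; NonZero; _≡ᵇ_)
open import Data.Nat.Coprimality using (coprime?; coprime-divisor)
open import Data.Nat.Divisibility using (_∣_; divides)
import Data.Nat.DivMod as ℕ
open import Data.Nat.DivMod using (_mod_)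
open import Data.Nat.Induction using (<-rec)
import Data.Nat.Properties as ℕ
open import Data.List.Membership.DecPropositional ℕ._≟_ using (_∈?_)
open import Data.Nat.Tactic.RingSolver using (solve-∀)
open import Data.Product using (Σ; Σ-syntax; ∃-syntax; _×_; _,_; proj₁; proj₂; map₁; map₂)
open import Data.Product.Function.NonDependent.Propositional using (_×-↔_)
import Data.Product.Properties as Product
open import Data.Sum as Sum using (_⊎_; inj₁; inj₂; swap)
open import Data.Sum.Function.Propositional using (_⊎-↔_)
import Data.Sum.Properties as Sum
open import Data.Unit using (⊤; tt)
open import Function using (_∘_)
open import Function.Bundles using (_↔_; _⇔_; Inverse; mk↔ₛ′; mk⇔; mk⤖)
open import Function.Properties.Bijection using (⤖⇒↔)
open import Function.Properties.Inverse using (↔-refl; ↔-sym; ↔-trans)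
open import Relation.Binary.Definitions using (DecidableEquality; tri<; tri≈; tri>)
open import Relation.Binary.PropositionalEquality
open import Relation.Nullary using (Dec; yes; no; ¬_; contradiction)
open import Relation.Nullary.Decidable using (_×-dec_; _⊎-dec_; _→-dec_; ¬?; map′; toWitness)
import Tactic.RingSolver as RingSolver
open import Tactic.RingSolver.Core.AlmostCommutativeRing using (AlmostCommutativeRing; fromCommutativeRing)

-- Decompositions into cycle factors

-- The deleted parallel class supplies the groups, and these absorb the edges between the seven
-- copies of a point: a group inflated by 7 spans all of K₂₁, a triangle of any other class only
-- K_{7,7,7}. The count fits, as 3 t · 7 + 10 = (n - 1) / 2. The gaps 2, 4, 6 in the values of τ and
-- κ close once there are three classes, since odd values add up to even ones; at n = 21 there is no
-- class, and the gaps become the exceptions of the theorem. Truncating a TD(5, m) reaches exactly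
-- the window 4 m ≤ t ≤ 5 m. Its five columns are lines modulo m whose slopes differ by at most 3,
-- so 2 and 3 must be invertible; the windows of the remaining m leave only finitely many gaps.
-- Cycle factors are given by two functions `pos` and `at`, because these compose directly when
-- designs are inflated, united or glued along blocks. The bijection demanded by `CFactor` is
-- produced only once, from a finished decomposition.

Neighbours : ∀ {k} → Fin k → Fin k → Set
Neighbours i j = j ≡ next i ⊎ i ≡ next j

-- In a triangle, unlike in longer cycles, any two positions are adjacent. Together with the
-- converse this lets a triangle act as a complete graph, both under inflation and in frames, whose
-- laws are stated with `≢`.
≢⇒neighbours : ∀ {i j : Fin 3} → i ≢ j → Neighbours i j
≢⇒neighbours {zero} {zero} n = contradiction refl n
≢⇒neighbours {zero} {suc zero} n = inj₁ refl
≢⇒neighbours {zero} {suc (suc zero)} n = inj₂ refl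
≢⇒neighbours {suc zero} {zero} n = inj₂ refl
≢⇒neighbours {suc zero} {suc zero} n = contradiction refl n
≢⇒neighbours {suc zero} {suc (suc zero)} n = inj₁ refl
≢⇒neighbours {suc (suc zero)} {zero} n = inj₁ refl
≢⇒neighbours {suc (suc zero)} {suc zero} n = inj₂ refl
≢⇒neighbours {suc (suc zero)} {suc (suc zero)} n = contradiction refl n

neighbours⇒≢ : ∀ {i j : Fin 3} → Neighbours i j → i ≢ j
neighbours⇒≢ {zero} (inj₁ ()) refl
neighbours⇒≢ {zero} (inj₂ ()) refl
neighbours⇒≢ {suc zero} (inj₁ ()) refl
neighbours⇒≢ {suc zero} (inj₂ ()) refl
neighbours⇒≢ {suc (suc zero)} (inj₁ ()) refl
neighbours⇒≢ {suc (suc zero)} (inj₂ ()) refl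

-- An edge partition of E into 2-factors: a colour c : C l stands for a factor into cycles of length size l,
-- in which x has position pos c x on its cycle and at c x i is the vertex at position i of that cycle.
-- The value of col outside E is irrelevant.
record Decomposition {L : Set} (size : L → ℕ) (V : Set) (E : V → V → Set)
                     (C : L → Set) : Set where
  field
    col : V → V → Maybe (Σ L C)
    pos : ∀ {l} → C l → V → Fin (size l)
    at  : ∀ {l} → C l → V → Fin (size l) → V
    pos-at : ∀ {l} (c : C l) x i → pos c (at c x i) ≡ i
    at-pos : ∀ {l} (c : C l) x → at c x (pos c x) ≡ x
    at-at  : ∀ {l} (c : C l) x i j → at c (at c x i) j ≡ at c x j
    sound  : ∀ {l} (c : C l) x {i j} → Neighbours i j →
             E (at c x i) (at c x j) × col (at c x i) (at c x j) ≡ just (l , c)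
    complete : ∀ {x y} → E x y → Σ[ l ∈ L ] Σ[ c ∈ C l ]
               (col x y ≡ just (l , c) × at c x (pos c y) ≡ y × Neighbours (pos c x) (pos c y))

module _ {L : Set} {size : L → ℕ} where

  -- `E₁?` decides which of the two colourings is consulted; disjointness ensures that an edge of
  -- `E₂` is never sent to the first.
  union : ∀ {V : Set} {E E₁ E₂ : V → V → Set} {C₁ C₂ : L → Set} →
          (∀ x y → Dec (E₁ x y)) →
          (∀ {x y} → E x y → E₁ x y ⊎ E₂ x y) →
          (∀ {x y} → E₁ x y → E x y) → (∀ {x y} → E₂ x y → E x y) →
          (∀ {x y} → E₁ x y → ¬ E₂ x y) →
          Decomposition size V E₁ C₁ → Decomposition size V E₂ C₂ →
          Decomposition size V E (λ l → C₁ l ⊎ C₂ l)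
  union {V} {E} {E₁} {E₂} {C₁} {C₂} E₁? split inc₁ inc₂ disjoint D₁ D₂ = record
    { col = col ; pos = pos ; at = at
    ; pos-at = λ { (inj₁ c) → D₁.pos-at c ; (inj₂ c) → D₂.pos-at c }
    ; at-pos = λ { (inj₁ c) → D₁.at-pos c ; (inj₂ c) → D₂.at-pos c }
    ; at-at  = λ { (inj₁ c) → D₁.at-at c ; (inj₂ c) → D₂.at-at c }
    ; sound = sound ; complete = complete }
    where
    module D₁ = Decomposition D₁
    module D₂ = Decomposition D₂
    col : V → V → Maybe (Σ L λ l → C₁ l ⊎ C₂ l)
    col x y with E₁? x y
    ... | yes _ = Maybe.map (map₂ inj₁) (D₁.col x y)
    ... | no _  = Maybe.map (map₂ inj₂) (D₂.col x y)
    col-₁ : ∀ {x y} → E₁ x y → col x y ≡ Maybe.map (map₂ inj₁) (D₁.col x y)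
    col-₁ {x} {y} e with E₁? x y
    ... | yes _ = refl
    ... | no ¬e = contradiction e ¬e
    col-₂ : ∀ {x y} → E₂ x y → col x y ≡ Maybe.map (map₂ inj₂) (D₂.col x y)
    col-₂ {x} {y} e with E₁? x y
    ... | yes e′ = contradiction e (disjoint e′)
    ... | no _ = refl
    pos : ∀ {l} → C₁ l ⊎ C₂ l → V → Fin (size l)
    pos (inj₁ c) = D₁.pos c
    pos (inj₂ c) = D₂.pos c
    at : ∀ {l} → C₁ l ⊎ C₂ l → V → Fin (size l) → V
    at (inj₁ c) = D₁.at c
    at (inj₂ c) = D₂.at c
    sound : ∀ {l} (c : C₁ l ⊎ C₂ l) x {i j} → Neighbours i j →
            E (at c x i) (at c x j) × col (at c x i) (at c x j) ≡ just (l , c)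
    sound (inj₁ c) x nb with D₁.sound c x nb
    ... | e , q = inc₁ e , trans (col-₁ e) (cong (Maybe.map (map₂ inj₁)) q)
    sound (inj₂ c) x nb with D₂.sound c x nb
    ... | e , q = inc₂ e , trans (col-₂ e) (cong (Maybe.map (map₂ inj₂)) q)
    complete : ∀ {x y} → E x y → Σ[ l ∈ L ] Σ[ c ∈ (C₁ l ⊎ C₂ l) ]
               (col x y ≡ just (l , c) × at c x (pos c y) ≡ y × Neighbours (pos c x) (pos c y))
    complete e with split e
    ... | inj₁ e₁ with D₁.complete e₁
    ...   | l , c , q , r = l , inj₁ c , trans (col-₁ e₁) (cong (Maybe.map (map₂ inj₁)) q) , r
    complete e | inj₂ e₂ with D₂.complete e₂
    ...   | l , c , q , r = l , inj₂ c , trans (col-₂ e₂) (cong (Maybe.map (map₂ inj₂)) q) , r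

  -- The copies share their colours: the same factor taken in every copy gives one factor of the
  -- disjoint union.
  copies : ∀ (A : Set) {V : Set} {E : V → V → Set} {C : L → Set} →
           Decomposition size V E C →
           Decomposition size (A × V) (λ p q → proj₁ p ≡ proj₁ q × E (proj₂ p) (proj₂ q)) C
  copies A D = record
    { col = λ p q → col (proj₂ p) (proj₂ q)
    ; pos = λ c p → pos c (proj₂ p)
    ; at = λ c p i → proj₁ p , at c (proj₂ p) i
    ; pos-at = λ c p → pos-at c (proj₂ p)
    ; at-pos = λ c p → cong (proj₁ p ,_) (at-pos c (proj₂ p))
    ; at-at = λ c p i j → cong (proj₁ p ,_) (at-at c (proj₂ p) i j)
    ; sound = λ c p nb → let e , q = sound c (proj₂ p) nb in (refl , e) , q
    ; complete = λ { (refl , e) → let l , c , q , r , nb = complete e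
                                  in l , c , q , cong (_ ,_) r , nb } }
    where open Decomposition D

  reindex : ∀ {V V′ : Set} {E : V → V → Set} {E′ : V′ → V′ → Set} {C C′ : L → Set} →
            (f : V′ ↔ V) → (∀ {x y} → E′ x y → E (Inverse.to f x) (Inverse.to f y)) →
            (∀ {x y} → E x y → E′ (Inverse.from f x) (Inverse.from f y)) →
            (∀ l → C l ↔ C′ l) →
            Decomposition size V E C → Decomposition size V′ E′ C′
  reindex {V} {V′} {E} {E′} {C} {C′} f E′⇒E E⇒E′ g D = record
    { col = col′ ; pos = λ {l} c x → pos (G.from l c) (F.to x)
    ; at = λ {l} c x i → F.from (at (G.from l c) (F.to x) i)
    ; pos-at = λ {l} c x i → trans (cong (pos (G.from l c)) (tf _)) (pos-at _ _ _)
    ; at-pos = λ {l} c x → trans (cong F.from (at-pos _ _)) (ft x)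
    ; at-at = λ {l} c x i j →
        cong F.from (trans (cong (λ z → at (G.from l c) z j) (tf (at (G.from l c) (F.to x) i))) (at-at _ _ _ _))
    ; sound = sound′ ; complete = complete′ }
    where
    open Decomposition D
    module F = Inverse f
    module G (l : L) = Inverse (g l)
    tf : ∀ y → F.to (F.from y) ≡ y
    tf = F.strictlyInverseˡ
    ft : ∀ y → F.from (F.to y) ≡ y
    ft = F.strictlyInverseʳ
    recolour : Σ L C → Σ L C′
    recolour (l , c) = l , G.to l c
    col′ : V′ → V′ → Maybe (Σ L C′)
    col′ x y = Maybe.map recolour (col (F.to x) (F.to y))
    sound′ : ∀ {l} (c : C′ l) x {i j} → Neighbours i j → _
    sound′ {l} c x nb with sound (G.from l c) (F.to x) nb
    ... | e , q = E⇒E′ e ,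
      trans (cong₂ (λ a b → Maybe.map recolour (col a b)) (tf _) (tf _))
        (trans (cong (Maybe.map recolour) q)
          (cong (λ d → just (l , d)) (G.strictlyInverseˡ l c)))
    complete′ : ∀ {x y} → E′ x y → Σ[ l ∈ L ] Σ[ c ∈ C′ l ]
                (col′ x y ≡ just (l , c) × F.from (at (G.from l c) (F.to x) (pos (G.from l c) (F.to y))) ≡ y
                  × Neighbours (pos (G.from l c) (F.to x)) (pos (G.from l c) (F.to y)))
    complete′ {x} {y} e with complete (E′⇒E e)
    ... | l , c , q , r , nb = l , G.to l c , cong (Maybe.map recolour) q ,
      subst (λ d → F.from (at d (F.to x) (pos d (F.to y))) ≡ y) (sym (G.strictlyInverseʳ l c))
        (trans (cong F.from r) (ft y)) ,
      subst (λ d → Neighbours (pos d (F.to x)) (pos d (F.to y))) (sym (G.strictlyInverseʳ l c)) nb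

DifferentFirst : ∀ {A B : Set} → A × B → A × B → Set
DifferentFirst p q = proj₁ p ≢ proj₁ q

differentFirst? : ∀ {n} {B : Set} (x y : Fin n × B) → Dec (DifferentFirst x y)
differentFirst? x y = ¬? (proj₁ x Fin.≟ proj₁ y)

three : ⊤ → ℕ
three _ = 3

-- Resolvable 3-GDDs with groups {a} × Fin 3; the colours are the parallel classes.
RGDD : (A C : Set) → Set
RGDD A C = Decomposition three (A × Fin 3) DifferentFirst (λ _ → C)

-- Each triangle of a colour class of the RGDD is inflated to a K_{W,W,W}.
inflate : ∀ {L : Set} {size : L → ℕ} {A C W : Set} {D : C → L → Set} →
          RGDD A C → (∀ c → Decomposition size (Fin 3 × W) DifferentFirst (D c)) →
          Decomposition size (A × (Fin 3 × W)) DifferentFirst (λ l → Σ[ c ∈ C ] D c l)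
inflate {L} {size} {A} {C} {W} {D} R I = record
  { col = col ; pos = pos ; at = at
  ; pos-at = λ { (c , d) x i → trans (cong (I.pos c d) (coord-place c (a x) (I.at c d (coord c x) i))) (I.pos-at c d _ i) }
  ; at-pos = λ { (c , d) x → trans (cong (place c (a x)) (I.at-pos c d _)) (place-coord c x) }
  ; at-at  = λ { (c , d) x i j → let p = I.at c d (coord c x) i in
      trans (cong (λ z → place c (place-base c (a x) p) (I.at c d z j)) (coord-place c (a x) p))
        (trans (place-place c (a x) p _) (cong (place c (a x)) (I.at-at c d _ i j))) }
  ; sound = sound ; complete = complete }
  where
  module R = Decomposition R
  module I (c : C) = Decomposition (I c)
  V = A × (Fin 3 × W)
  a : V → A × Fin 3
  a (x , i , w) = x , i
  -- Coordinates of a vertex inside the K_{W,W,W} over its triangle of class c; `place` inverts them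
  -- once a vertex of the triangle is known.
  coord : C → V → Fin 3 × W
  coord c (x , i , w) = R.pos c (x , i) , w
  place : C → A × Fin 3 → Fin 3 × W → V
  place c x (i , w) = proj₁ (R.at c x i) , proj₂ (R.at c x i) , w
  place-base : C → A × Fin 3 → Fin 3 × W → A × Fin 3
  place-base c x (i , w) = R.at c x i
  coord-place : ∀ c x p → coord c (place c x p) ≡ p
  coord-place c x (i , w) = cong (_, w) (R.pos-at c x i)
  place-coord : ∀ c x → place c (a x) (coord c x) ≡ x
  place-coord c (x , i , w) = cong (λ z → proj₁ z , proj₂ z , w) (R.at-pos c (x , i))
  place-place : ∀ c x p q → place c (place-base c x p) q ≡ place c x q
  place-place c x (i , _) (j , w) = cong (λ z → proj₁ z , proj₂ z , w) (R.at-at c x i j)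
  K : L → Set
  K l = Σ[ c ∈ C ] D c l
  pos : ∀ {l} → K l → V → Fin (size l)
  pos (c , d) x = I.pos c d (coord c x)
  at : ∀ {l} → K l → V → Fin (size l) → V
  at (c , d) x i = place c (a x) (I.at c d (coord c x) i)
  tag : (c : C) → Σ L (D c) → Σ L K
  tag c (l , d) = l , c , d
  col-in : V → V → Maybe (⊤ × C) → Maybe (Σ L K)
  col-in x y nothing = nothing
  col-in x y (just (_ , c)) = Maybe.map (tag c) (I.col c (coord c x) (coord c y))
  col : V → V → Maybe (Σ L K)
  col x y = col-in x y (R.col (a x) (a y))
  sound : ∀ {l} (c : K l) x {i j} → Neighbours i j →
          DifferentFirst (at c x i) (at c x j) × col (at c x i) (at c x j) ≡ just (l , c)
  sound {l} (c , d) x {i} {j} nb with I.sound c d (coord c x) nb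
  ... | e , q with R.sound c (a x) (≢⇒neighbours e)
  ...   | e′ , q′ = e′ , trans (cong (col-in (at (c , d) x i) (at (c , d) x j)) q′)
          (cong (Maybe.map (tag c)) (trans (cong₂ (I.col c) (coord-place c (a x) _) (coord-place c (a x) _)) q))
  complete : ∀ {x y} → DifferentFirst x y → Σ[ l ∈ L ] Σ[ c ∈ K l ]
             (col x y ≡ just (l , c) × at c x (pos c y) ≡ y × Neighbours (pos c x) (pos c y))
  complete {x} {y} e with R.complete {a x} {a y} e
  ... | _ , c , q , r , nb with I.complete c {coord c x} {coord c y} (neighbours⇒≢ nb)
  ...   | l , d , q′ , r′ , nb′ = l , (c , d) ,
          trans (cong (col-in x y) q) (cong (Maybe.map (tag c)) q′) ,
          trans (cong (place c (a x)) r′) (cong (λ z → proj₁ z , proj₂ z , proj₂ (proj₂ y)) r) , nb′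

-- Decompositions and the Hamilton–Waterloo problem

lookup-injective : ∀ {A : Set} {xs : List A} → Unique xs → ∀ i j → lookup xs i ≡ lookup xs j → i ≡ j
lookup-injective (_ ∷ _) zero zero e = refl
lookup-injective (x≢ ∷ _) zero (suc j) e = contradiction e (All.lookup x≢ (∈-lookup j))
lookup-injective (x≢ ∷ _) (suc i) zero e = contradiction (sym e) (All.lookup x≢ (∈-lookup i))
lookup-injective (_ ∷ u) (suc i) (suc j) e = cong suc (lookup-injective u i j e)

-- Each cycle has exactly one vertex at position zero, so the list `bases` of these vertices indexes
-- the cycles.
cycle-factor : ∀ {n k} {F : Graph n} → 3 ≤ k →
  (pos : Fin n → Fin k) (at : Fin n → Fin k → Fin n) →
  (∀ x i → pos (at x i) ≡ i) → (∀ x → at x (pos x) ≡ x) → (∀ x i j → at (at x i) j ≡ at x j) →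
  (∀ x {i j} → Neighbours i j → F (at x i) (at x j)) →
  (∀ {x y} → F x y → at x (pos y) ≡ y × Neighbours (pos x) (pos y)) →
  CFactor n k F
cycle-factor {n} {suc k} {F} 3≤k pos at pos-at at-pos at-at sound complete =
  3≤k , length bases , mk⤖ (injective , surjective) , λ x y → mk⇔ (arcs x y) (edges x y)
  where
  is-base? : ∀ x → Dec (pos x ≡ zero)
  is-base? x = pos x Fin.≟ zero
  bases : List (Fin n)
  bases = filter is-base? (allFin n)
  base : Fin (length bases) → Fin n
  base = lookup bases
  base-pos : ∀ i → pos (base i) ≡ zero
  base-pos i = proj₂ (∈-filter⁻ is-base? {xs = allFin n} (∈-lookup {xs = bases} i))
  vertex : Fin (length bases) × Fin (suc k) → Fin n
  vertex (i , j) = at (base i) j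
  vertex-base : ∀ i j → at (at (base i) j) zero ≡ base i
  vertex-base i j = trans (at-at _ j zero)
    (trans (cong (at (base i)) (sym (base-pos i))) (at-pos (base i)))
  injective : ∀ {p q} → vertex p ≡ vertex q → p ≡ q
  injective {i , j} {i′ , j′} e = cong₂ _,_
    (lookup-injective (filter⁺ is-base? (allFin⁺ n)) i i′
      (trans (sym (vertex-base i j)) (trans (cong (λ z → at z zero) e) (vertex-base i′ j′))))
    (trans (sym (pos-at _ j)) (trans (cong pos e) (pos-at _ j′)))
  base∈ : ∀ y → at y zero ∈ bases
  base∈ y = ∈-filter⁺ is-base? (∈-allFin _) (pos-at y zero)
  cycle-of : Fin n → Fin (length bases)
  cycle-of y = index (base∈ y)
  vertex-of : ∀ y i → vertex (cycle-of y , i) ≡ at y i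
  vertex-of y i = trans (cong (λ z → at z i) (sym (lookup-index (base∈ y)))) (at-at y zero i)
  surjective : ∀ y → Σ[ p ∈ _ ] (∀ {z} → z ≡ p → vertex z ≡ y)
  surjective y = (cycle-of y , pos y) , λ { refl → trans (vertex-of y (pos y)) (at-pos y) }
  arcs : ∀ x y → F x y → _
  arcs x y e with complete e
  ... | r , inj₁ q = inj₁ (cycle-of x , pos x , trans (vertex-of x _) (at-pos x) ,
                           trans (vertex-of x _) (trans (cong (at x) (sym q)) r))
  ... | r , inj₂ q = inj₂ (cycle-of x , pos y , trans (vertex-of x _) r ,
                           trans (vertex-of x _) (trans (cong (at x) (sym q)) (at-pos x)))
  edges : ∀ x y → _ → F x y
  edges x y (inj₁ (i , j , refl , refl)) = sound (base i) (inj₁ refl)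
  edges x y (inj₂ (i , j , refl , refl)) = sound (base i) (inj₂ refl)

data Length : Set where
  triangle heptagon : Length

len : Length → ℕ
len triangle = 3
len heptagon = 7

counts : ℕ → ℕ → Length → ℕ
counts r s triangle = r
counts r s heptagon = s

mix : ℕ → ℕ → Length → Set
mix r s l = Fin (counts r s l)

decomposition⇒HW : ∀ {n r s} → 1 ≤ r → Decomposition len (Fin n) _≢_ (mix r s) → HW n r s 3 7
decomposition⇒HW {n} {r} {s} 1≤r D = colour , colour-sym , λ c → triangles c , heptagons c
  where
  open Decomposition D
  code : Σ Length (mix r s) → Fin (r + s)
  code (triangle , c) = c ↑ˡ s
  code (heptagon , c) = r ↑ʳ c
  code-injective : ∀ {c d} → code c ≡ code d → c ≡ d
  code-injective {triangle , c} {triangle , d} e = cong (triangle ,_) (Fin.↑ˡ-injective s c d e)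
  code-injective {heptagon , c} {heptagon , d} e = cong (heptagon ,_) (Fin.↑ʳ-injective r c d e)
  code-injective {triangle , c} {heptagon , d} e
    with () ← trans (sym (Fin.splitAt-↑ˡ r c s)) (trans (cong (splitAt r) e) (Fin.splitAt-↑ʳ r s d))
  code-injective {heptagon , c} {triangle , d} e
    with () ← trans (sym (Fin.splitAt-↑ʳ r s c)) (trans (cong (splitAt r) e) (Fin.splitAt-↑ˡ r d s))
  colour : Fin n → Fin n → Fin (r + s)
  -- `HW` wants a colour for every pair, also on the diagonal, where `col` may be `nothing`; colour
  -- 0, available since 1 ≤ r, is the default.
  colour x y = maybe code (code (triangle , Fin.fromℕ< 1≤r)) (col x y)
  -- Symmetry is no field of `Decomposition`; it follows from `sound` applied to the two positions
  -- in reverse order.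
  colour-sym : ∀ x y → colour x y ≡ colour y x
  colour-sym x y with x Fin.≟ y
  ... | yes refl = refl
  ... | no x≢y with complete x≢y
  ...   | l , c , q , r , nb = cong (maybe code _) (trans q (sym
           (subst₂ (λ a b → col a b ≡ just (l , c)) r (at-pos c x) (proj₂ (sound c x (swap nb))))))
  factor : ∀ {l} (c : mix r s l) → 3 ≤ len l → CFactor n (len l) (ColourClass colour (code (l , c)))
  factor {l} c 3≤l = cycle-factor 3≤l (pos c) (at c) (pos-at c) (at-pos c) (at-at c)
    (λ x nb → let e , q = sound c x nb in e , cong (maybe code _) q)
    (λ { (x≢y , e) → class x≢y e })
    where
    class : ∀ {x y} → x ≢ y → colour x y ≡ code (l , c) → at c x (pos c y) ≡ y × Neighbours (pos c x) (pos c y)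
    class x≢y e with complete x≢y
    ... | l′ , c′ , q , r , nb with refl ← code-injective {l′ , c′} {l , c} (trans (sym (cong (maybe code _) q)) e) = r , nb
  triangles : ∀ c → toℕ c < r → CFactor n 3 (ColourClass colour c)
  triangles c c<r with splitAt r c in eq
  ... | inj₁ d = subst (λ z → CFactor n 3 (ColourClass colour z)) (Fin.splitAt⁻¹-↑ˡ eq)
                   (factor {triangle} d ℕ.≤-refl)
  ... | inj₂ d = contradiction c<r (ℕ.≤⇒≯ (subst (λ z → r ≤ toℕ z) (Fin.splitAt⁻¹-↑ʳ eq)
                   (subst (r ≤_) (sym (Fin.toℕ-↑ʳ r d)) (ℕ.m≤m+n r _))))
  heptagons : ∀ c → r ≤ toℕ c → CFactor n 7 (ColourClass colour c)
  heptagons c r≤c with splitAt r c in eq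
  ... | inj₁ d = contradiction (subst (λ z → toℕ z < r) (Fin.splitAt⁻¹-↑ˡ eq)
                   (subst (_< r) (sym (Fin.toℕ-↑ˡ d s)) (Fin.toℕ<n d))) (ℕ.≤⇒≯ r≤c)
  ... | inj₂ d = subst (λ z → CFactor n 7 (ColourClass colour z)) (Fin.splitAt⁻¹-↑ʳ eq)
                   (factor {heptagon} d (s≤s (s≤s (s≤s z≤n))))

-- Necessity of the congruence

cycle-length-divides : ∀ {n k} {F : Graph n} → CFactor n k F → k ∣ n
cycle-length-divides (_ , t , σ , _) = divides t (sym (↔⇒≡ (↔-trans Fin.*↔× (⤖⇒↔ σ))))

odd-multiple-of-21 : ∀ {n} → n % 2 ≡ 1 → 3 ∣ n → 7 ∣ n → n % 42 ≡ 21
odd-multiple-of-21 {n} n-odd (divides a refl) 7∣n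
  with coprime-divisor {7} {3} {a} (toWitness {a? = coprime? 7 3} _) (subst (7 ∣_) (ℕ.*-comm a 3) 7∣n)
... | divides b refl = begin
  (b * 7 * 3) % 42            ≡⟨ cong (λ z → (z * 7 * 3) % 42) (ℕ.m≡m%n+[m/n]*n b 2) ⟩
  ((b % 2 + h * 2) * 7 * 3) % 42  ≡⟨ cong (λ z → ((z + h * 2) * 7 * 3) % 42) b-odd ⟩
  ((1 + h * 2) * 7 * 3) % 42      ≡⟨ cong (_% 42) (rearrange h) ⟩
  (21 + h * 42) % 42          ≡⟨ ℕ.[m+kn]%n≡m%n 21 h 42 ⟩
  21 ∎
  where
  open ≡-Reasoning
  h = b / 2
  rearrange : ∀ h → (1 + h * 2) * 7 * 3 ≡ 21 + h * 42
  rearrange = solve-∀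
  b-odd : b % 2 ≡ 1
  b-odd with b % 2 in eq | ℕ.m%n<n b 2
  ... | 1 | _ = refl
  ... | suc (suc _) | s≤s (s≤s ())
  ... | 0 | _ = contradiction (trans (sym even) n-odd) λ ()
    where
    even : (b * 7 * 3) % 2 ≡ 0
    even = begin
      (b * 7 * 3) % 2             ≡⟨ ℕ.%-congˡ (ℕ.*-assoc b 7 3) ⟩
      (b * 21) % 2                ≡⟨ ℕ.%-distribˡ-* b 21 2 ⟩
      (b % 2 * 1) % 2             ≡⟨ cong (λ z → (z * 1) % 2) eq ⟩
      0 ∎

-- Both kinds of factor occur, as colours 0 and r, so both cycle lengths divide n.
HW⇒order : ∀ {n r s} → n % 2 ≡ 1 → 1 ≤ r → 1 ≤ s → HW n r s 3 7 → n % 42 ≡ 21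
HW⇒order {n} {r} {s} n-odd 1≤r 1≤s (col , _ , factors) = odd-multiple-of-21 n-odd
  (cycle-length-divides (proj₁ (factors (Fin.fromℕ< 1≤r ↑ˡ s))
    (subst (_< r) (sym (Fin.toℕ-↑ˡ _ s)) (Fin.toℕ<n _))))
  (cycle-length-divides (proj₂ (factors (r ↑ʳ Fin.fromℕ< 1≤s))
    (subst (r ≤_) (sym (Fin.toℕ-↑ʳ r _)) (ℕ.m≤m+n r _))))

-- Integers modulo m

module Residues (n : ℕ) where

  m : ℕ
  m = suc n

  ρ : ℕ → Fin m
  ρ a = a mod m

  toℕ-ρ : ∀ a → toℕ (ρ a) ≡ a % m
  toℕ-ρ a = Fin.toℕ-fromℕ< (ℕ.m%n<n a m)

  ρ-cong : ∀ a b → a % m ≡ b % m → ρ a ≡ ρ b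
  ρ-cong a b e = Fin.toℕ-injective (trans (toℕ-ρ a) (trans e (sym (toℕ-ρ b))))

  ρ-toℕ : ∀ x → ρ (toℕ x) ≡ x
  ρ-toℕ x = Fin.toℕ-injective (trans (toℕ-ρ (toℕ x)) (ℕ.m<n⇒m%n≡m (Fin.toℕ<n x)))

  ρ-drop : ∀ b q → ρ (b + q * m) ≡ ρ b
  ρ-drop b q = ρ-cong (b + q * m) b (ℕ.[m+kn]%n≡m%n b q m)

  infixl 6 _⊕_ _⊖_
  infixl 7 _⊗_

  _⊕_ _⊗_ _⊖_ : Fin m → Fin m → Fin m
  x ⊕ y = ρ (toℕ x + toℕ y)
  x ⊗ y = ρ (toℕ x * toℕ y)
  x ⊖ y = ρ (toℕ x + (m ∸ toℕ y))

  negate : Fin m → Fin m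
  negate x = zero ⊖ x

  ρ-⊕ : ∀ a b → ρ a ⊕ ρ b ≡ ρ (a + b)
  ρ-⊕ a b = ρ-cong (toℕ (ρ a) + toℕ (ρ b)) (a + b) (trans (cong₂ (λ u v → (u + v) % m) (toℕ-ρ a) (toℕ-ρ b)) (sym (ℕ.%-distribˡ-+ a b m)))

  ρ-⊗ : ∀ a b → ρ a ⊗ ρ b ≡ ρ (a * b)
  ρ-⊗ a b = ρ-cong (toℕ (ρ a) * toℕ (ρ b)) (a * b) (trans (cong₂ (λ u v → (u * v) % m) (toℕ-ρ a) (toℕ-ρ b)) (sym (ℕ.%-distribˡ-* a b m)))

  -- Every residue is the image of a natural number, so the ring laws are inherited from ℕ by moving
  -- `ρ` outwards.
  elim : (P : Fin m → Set) → (∀ a → P (ρ a)) → ∀ x → P x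
  elim P h x = subst P (ρ-toℕ x) (h (toℕ x))

  ⊕-assoc : ∀ x y z → x ⊕ y ⊕ z ≡ x ⊕ (y ⊕ z)
  ⊕-assoc = elim _ λ a → elim _ λ b → elim _ λ c → begin
    ρ a ⊕ ρ b ⊕ ρ c     ≡⟨ cong (_⊕ ρ c) (ρ-⊕ a b) ⟩
    ρ (a + b) ⊕ ρ c     ≡⟨ ρ-⊕ (a + b) c ⟩
    ρ (a + b + c)       ≡⟨ cong ρ (ℕ.+-assoc a b c) ⟩
    ρ (a + (b + c))     ≡⟨ ρ-⊕ a (b + c) ⟨
    ρ a ⊕ ρ (b + c)     ≡⟨ cong (ρ a ⊕_) (ρ-⊕ b c) ⟨
    ρ a ⊕ (ρ b ⊕ ρ c)   ∎
    where open ≡-Reasoning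

  ⊗-assoc : ∀ x y z → x ⊗ y ⊗ z ≡ x ⊗ (y ⊗ z)
  ⊗-assoc = elim _ λ a → elim _ λ b → elim _ λ c → begin
    ρ a ⊗ ρ b ⊗ ρ c     ≡⟨ cong (_⊗ ρ c) (ρ-⊗ a b) ⟩
    ρ (a * b) ⊗ ρ c     ≡⟨ ρ-⊗ (a * b) c ⟩
    ρ (a * b * c)       ≡⟨ cong ρ (ℕ.*-assoc a b c) ⟩
    ρ (a * (b * c))     ≡⟨ ρ-⊗ a (b * c) ⟨
    ρ a ⊗ ρ (b * c)     ≡⟨ cong (ρ a ⊗_) (ρ-⊗ b c) ⟨
    ρ a ⊗ (ρ b ⊗ ρ c)   ∎
    where open ≡-Reasoning

  ⊕-comm : ∀ x y → x ⊕ y ≡ y ⊕ x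
  ⊕-comm x y = cong ρ (ℕ.+-comm (toℕ x) (toℕ y))

  ⊗-comm : ∀ x y → x ⊗ y ≡ y ⊗ x
  ⊗-comm x y = cong ρ (ℕ.*-comm (toℕ x) (toℕ y))

  ⊕-identityˡ : ∀ x → zero ⊕ x ≡ x
  ⊕-identityˡ = ρ-toℕ

  ⊗-identityˡ : ∀ x → ρ 1 ⊗ x ≡ x
  ⊗-identityˡ = elim _ λ a → trans (ρ-⊗ 1 a) (cong ρ (ℕ.*-identityˡ a))

  ⊗-distribˡ-⊕ : ∀ x y z → x ⊗ (y ⊕ z) ≡ x ⊗ y ⊕ x ⊗ z
  ⊗-distribˡ-⊕ = elim _ λ a → elim _ λ b → elim _ λ c → begin
    ρ a ⊗ (ρ b ⊕ ρ c)         ≡⟨ cong (ρ a ⊗_) (ρ-⊕ b c) ⟩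
    ρ a ⊗ ρ (b + c)           ≡⟨ ρ-⊗ a (b + c) ⟩
    ρ (a * (b + c))           ≡⟨ cong ρ (ℕ.*-distribˡ-+ a b c) ⟩
    ρ (a * b + a * c)         ≡⟨ ρ-⊕ (a * b) (a * c) ⟨
    ρ (a * b) ⊕ ρ (a * c)     ≡⟨ cong₂ _⊕_ (ρ-⊗ a b) (ρ-⊗ a c) ⟨
    ρ a ⊗ ρ b ⊕ ρ a ⊗ ρ c     ∎
    where open ≡-Reasoning

  ⊕-inverseˡ : ∀ x → negate x ⊕ x ≡ zero
  ⊕-inverseˡ x = begin
    negate x ⊕ x              ≡⟨ cong (negate x ⊕_) (ρ-toℕ x) ⟨
    negate x ⊕ ρ (toℕ x)      ≡⟨ ρ-⊕ (m ∸ toℕ x) (toℕ x) ⟩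
    ρ (m ∸ toℕ x + toℕ x)     ≡⟨ cong ρ (ℕ.m∸n+n≡m (ℕ.<⇒≤ (Fin.toℕ<n x))) ⟩
    ρ m                       ≡⟨ ρ-cong m 0 (ℕ.n%n≡0 m) ⟩
    zero                      ∎
    where open ≡-Reasoning

  ⊖-negate : ∀ x y → x ⊖ y ≡ x ⊕ negate y
  ⊖-negate x y = trans (sym (ρ-⊕ (toℕ x) (m ∸ toℕ y))) (cong (_⊕ negate y) (ρ-toℕ x))

  commutativeRing : CommutativeRing _ _
  commutativeRing = record
    { Carrier = Fin m ; _≈_ = _≡_ ; _+_ = _⊕_ ; _*_ = _⊗_ ; -_ = negate ; 0# = zero ; 1# = ρ 1
    ; isCommutativeRing = record
      { isRing = record
        { +-isAbelianGroup = record
          { isGroup = record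
            { isMonoid = record
              { isSemigroup = record
                { isMagma = record { isEquivalence = isEquivalence ; ∙-cong = cong₂ _⊕_ }
                ; assoc = ⊕-assoc }
              ; identity = ⊕-identityˡ , λ x → trans (⊕-comm x zero) (⊕-identityˡ x) }
            ; inverse = ⊕-inverseˡ , λ x → trans (⊕-comm x (negate x)) (⊕-inverseˡ x)
            ; ⁻¹-cong = cong negate }
          ; comm = ⊕-comm }
        ; *-cong = cong₂ _⊗_
        ; *-assoc = ⊗-assoc
        ; *-identity = ⊗-identityˡ , λ x → trans (⊗-comm x (ρ 1)) (⊗-identityˡ x)
        ; distrib = ⊗-distribˡ-⊕ , λ x y z → trans (⊗-comm (y ⊕ z) x)
            (trans (⊗-distribˡ-⊕ x y z) (cong₂ _⊕_ (⊗-comm x y) (⊗-comm x z))) }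
      ; *-comm = ⊗-comm } }

  ring : AlmostCommutativeRing _ _
  ring = fromCommutativeRing commutativeRing λ _ → nothing

  open AlmostCommutativeRing ring using () renaming (_+_ to _+′_; _*_ to _*′_)

  rearrange : ∀ a b c d → a +′ b *′ c +′ d *′ c ≡ a +′ (b +′ d) *′ c
  rearrange = RingSolver.solve-∀ ring

  [x⊖y]⊕y≡x : ∀ x y → x ⊖ y ⊕ y ≡ x
  [x⊖y]⊕y≡x x y = trans (cong (_⊕ y) (⊖-negate x y)) (trans (⊕-assoc x (negate y) y)
    (trans (cong (x ⊕_) (⊕-inverseˡ y)) (trans (⊕-comm x zero) (⊕-identityˡ x))))

  ⊕-cancelʳ : ∀ x y z → x ⊕ z ≡ y ⊕ z → x ≡ y
  ⊕-cancelʳ x y z e = trans (sym (undo x)) (trans (cong (_⊕ negate z) e) (undo y))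
    where
    undo : ∀ w → w ⊕ z ⊕ negate z ≡ w
    undo w = trans (⊕-assoc w z (negate z)) (trans (cong (w ⊕_) (trans (⊕-comm z _) (⊕-inverseˡ z)))
      (trans (⊕-comm w zero) (⊕-identityˡ w)))

  [x⊕y]⊖y≡x : ∀ x y → x ⊕ y ⊖ y ≡ x
  [x⊕y]⊖y≡x x y = ⊕-cancelʳ _ _ y ([x⊖y]⊕y≡x (x ⊕ y) y)

  [x⊕s]⊖[y⊕s]≡x⊖y : ∀ x y s → (x ⊕ s) ⊖ (y ⊕ s) ≡ x ⊖ y
  [x⊕s]⊖[y⊕s]≡x⊖y x y s = ⊕-cancelʳ _ _ (y ⊕ s) (trans ([x⊖y]⊕y≡x (x ⊕ s) (y ⊕ s))
    (sym (trans (sym (⊕-assoc (x ⊖ y) y s)) (cong (_⊕ s) ([x⊖y]⊕y≡x x y)))))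

  -- The line (a, b) takes the value a + c b in the column with multiplier c. Its values y and x in
  -- the columns c and c + δ determine it when δ is a unit: b = (x - y) / δ and a = y - c b.
  module Lines (c δ δ⁻¹ : Fin m) (unit : δ ⊗ δ⁻¹ ≡ ρ 1) where

    slope : Fin m → Fin m → Fin m
    slope y x = (x ⊖ y) ⊗ δ⁻¹

    intercept : Fin m → Fin m → Fin m
    intercept y x = y ⊖ c ⊗ slope y x

    δ⊗slope : ∀ y x → δ ⊗ slope y x ≡ x ⊖ y
    δ⊗slope y x = begin
      δ ⊗ ((x ⊖ y) ⊗ δ⁻¹)     ≡⟨ cong (δ ⊗_) (⊗-comm (x ⊖ y) δ⁻¹) ⟩
      δ ⊗ (δ⁻¹ ⊗ (x ⊖ y))     ≡⟨ ⊗-assoc δ δ⁻¹ (x ⊖ y) ⟨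
      δ ⊗ δ⁻¹ ⊗ (x ⊖ y)       ≡⟨ cong (_⊗ (x ⊖ y)) unit ⟩
      ρ 1 ⊗ (x ⊖ y)           ≡⟨ ⊗-identityˡ (x ⊖ y) ⟩
      x ⊖ y                   ∎
      where open ≡-Reasoning

    line₁ : ∀ y x → intercept y x ⊕ c ⊗ slope y x ≡ y
    line₁ y x = [x⊖y]⊕y≡x y (c ⊗ slope y x)

    line₂ : ∀ y x → intercept y x ⊕ (c ⊕ δ) ⊗ slope y x ≡ x
    line₂ y x = begin
      intercept y x ⊕ (c ⊕ δ) ⊗ slope y x               ≡⟨ rearrange (intercept y x) c (slope y x) δ ⟨
      intercept y x ⊕ c ⊗ slope y x ⊕ δ ⊗ slope y x     ≡⟨ cong₂ _⊕_ (line₁ y x) (δ⊗slope y x) ⟩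
      y ⊕ (x ⊖ y)                                       ≡⟨ ⊕-comm y (x ⊖ y) ⟩
      x ⊖ y ⊕ y                                         ≡⟨ [x⊖y]⊕y≡x x y ⟩
      x                                                 ∎
      where open ≡-Reasoning

    slope-unique : ∀ a b → slope (a ⊕ c ⊗ b) (a ⊕ (c ⊕ δ) ⊗ b) ≡ b
    slope-unique a b = begin
      (a ⊕ (c ⊕ δ) ⊗ b ⊖ (a ⊕ c ⊗ b)) ⊗ δ⁻¹             ≡⟨ cong (λ z → (z ⊖ (a ⊕ c ⊗ b)) ⊗ δ⁻¹) reorder ⟩
      (δ ⊗ b ⊕ (a ⊕ c ⊗ b) ⊖ (a ⊕ c ⊗ b)) ⊗ δ⁻¹         ≡⟨ cong (_⊗ δ⁻¹) ([x⊕y]⊖y≡x (δ ⊗ b) (a ⊕ c ⊗ b)) ⟩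
      δ ⊗ b ⊗ δ⁻¹                                       ≡⟨ ⊗-comm (δ ⊗ b) δ⁻¹ ⟩
      δ⁻¹ ⊗ (δ ⊗ b)                                     ≡⟨ ⊗-assoc δ⁻¹ δ b ⟨
      δ⁻¹ ⊗ δ ⊗ b                                       ≡⟨ cong (_⊗ b) (trans (⊗-comm δ⁻¹ δ) unit) ⟩
      ρ 1 ⊗ b                                           ≡⟨ ⊗-identityˡ b ⟩
      b                                                 ∎
      where
      open ≡-Reasoning
      reorder : a ⊕ (c ⊕ δ) ⊗ b ≡ δ ⊗ b ⊕ (a ⊕ c ⊗ b)
      reorder = trans (sym (rearrange a c b δ)) (⊕-comm (a ⊕ c ⊗ b) (δ ⊗ b))

    intercept-unique : ∀ a b → intercept (a ⊕ c ⊗ b) (a ⊕ (c ⊕ δ) ⊗ b) ≡ a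
    intercept-unique a b = trans (cong (λ z → a ⊕ c ⊗ b ⊖ c ⊗ z) (slope-unique a b)) ([x⊕y]⊖y≡x a (c ⊗ b))

-- Transversal designs

-- The columns have multipliers 0, ..., k - 1, so all differences are ± d with 1 ≤ d < k, and it
-- suffices to invert these d.
module Slopes (n k : ℕ) (inverse : ℕ → ℕ)
  (unit : ∀ d → 1 ≤ d → d < k → Residues.ρ n (d * inverse d) ≡ Residues.ρ n 1) where

  open Residues n

  -- This is (-1)² = 1: adding 2 m to n² gives 1 + m².
  ρ[n*n]≡ρ1 : ρ (n * n) ≡ ρ 1
  ρ[n*n]≡ρ1 = trans (sym (ρ-drop (n * n) 2)) (trans (cong ρ (square n)) (ρ-drop 1 m))
    where
    square : ∀ n → n * n + 2 * suc n ≡ 1 + suc n * suc n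
    square = solve-∀

  c : Fin k → Fin m
  c i = ρ (toℕ i)

  δ δ⁻¹ : Fin k → Fin k → Fin m
  δ i j with ℕ.<-cmp (toℕ i) (toℕ j)
  ... | tri< _ _ _ = ρ (toℕ j ∸ toℕ i)
  ... | tri≈ _ _ _ = zero
  -- n represents −1 modulo m = n + 1
  ... | tri> _ _ _ = ρ ((toℕ i ∸ toℕ j) * n)
  δ⁻¹ i j with ℕ.<-cmp (toℕ i) (toℕ j)
  ... | tri< _ _ _ = ρ (inverse (toℕ j ∸ toℕ i))
  ... | tri≈ _ _ _ = zero
  ... | tri> _ _ _ = ρ (inverse (toℕ i ∸ toℕ j) * n)

  c⊕δ : ∀ i j → i ≢ j → c i ⊕ δ i j ≡ c j
  c⊕δ i j i≢j with ℕ.<-cmp (toℕ i) (toℕ j)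
  ... | tri< i<j _ _ = trans (ρ-⊕ (toℕ i) _) (cong ρ (ℕ.m+[n∸m]≡n (ℕ.<⇒≤ i<j)))
  ... | tri≈ _ i≡j _ = contradiction (Fin.toℕ-injective i≡j) i≢j
  ... | tri> _ _ j<i = begin
    c i ⊕ ρ (d * n)             ≡⟨ ρ-⊕ (toℕ i) (d * n) ⟩
    ρ (toℕ i + d * n)           ≡⟨ cong (λ z → ρ (z + d * n)) (ℕ.m+[n∸m]≡n (ℕ.<⇒≤ j<i)) ⟨
    ρ (toℕ j + d + d * n)       ≡⟨ cong ρ (collect (toℕ j) d n) ⟩
    ρ (toℕ j + d * m)           ≡⟨ ρ-drop (toℕ j) d ⟩
    c j                         ∎
    where
    open ≡-Reasoning
    d = toℕ i ∸ toℕ j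
    collect : ∀ j d n → j + d + d * n ≡ j + d * suc n
    collect = solve-∀

  δ-unit : ∀ i j → i ≢ j → δ i j ⊗ δ⁻¹ i j ≡ ρ 1
  δ-unit i j i≢j with ℕ.<-cmp (toℕ i) (toℕ j)
  ... | tri< i<j _ _ = trans (ρ-⊗ (toℕ j ∸ toℕ i) _)
    (unit _ (ℕ.m<n⇒0<n∸m i<j) (ℕ.≤-<-trans (ℕ.m∸n≤m _ (toℕ i)) (Fin.toℕ<n j)))
  ... | tri≈ _ i≡j _ = contradiction (Fin.toℕ-injective i≡j) i≢j
  ... | tri> _ _ j<i = begin
    ρ (d * n) ⊗ ρ (inverse d * n)   ≡⟨ ρ-⊗ (d * n) (inverse d * n) ⟩
    ρ (d * n * (inverse d * n))     ≡⟨ cong ρ (collect d n (inverse d)) ⟩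
    ρ (d * inverse d * (n * n))     ≡⟨ ρ-⊗ (d * inverse d) (n * n) ⟨
    ρ (d * inverse d) ⊗ ρ (n * n)   ≡⟨ cong₂ _⊗_ (unit d (ℕ.m<n⇒0<n∸m j<i)
                                         (ℕ.≤-<-trans (ℕ.m∸n≤m _ (toℕ j)) (Fin.toℕ<n i))) ρ[n*n]≡ρ1 ⟩
    ρ 1 ⊗ ρ 1                       ≡⟨ ⊗-identityˡ (ρ 1) ⟩
    ρ 1                             ∎
    where
    open ≡-Reasoning
    d = toℕ i ∸ toℕ j
    collect : ∀ d n e → d * n * (e * n) ≡ d * e * (n * n)
    collect = solve-∀

  value : Fin k → Fin m × Fin m → Fin m
  value i (a , b) = a ⊕ c i ⊗ b

  through : Fin k → Fin k → Fin m → Fin m → Fin m × Fin m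
  through i j y x = y ⊖ c i ⊗ b , b
    where b = (x ⊖ y) ⊗ δ⁻¹ i j

  value-through₁ : ∀ i j y x → value i (through i j y x) ≡ y
  value-through₁ i j y x = [x⊖y]⊕y≡x y _

  value-through₂ : ∀ i j y x → i ≢ j → value j (through i j y x) ≡ x
  value-through₂ i j y x i≢j = trans
    (cong (λ z → proj₁ (through i j y x) ⊕ z ⊗ proj₂ (through i j y x)) (sym (c⊕δ i j i≢j)))
    (Lines.line₂ (c i) (δ i j) (δ⁻¹ i j) (δ-unit i j i≢j) y x)

  through-values : ∀ i j → i ≢ j → ∀ B → through i j (value i B) (value j B) ≡ B
  through-values i j i≢j (a , b) = trans
    (cong (λ z → through i j (a ⊕ c i ⊗ b) (a ⊕ z ⊗ b)) (sym (c⊕δ i j i≢j)))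
    (cong₂ _,_ (intercept-unique a b) (slope-unique a b))
    where open Lines (c i) (δ i j) (δ⁻¹ i j) (δ-unit i j i≢j)

-- Resolvable transversal designs: the colour of an arithmetic progression x, x + s, x + 2s is s.
transversal : ∀ h → Decomposition three (Fin 3 × Fin (suc (h + h))) DifferentFirst (λ _ → Fin (suc (h + h)))
transversal h = record
  { col = λ { (i , x) (j , y) → just (tt , proj₂ (through i j x y)) }
  ; pos = λ _ → proj₁
  ; at = λ { s (i , x) j → j , value j (x ⊖ c i ⊗ s , s) }
  ; pos-at = λ _ _ _ → refl
  ; at-pos = λ { s (i , x) → cong (i ,_) ([x⊖y]⊕y≡x x _) }
  ; at-at = λ { s (i , x) j l → cong (λ z → l , value l (z , s)) ([x⊕y]⊖y≡x (x ⊖ c i ⊗ s) (c j ⊗ s)) }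
  ; sound = λ { s (i , x) nb → neighbours⇒≢ nb ,
      cong (λ z → just (tt , proj₂ z)) (through-values _ _ (neighbours⇒≢ nb) (x ⊖ c i ⊗ s , s)) }
  ; complete = λ { {i , x} {j , y} i≢j → tt , proj₂ (through i j x y) , refl ,
      cong (j ,_) (value-through₂ i j x y i≢j) , ≢⇒neighbours i≢j } }
  where
  inverse : ℕ → ℕ
  -- Half of 1 modulo 2 h + 1, as 2 (h + 1) = (2 h + 1) + 1; here the odd order matters.
  inverse 2 = suc h
  inverse _ = 1
  unit : ∀ d → 1 ≤ d → d < 3 → Residues.ρ (h + h) (d * inverse d) ≡ Residues.ρ (h + h) 1
  unit 1 _ _ = refl
  unit 2 _ _ = trans (cong ρ (double h)) (ρ-drop 1 1)
    where
    open Residues (h + h)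
    double : ∀ h → 2 * suc h ≡ 1 + 1 * suc (h + h)
    double = solve-∀
  unit (suc (suc (suc _))) _ (s≤s (s≤s (s≤s ())))
  open Slopes (h + h) 3 inverse unit
  open Residues (h + h)

-- A transversal design TD(5, m); blocks are pairs, and block B meets group i in the point f i B.
record TransversalDesign (m : ℕ) : Set where
  field
    f : Fin 5 → Fin m × Fin m → Fin m
    block : Fin 5 → Fin 5 → Fin m → Fin m → Fin m × Fin m
    f-block₁ : ∀ i j x y → i ≢ j → f i (block i j x y) ≡ x
    f-block₂ : ∀ i j x y → i ≢ j → f j (block i j x y) ≡ y
    block-f : ∀ i j → i ≢ j → ∀ B → block i j (f i B) (f j B) ≡ B

-- Four columns have the multipliers 0, 1, 2, 3; the fifth is the column at infinity, which reads
-- off the slope b.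
linear-TD : ∀ n (inverse : ℕ → ℕ) → (∀ d → 1 ≤ d → d < 4 → Residues.ρ n (d * inverse d) ≡ Residues.ρ n 1) →
            TransversalDesign (suc n)
linear-TD n inverse unit = record
  { f = f ; block = block ; f-block₁ = f-block₁ ; f-block₂ = f-block₂ ; block-f = block-f }
  where
  open Slopes n 4 inverse unit
  open Residues n
  f : Fin 5 → Fin m × Fin m → Fin m
  f zero (_ , b) = b
  f (suc i) B = value i B
  block : Fin 5 → Fin 5 → Fin m → Fin m → Fin m × Fin m
  block zero zero x y = x , y
  block zero (suc j) x y = y ⊖ c j ⊗ x , x
  block (suc i) zero x y = x ⊖ c i ⊗ y , y
  block (suc i) (suc j) x y = through i j x y
  f-block₁ : ∀ i j x y → i ≢ j → f i (block i j x y) ≡ x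
  f-block₁ zero zero x y n = contradiction refl n
  f-block₁ zero (suc j) x y _ = refl
  f-block₁ (suc i) zero x y _ = [x⊖y]⊕y≡x x _
  f-block₁ (suc i) (suc j) x y _ = value-through₁ i j x y
  f-block₂ : ∀ i j x y → i ≢ j → f j (block i j x y) ≡ y
  f-block₂ zero zero x y n = contradiction refl n
  f-block₂ zero (suc j) x y _ = [x⊖y]⊕y≡x y _
  f-block₂ (suc i) zero x y _ = refl
  f-block₂ (suc i) (suc j) x y n = value-through₂ i j x y λ e → n (cong suc e)
  block-f : ∀ i j → i ≢ j → ∀ B → block i j (f i B) (f j B) ≡ B
  block-f zero zero n _ = contradiction refl n
  block-f zero (suc j) _ (a , b) = cong (_, b) ([x⊕y]⊖y≡x a _)
  block-f (suc i) zero _ (a , b) = cong (_, b) ([x⊕y]⊖y≡x a _)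
  block-f (suc i) (suc j) n B = through-values i j (λ e → n (cong suc e)) B

TD-6q+1 : ∀ q → TransversalDesign (1 + 6 * q)
TD-6q+1 q = linear-TD (6 * q) inverse unit
  where
  open Residues (6 * q)
  inverse : ℕ → ℕ
  inverse 2 = 1 + 3 * q
  inverse 3 = 1 + 4 * q
  inverse _ = 1
  unit : ∀ d → 1 ≤ d → d < 4 → ρ (d * inverse d) ≡ ρ 1
  unit 1 _ _ = refl
  unit 2 _ _ = trans (cong ρ (twice q)) (ρ-drop 1 1)
    where
    twice : ∀ q → 2 * (1 + 3 * q) ≡ 1 + 1 * (1 + 6 * q)
    twice = solve-∀
  unit 3 _ _ = trans (cong ρ (thrice q)) (ρ-drop 1 2)
    where
    thrice : ∀ q → 3 * (1 + 4 * q) ≡ 1 + 2 * (1 + 6 * q)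
    thrice = solve-∀
  unit (suc (suc (suc (suc _)))) _ (s≤s (s≤s (s≤s (s≤s ()))))

TD-6q+5 : ∀ q → TransversalDesign (5 + 6 * q)
TD-6q+5 q = linear-TD (4 + 6 * q) inverse unit
  where
  open Residues (4 + 6 * q)
  inverse : ℕ → ℕ
  inverse 2 = 3 + 3 * q
  inverse 3 = 2 + 2 * q
  inverse _ = 1
  unit : ∀ d → 1 ≤ d → d < 4 → ρ (d * inverse d) ≡ ρ 1
  unit 1 _ _ = refl
  unit 2 _ _ = trans (cong ρ (twice q)) (ρ-drop 1 1)
    where
    twice : ∀ q → 2 * (3 + 3 * q) ≡ 1 + 1 * (5 + 6 * q)
    twice = solve-∀
  unit 3 _ _ = trans (cong ρ (thrice q)) (ρ-drop 1 1)
    where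
    thrice : ∀ q → 3 * (2 + 2 * q) ≡ 1 + 1 * (5 + 6 * q)
    thrice = solve-∀
  unit (suc (suc (suc (suc _)))) _ (s≤s (s≤s (s≤s (s≤s ()))))

-- Points over different elements of `Fin v` are joined by the inflation of R₁ with resolvable
-- transversal designs. Points over the same element form a copy of R₂, and all these copies use the
-- same classes C₂.
RGDD-product : ∀ {v h C₁ C₂} → RGDD (Fin v) C₁ → RGDD (Fin (suc (h + h))) C₂ →
               RGDD (Fin v × Fin (suc (h + h))) (C₁ × Fin (suc (h + h)) ⊎ C₂)
RGDD-product {v} {h} {C₁} {C₂} R₁ R₂ = reindex regroup (λ e → e) (λ e → e) (λ _ → ↔-refl)
  (union differentFirst? (λ {x} {y} → split {x} {y}) (λ n e → n (cong proj₁ e))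
    (λ { (refl , n) e → n (cong proj₂ e) }) (λ n (e , _) → n e)
    (inflate R₁ (λ _ → transversal h)) (copies (Fin v) columns))
  where
  W = Fin (suc (h + h))
  regroup : ((Fin v × W) × Fin 3) ↔ (Fin v × (Fin 3 × W))
  regroup = mk↔ₛ′ (λ { ((a , w) , i) → a , i , w }) (λ { (a , i , w) → (a , w) , i }) (λ _ → refl) (λ _ → refl)
  key : Fin v × (Fin 3 × W) → Fin v × W
  key (a , i , w) = a , w
  columns : Decomposition three (Fin 3 × W) (λ p q → proj₂ p ≢ proj₂ q) (λ _ → C₂)
  columns = reindex (mk↔ₛ′ (λ { (i , w) → w , i }) (λ { (w , i) → i , w }) (λ _ → refl) (λ _ → refl))
    (λ e → e) (λ e → e) (λ _ → ↔-refl) R₂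
  split : ∀ {x y} → key x ≢ key y →
          DifferentFirst x y ⊎ (proj₁ x ≡ proj₁ y × proj₂ (proj₂ x) ≢ proj₂ (proj₂ y))
  split {x} {y} n with proj₁ x Fin.≟ proj₁ y
  ... | yes e = inj₂ (e , λ e′ → n (cong₂ _,_ e e′))
  ... | no ¬e = inj₁ ¬e

-- Starters

-- Classes of the first kind are the transversal triangles {(x + offset k i, i)}, classes of the
-- second kind are the translates of one parallel class; orbit i j d is the class of {(0, i), (d, j)}.
module Starter (n q : ℕ) (offset : Fin q → Fin 3 → Fin (suc n))
  (vertex : Fin (suc n) × Fin 3 → Fin (suc n) × Fin 3)
  (locate : Fin (suc n) × Fin 3 → Fin (suc n) × Fin 3)
  (orbit : Fin 3 → Fin 3 → Fin (suc n) → Fin q ⊎ Fin (suc n)) where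

  open Residues n

  -- For `inj₂ s` the pair (0, i), (d, j) is moved back by s into the base class, where it has to
  -- lie in one triangle.
  Joined : Fin 3 → Fin 3 → Fin m → Fin q ⊎ Fin m → Set
  Joined i j d (inj₁ k) = offset k j ≡ d ⊕ offset k i × i ≢ j
  Joined i j d (inj₂ s) = proj₁ (locate (zero ⊖ s , i)) ≡ proj₁ (locate (d ⊖ s , j)) ×
                          proj₂ (locate (zero ⊖ s , i)) ≢ proj₂ (locate (d ⊖ s , j))

  Separated : Fin m × Fin 3 → Fin m × Fin 3 → Fin q ⊎ Fin m → Set
  Separated (x , a) (y , b) o = x ≢ y × orbit a b (y ⊖ x) ≡ o

  record IsStarter : Set where
    field
      locate-vertex : ∀ t i → locate (vertex (t , i)) ≡ (t , i)
      vertex-locate : ∀ x a → vertex (locate (x , a)) ≡ (x , a)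
      transversal-classes : ∀ k i j → i ≢ j → Separated (offset k i , i) (offset k j , j) (inj₁ k)
      -- `orbit` expects the first point at 0. If that point is at x in the base class, moving it to
      -- 0 puts the pair into the translate by -x.
      translates : ∀ t i j → i ≢ j →
        Separated (vertex (t , i)) (vertex (t , j)) (inj₂ (negate (proj₁ (vertex (t , i)))))
      joined : ∀ i j d → d ≢ zero → Joined i j d (orbit i j d)

  private
    _≟₂_ : DecidableEquality (Fin m × Fin 3)
    _≟₂_ = Product.≡-dec Fin._≟_ Fin._≟_

    separated? : ∀ p p′ o → Dec (Separated p p′ o)
    separated? (x , a) (y , b) o =
      ¬? (x Fin.≟ y) ×-dec Sum.≡-dec Fin._≟_ Fin._≟_ (orbit a b (y ⊖ x)) o

    joined? : ∀ i j d o → Dec (Joined i j d o)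
    joined? i j d (inj₁ k) = offset k j Fin.≟ (d ⊕ offset k i) ×-dec ¬? (i Fin.≟ j)
    joined? i j d (inj₂ s) = (proj₁ (locate (zero ⊖ s , i)) Fin.≟ proj₁ (locate (d ⊖ s , j))) ×-dec
                          ¬? (proj₂ (locate (zero ⊖ s , i)) Fin.≟ proj₂ (locate (d ⊖ s , j)))

  isStarter? : Dec IsStarter
  isStarter? = map′
    (λ (a , b , c , d , e) → record
      { locate-vertex = a ; vertex-locate = b ; transversal-classes = c ; translates = d ; joined = e })
    (λ S → let open IsStarter S in locate-vertex , vertex-locate , transversal-classes , translates , joined)
    ((Fin.all? λ t → Fin.all? λ i → locate (vertex (t , i)) ≟₂ (t , i)) ×-dec
     (Fin.all? λ x → Fin.all? λ a → vertex (locate (x , a)) ≟₂ (x , a)) ×-dec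
     (Fin.all? λ k → Fin.all? λ i → Fin.all? λ j → ¬? (i Fin.≟ j) →-dec
       separated? (offset k i , i) (offset k j , j) (inj₁ k)) ×-dec
     (Fin.all? λ t → Fin.all? λ i → Fin.all? λ j → ¬? (i Fin.≟ j) →-dec
       separated? (vertex (t , i)) (vertex (t , j)) (inj₂ (negate (proj₁ (vertex (t , i)))))) ×-dec
     (Fin.all? λ i → Fin.all? λ j → Fin.all? λ d → ¬? (d Fin.≟ zero) →-dec joined? i j d (orbit i j d)))

  develop : IsStarter → RGDD (Fin m) (Fin q ⊎ Fin m)
  develop S = record
    { col = col ; pos = pos ; at = at ; pos-at = pos-at ; at-pos = at-pos ; at-at = at-at
    ; sound = sound ; complete = complete }
    where
    open IsStarter S
    C = Fin q ⊎ Fin m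
    V = Fin m × Fin 3
    shift : Fin m → V → V
    shift s (x , a) = x ⊕ s , a
    unshift : Fin m → V → V
    unshift s (x , a) = x ⊖ s , a
    unshift-shift : ∀ s p → unshift s (shift s p) ≡ p
    unshift-shift s (x , a) = cong (_, a) ([x⊕y]⊖y≡x x s)
    shift-unshift : ∀ s p → shift s (unshift s p) ≡ p
    shift-unshift s (x , a) = cong (_, a) ([x⊖y]⊕y≡x x s)
    -- Transversal classes are invariant under translation, whereas translates of the base class
    -- have their shift increased.
    colour-shift : Fin m → C → C
    colour-shift z = Sum.map₂ (_⊕ z)
    colour : V → V → C
    colour (z , a) (w , b) = colour-shift z (orbit a b (w ⊖ z))
    col : V → V → Maybe (⊤ × C)
    col p r = just (tt , colour p r)
    pos : C → V → Fin 3
    pos (inj₁ k) (x , i) = i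
    pos (inj₂ s) p = proj₂ (locate (unshift s p))
    at : C → V → Fin 3 → V
    at (inj₁ k) (x , i) j = x ⊖ offset k i ⊕ offset k j , j
    at (inj₂ s) p j = shift s (vertex (proj₁ (locate (unshift s p)) , j))
    pos-at : ∀ c p i → pos c (at c p i) ≡ i
    pos-at (inj₁ k) p i = refl
    pos-at (inj₂ s) p i = trans (cong (λ z → proj₂ (locate z)) (unshift-shift s _))
                            (cong proj₂ (locate-vertex _ i))
    at-pos : ∀ c p → at c p (pos c p) ≡ p
    at-pos (inj₁ k) (x , i) = cong (_, i) ([x⊖y]⊕y≡x x (offset k i))
    at-pos (inj₂ s) p = trans (cong (shift s) (vertex-locate _ _)) (shift-unshift s p)
    at-at : ∀ c p i j → at c (at c p i) j ≡ at c p j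
    at-at (inj₁ k) (x , i) j l = cong (λ z → z ⊕ offset k l , l) ([x⊕y]⊖y≡x (x ⊖ offset k i) (offset k j))
    at-at (inj₂ s) p i j = cong (λ z → shift s (vertex (z , j)))
      (trans (cong (λ z → proj₁ (locate z)) (unshift-shift s _)) (cong proj₁ (locate-vertex _ i)))
    shift-colour : ∀ p r s → colour (shift s p) (shift s r) ≡
                   colour-shift (proj₁ p ⊕ s) (orbit (proj₂ p) (proj₂ r) (proj₁ r ⊖ proj₁ p))
    shift-colour (x , a) (y , b) s = cong (λ d → colour-shift (x ⊕ s) (orbit a b d)) ([x⊕s]⊖[y⊕s]≡x⊖y y x s)
    shift-≢ : ∀ {x y} s → x ≢ y → x ⊕ s ≢ y ⊕ s
    shift-≢ s n e = n (⊕-cancelʳ _ _ s e)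
    sound : ∀ c p {i j} → Neighbours i j →
            DifferentFirst (at c p i) (at c p j) × col (at c p i) (at c p j) ≡ just (tt , c)
    sound (inj₁ k) (x , l) {i} {j} nb with transversal-classes k i j (neighbours⇒≢ nb)
    ... | n , e = (λ e′ → n (⊕-cancelʳ _ _ z (trans (⊕-comm (offset k i) z) (trans e′ (⊕-comm z (offset k j)))))) ,
        cong (λ c → just (tt , c)) (trans
          (cong₂ (λ u w → colour (u , i) (w , j)) (⊕-comm z (offset k i)) (⊕-comm z (offset k j)))
          (trans (shift-colour (offset k i , i) (offset k j , j) z) (cong (colour-shift _) e)))
      where z = x ⊖ offset k l
    sound (inj₂ s) p {i} {j} nb with translates (proj₁ (locate (unshift s p))) i j (neighbours⇒≢ nb)
    ... | n , e = shift-≢ s n , cong (λ c → just (tt , c))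
        (trans (shift-colour (vertex (t , i)) (vertex (t , j)) s)
          (trans (cong (colour-shift _) e) (cong inj₂ (begin
            negate x ⊕ (x ⊕ s)    ≡⟨ ⊕-assoc (negate x) x s ⟨
            negate x ⊕ x ⊕ s      ≡⟨ cong (_⊕ s) (⊕-inverseˡ x) ⟩
            zero ⊕ s              ≡⟨ ⊕-identityˡ s ⟩
            s                     ∎))))
      where
      open ≡-Reasoning
      t = proj₁ (locate (unshift s p))
      x = proj₁ (vertex (t , i))
    complete : ∀ {p r} → DifferentFirst p r → Σ[ l ∈ ⊤ ] Σ[ c ∈ C ]
               (col p r ≡ just (l , c) × at c p (pos c r) ≡ r × Neighbours (pos c p) (pos c r))
    complete {z , a} {w , b} z≢w = tt , colour (z , a) (w , b) , refl ,
      body (orbit a b d) (joined a b d λ e → z≢w (sym (trans (sym w≡d⊕z) (trans (cong (_⊕ z) e) (⊕-identityˡ z)))))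
      where
      d = w ⊖ z
      w≡d⊕z : d ⊕ z ≡ w
      w≡d⊕z = [x⊖y]⊕y≡x w z
      body : ∀ o → Joined a b d o → at (colour-shift z o) (z , a) (pos (colour-shift z o) (w , b)) ≡ (w , b) ×
               Neighbours (pos (colour-shift z o) (z , a)) (pos (colour-shift z o) (w , b))
      body (inj₁ k) (e , a≢b) = cong (_, b) (begin
        z ⊖ offset k a ⊕ offset k b          ≡⟨ cong (z ⊖ offset k a ⊕_) (trans e (⊕-comm d _)) ⟩
        z ⊖ offset k a ⊕ (offset k a ⊕ d)    ≡⟨ ⊕-assoc (z ⊖ offset k a) _ d ⟨
        z ⊖ offset k a ⊕ offset k a ⊕ d      ≡⟨ cong (_⊕ d) ([x⊖y]⊕y≡x z (offset k a)) ⟩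
        z ⊕ d                                ≡⟨ trans (⊕-comm z d) w≡d⊕z ⟩
        w                                    ∎) , ≢⇒neighbours a≢b
        where open ≡-Reasoning
      body (inj₂ s) (same , differ) =
        (begin
          shift (s ⊕ z) (vertex (proj₁ (locate (z ⊖ (s ⊕ z) , a)) , proj₂ (locate (w ⊖ (s ⊕ z) , b))))
            ≡⟨ cong (λ u → shift (s ⊕ z) (vertex (u , proj₂ (locate (w ⊖ (s ⊕ z) , b))))) same′ ⟩
          shift (s ⊕ z) (vertex (locate (w ⊖ (s ⊕ z) , b)))
            ≡⟨ cong (shift (s ⊕ z)) (vertex-locate _ _) ⟩
          shift (s ⊕ z) (unshift (s ⊕ z) (w , b))
            ≡⟨ shift-unshift (s ⊕ z) (w , b) ⟩
          (w , b) ∎) ,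
        ≢⇒neighbours (subst₂ (λ u u′ → proj₂ (locate (u , a)) ≢ proj₂ (locate (u′ , b))) (sym z-base) (sym w-base) differ)
        where
        open ≡-Reasoning
        z-base : z ⊖ (s ⊕ z) ≡ zero ⊖ s
        z-base = trans (cong (_⊖ (s ⊕ z)) (sym (⊕-identityˡ z))) ([x⊕s]⊖[y⊕s]≡x⊖y zero s z)
        w-base : w ⊖ (s ⊕ z) ≡ d ⊖ s
        w-base = trans (cong (_⊖ (s ⊕ z)) (sym w≡d⊕z)) ([x⊕s]⊖[y⊕s]≡x⊖y d s z)
        same′ : proj₁ (locate (z ⊖ (s ⊕ z) , a)) ≡ proj₁ (locate (w ⊖ (s ⊕ z) , b))
        same′ = subst₂ (λ u u′ → proj₁ (locate (u , a)) ≡ proj₁ (locate (u′ , b))) (sym z-base) (sym w-base) same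

-- Kirkman frames and truncated transversal designs

Point : Set
Point = (Fin 5 × Bool) × Fin 3

group : Point → Fin 5
group p = proj₁ (proj₁ p)

-- Kirkman frames of type 6^u, whose groups are the u elements of Fin 5 satisfying Alive.
record Frame (Alive : Fin 5 → Set) : Set where
  field
    col : Point → Point → Fin 5 × Fin 3
    pos : Fin 5 × Fin 3 → Point → Fin 3
    at  : Fin 5 × Fin 3 → Point → Fin 3 → Point
  -- Colour (g, u) is the u-th of the three partial parallel classes that miss exactly the group g,
  -- so its laws are required only off that group.
  Outside : Fin 5 → Point → Set
  Outside g p = Alive (group p) × group p ≢ g
  field
    outside : ∀ {g} u {p} → Alive g → Outside g p → ∀ i → Outside g (at (g , u) p i)
    pos-at  : ∀ {g} u {p} → Alive g → Outside g p → ∀ i → pos (g , u) (at (g , u) p i) ≡ i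
    at-pos  : ∀ {g} u {p} → Alive g → Outside g p → at (g , u) p (pos (g , u) p) ≡ p
    at-at   : ∀ {g} u {p} → Alive g → Outside g p → ∀ i j → at (g , u) (at (g , u) p i) j ≡ at (g , u) p j
    sound   : ∀ {g} u {p} → Alive g → Outside g p → ∀ {i j} → i ≢ j →
              group (at (g , u) p i) ≢ group (at (g , u) p j) ×
              col (at (g , u) p i) (at (g , u) p j) ≡ (g , u)
    complete : ∀ {p q} → Alive (group p) → Alive (group q) → group p ≢ group q →
               Alive (proj₁ (col p q)) × group p ≢ proj₁ (col p q) × group q ≢ proj₁ (col p q) ×
               at (col p q) p (pos (col p q) q) ≡ q × pos (col p q) p ≢ pos (col p q) q

frame-cong : ∀ {P Q : Fin 5 → Set} → (∀ i → P i → Q i) → (∀ i → Q i → P i) → Frame P → Frame Q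
frame-cong to from F = record
  { col = col ; pos = pos ; at = at
  ; outside = λ u a o i → map₁ (to _) (outside u (from _ a) (map₁ (from _) o) i)
  ; pos-at = λ u a o → pos-at u (from _ a) (map₁ (from _) o)
  ; at-pos = λ u a o → at-pos u (from _ a) (map₁ (from _) o)
  ; at-at = λ u a o → at-at u (from _ a) (map₁ (from _) o)
  ; sound = λ u a o → sound u (from _ a) (map₁ (from _) o)
  ; complete = λ a b n → map₁ (to _) (complete (from _ a) (from _ b) n) }
  where open Frame F

-- A resolvable 3-GDD of type 3^(2|T| + 1), that is a KTS(6|T| + 3) without one of its parallel classes.
KirkmanGDD : Set → Set
KirkmanGDD T = RGDD (Maybe (T × Bool)) (T × Fin 3)

-- Every point x of the truncated design becomes six points and owns three classes; three points at
-- infinity are added. The class (x, u) consists of the u-th frame class missing x on each block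
-- through x, and of the class (x, u) of the filling on the group of x with infinity. The blocks
-- through x partition the points outside its group, hence the pieces form a parallel class.
module Truncation {m : ℕ} (D : TransversalDesign m) (h : ℕ) (h≤m : h ≤ m)
  (F₅ : Frame (λ _ → ⊤)) (F₄ : Frame (_≢ zero))
  (Gₘ : KirkmanGDD (Fin m)) (Gₕ : KirkmanGDD (Fin h)) where

  open TransversalDesign D

  Block : Set
  Block = Fin m × Fin m

  size : Fin 5 → ℕ
  size zero = h
  size (suc _) = m

  size≤m : ∀ i → size i ≤ m
  size≤m zero = h≤m
  size≤m (suc _) = ℕ.≤-refl

  T : Set
  T = Σ[ i ∈ Fin 5 ] Fin (size i)

  V : Set
  V = Maybe (T × Bool) × Fin 3

  Colour : Set
  Colour = T × Fin 3

  fill : ∀ g → KirkmanGDD (Fin (size g))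
  fill zero = Gₕ
  fill (suc _) = Gₘ

  module G (g : Fin 5) = Decomposition (fill g)

  Alive : Block → Fin 5 → Set
  Alive B i = toℕ (f i B) < size i

  -- Only group zero is truncated, so a block keeps all five points or loses just the one in that
  -- group.
  frame : ∀ B → Frame (Alive B)
  frame B with toℕ (f zero B) ℕ.<? h
  ... | yes a = frame-cong (λ { zero _ → a ; (suc i) _ → Fin.toℕ<n (f (suc i) B) }) (λ _ _ → tt) F₅
  ... | no ¬a = frame-cong (λ { zero n → contradiction refl n ; (suc i) _ → Fin.toℕ<n (f (suc i) B) })
                           (λ { zero a → contradiction a ¬a ; (suc i) _ () }) F₄

  module F (B : Block) = Frame (frame B)

  incl : ∀ i → Fin (size i) → Fin m
  incl i e = inject≤ e (size≤m i)

  On : Block → ∀ i → Fin (size i) → Set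
  On B i e = f i B ≡ incl i e

  on⇒alive : ∀ {B i e} → On B i e → Alive B i
  on⇒alive {B} {i} {e} on =
    subst (_< size i) (sym (trans (cong toℕ on) (Fin.toℕ-inject≤ e (size≤m i)))) (Fin.toℕ<n e)

  alive⇒on : ∀ {B i} → Alive B i → Σ[ e ∈ Fin (size i) ] On B i e
  alive⇒on {B} {i} a = fromℕ< a , Fin.toℕ-injective
    (sym (trans (Fin.toℕ-inject≤ (fromℕ< a) (size≤m i)) (Fin.toℕ-fromℕ< a)))

  -- The point of B in group i; the junk value d is returned if that point has been deleted.
  point : T → Block → Fin 5 → T
  point d B i with toℕ (f i B) ℕ.<? size i
  ... | yes a = i , fromℕ< a
  ... | no _ = d

  point-on : ∀ d {B i e} → On B i e → point d B i ≡ (i , e)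
  point-on d {B} {i} {e} on with toℕ (f i B) ℕ.<? size i
  ... | yes a = cong (i ,_) (Fin.toℕ-injective (trans (Fin.toℕ-fromℕ< a)
                  (trans (cong toℕ on) (Fin.toℕ-inject≤ e (size≤m i)))))
  ... | no ¬a = contradiction (on⇒alive on) ¬a

  place : T → Block → Point → V
  place d B ((i , b) , j) = just (point d B i , b) , j

  place-on : ∀ d {B i e} b j → On B i e → place d B ((i , b) , j) ≡ (just ((i , e) , b) , j)
  place-on d b j on = cong (λ z → just (z , b) , j) (point-on d on)

  place-cong : ∀ d d′ {B p} → Alive B (group p) → place d B p ≡ place d′ B p
  place-cong d d′ {p = (i , b) , j} a = let e , on = alive⇒on a in
    trans (place-on d b j on) (sym (place-on d′ b j on))

  embed : ∀ g → Maybe (Fin (size g) × Bool) × Fin 3 → V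
  embed g (nothing , j) = nothing , j
  embed g (just (e , b) , j) = just ((g , e) , b) , j

  join : ∀ g i → Fin (size g) → Fin (size i) → Block
  join g i e e′ = block g i (incl g e) (incl i e′)

  join-on₁ : ∀ g i {e e′} → g ≢ i → On (join g i e e′) g e
  join-on₁ g i n = f-block₁ g i _ _ n

  join-on₂ : ∀ g i {e e′} → g ≢ i → On (join g i e e′) i e′
  join-on₂ g i n = f-block₂ g i _ _ n

  join-unique : ∀ {B} g i {e e′} → g ≢ i → On B g e → On B i e′ → join g i e e′ ≡ B
  join-unique {B} g i n on on′ = trans (cong₂ (block g i) (sym on) (sym on′)) (block-f g i n B)

  data Side (g : Fin 5) : V → Set where
    inside  : ∀ w → Side g (embed g w)
    outside : ∀ i e b j → i ≢ g → Side g (just ((i , e) , b) , j)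

  side : ∀ g v → Side g v
  side g (nothing , j) = inside (nothing , j)
  side g (just ((i , e) , b) , j) with i Fin.≟ g
  ... | yes refl = inside (just (e , b) , j)
  ... | no n = outside i e b j n

  side-embed : ∀ g w → side g (embed g w) ≡ inside w
  side-embed g (nothing , j) = refl
  side-embed g (just (e , b) , j) with g Fin.≟ g
  ... | yes refl = refl
  ... | no n = contradiction refl n

  side-outside : ∀ g {i} e b j → i ≢ g → Σ[ n ∈ i ≢ g ] side g (just ((i , e) , b) , j) ≡ outside i e b j n
  side-outside g {i} e b j n with i Fin.≟ g
  ... | yes i≡g = contradiction i≡g n
  ... | no n′ = n′ , refl

  -- A point outside group g lies on exactly one block with e; its triangle comes from the frame on
  -- that block.
  at-side : ∀ {g} → Fin (size g) → Fin 3 → ∀ {v} → Side g v → Fin 3 → V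
  at-side {g} e u (inside w) k = embed g (G.at g (e , u) w k)
  at-side {g} e u (outside i e′ b j _) k =
    place (i , e′) (join g i e e′) (F.at (join g i e e′) (g , u) ((i , b) , j) k)

  at : Colour → V → Fin 3 → V
  at c@((g , e) , u) v = at-side e u (side g v)

  pos-side : ∀ {g} → Fin (size g) → Fin 3 → ∀ {v} → Side g v → Fin 3
  pos-side {g} e u (inside w) = G.pos g (e , u) w
  pos-side {g} e u (outside i e′ b j _) = F.pos (join g i e e′) (g , u) ((i , b) , j)

  pos : Colour → V → Fin 3
  pos ((g , e) , u) v = pos-side e u (side g v)

  at-embed : ∀ g e u w k → at ((g , e) , u) (embed g w) k ≡ embed g (G.at g (e , u) w k)
  at-embed g e u w k rewrite side-embed g w = refl

  pos-embed : ∀ g e u w → pos ((g , e) , u) (embed g w) ≡ G.pos g (e , u) w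
  pos-embed g e u w rewrite side-embed g w = refl

  -- The block recomputed from e and the placed point is B again by `join-unique`, so `at` works in
  -- the frame on B.
  at-place : ∀ d {B g e p} u → On B g e → Alive B (group p) → group p ≢ g → ∀ k →
             at ((g , e) , u) (place d B p) k ≡ place d B (F.at B (g , u) p k)
  at-place d {B} {g} {e} {p@((i , b) , j)} u on a n k with alive⇒on {B} {i} a
  ... | e′ , on′ rewrite point-on d on′ | proj₂ (side-outside g e′ b j n)
                       | join-unique g i (λ z → n (sym z)) on on′ =
    place-cong (i , e′) d (proj₁ (F.outside B u (on⇒alive on) (a , n) k))

  pos-place : ∀ d {B g e p} u → On B g e → Alive B (group p) → group p ≢ g →
              pos ((g , e) , u) (place d B p) ≡ F.pos B (g , u) p
  pos-place d {B} {g} {e} {p@((i , b) , j)} u on a n with alive⇒on {B} {i} a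
  ... | e′ , on′ rewrite point-on d on′ | proj₂ (side-outside g e′ b j n)
                       | join-unique g i (λ z → n (sym z)) on on′ = refl

  -- In contrast to `Side`, the block is an argument here, so that all vertices of a triangle are
  -- seen in the same block and the frame laws transfer through `at-place` and `pos-place`.
  data Local (g : Fin 5) (e : Fin (size g)) : V → Set where
    in-group : ∀ w → Local g e (embed g w)
    in-block : ∀ d B p → On B g e → Alive B (group p) → group p ≢ g → Local g e (place d B p)

  local : ∀ g e v → Local g e v
  local g e v with side g v
  ... | inside w = in-group w
  ... | outside i e′ b j n = subst (Local g e) (place-on (i , e′) b j on′)
    (in-block (i , e′) (join g i e e′) ((i , b) , j) (join-on₁ g i (λ z → n (sym z))) (on⇒alive on′) n)
    where on′ = join-on₂ g i {e} {e′} λ z → n (sym z)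

  lift : ∀ g → Maybe (⊤ × (Fin (size g) × Fin 3)) → Maybe (⊤ × Colour)
  lift g = Maybe.map λ { (_ , e , u) → tt , (g , e) , u }

  col : V → V → Maybe (⊤ × Colour)
  col (nothing , j) (nothing , j′) = nothing
  col (nothing , j) (just ((i , e) , b) , j′) = lift i (G.col i (nothing , j) (just (e , b) , j′))
  col (just ((i , e) , b) , j) (nothing , j′) = lift i (G.col i (just (e , b) , j) (nothing , j′))
  col (just ((i , e) , b) , j) (just ((i′ , e′) , b′) , j′) with i Fin.≟ i′
  ... | yes refl = lift i (G.col i (just (e , b) , j) (just (e′ , b′) , j′))
  -- The frame on B names the group k missed by the triangle; the point of B in group k owns the
  -- class.
  ... | no _ = let B = join i i′ e e′ ; k , u = F.col B ((i , b) , j) ((i′ , b′) , j′)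
               in just (tt , point (i , e) B k , u)

  col-embed : ∀ g w w′ → DifferentFirst w w′ → col (embed g w) (embed g w′) ≡ lift g (G.col g w w′)
  col-embed g (nothing , j) (nothing , j′) n = contradiction refl n
  col-embed g (nothing , j) (just _ , j′) n = refl
  col-embed g (just _ , j) (nothing , j′) n = refl
  col-embed g (just _ , j) (just _ , j′) n with g Fin.≟ g
  ... | yes refl = refl
  ... | no ¬e = contradiction refl ¬e

  col-place : ∀ d {B p q k e u} → Alive B (group p) → Alive B (group q) → group p ≢ group q →
              F.col B p q ≡ (k , u) → On B k e → col (place d B p) (place d B q) ≡ just (tt , (k , e) , u)
  col-place d {B} {(i , b) , j} {(i′ , b′) , j′} a a′ n q on
    with alive⇒on {B} {i} a | alive⇒on {B} {i′} a′
  ... | e₁ , on₁ | e₂ , on₂ rewrite point-on d on₁ | point-on d on₂ with i Fin.≟ i′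
  ...   | yes i≡i′ = contradiction i≡i′ n
  ...   | no _ rewrite join-unique i i′ n on₁ on₂ | q | point-on (i , e₁) on = refl

  embed-different : ∀ g {w w′} → DifferentFirst w w′ → DifferentFirst (embed g w) (embed g w′)
  embed-different g {nothing , _} {nothing , _} n _ = n refl
  embed-different g {nothing , _} {just _ , _} n ()
  embed-different g {just _ , _} {nothing , _} n ()
  embed-different g {just _ , _} {just _ , _} n refl = n refl

  place-different : ∀ d {B p q} → Alive B (group p) → Alive B (group q) → group p ≢ group q →
                    DifferentFirst (place d B p) (place d B q)
  place-different d {B} {(i , b) , j} {(i′ , b′) , j′} a a′ n e
    with alive⇒on {B} {i} a | alive⇒on {B} {i′} a′
  ... | e₁ , on₁ | e₂ , on₂ rewrite point-on d on₁ | point-on d on₂ = n (cong (λ { (just ((i , _) , _)) → i ; nothing → zero }) e)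

  pos-at : ∀ c v k → pos c (at c v k) ≡ k
  pos-at c@((g , e) , u) v k with local g e v
  ... | in-group w = trans (cong (pos c) (at-embed g e u w k))
          (trans (pos-embed g e u _) (G.pos-at g (e , u) w k))
  ... | in-block d B p on a n = let a′ , n′ = F.outside B u (on⇒alive on) (a , n) k in
          trans (cong (pos c) (at-place d u on a n k))
            (trans (pos-place d u on a′ n′) (F.pos-at B u (on⇒alive on) (a , n) k))

  at-pos : ∀ c v → at c v (pos c v) ≡ v
  at-pos c@((g , e) , u) v with local g e v
  ... | in-group w = trans (cong (at c (embed g w)) (pos-embed g e u w))
          (trans (at-embed g e u w _) (cong (embed g) (G.at-pos g (e , u) w)))
  ... | in-block d B p on a n = trans (cong (at c (place d B p)) (pos-place d u on a n))
          (trans (at-place d u on a n _) (cong (place d B) (F.at-pos B u (on⇒alive on) (a , n))))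

  at-at : ∀ c v k l → at c (at c v k) l ≡ at c v l
  at-at c@((g , e) , u) v k l with local g e v
  ... | in-group w = trans (cong (λ z → at c z l) (at-embed g e u w k))
          (trans (at-embed g e u _ l) (trans (cong (embed g) (G.at-at g (e , u) w k l)) (sym (at-embed g e u w l))))
  ... | in-block d B p on a n = let a′ , n′ = F.outside B u (on⇒alive on) (a , n) k in
          trans (cong (λ z → at c z l) (at-place d u on a n k))
            (trans (at-place d u on a′ n′ l)
              (trans (cong (place d B) (F.at-at B u (on⇒alive on) (a , n) k l)) (sym (at-place d u on a n l))))

  sound : ∀ c v {k l} → Neighbours k l →
          DifferentFirst (at c v k) (at c v l) × col (at c v k) (at c v l) ≡ just (tt , c)
  sound c@((g , e) , u) v {k} {l} nb with local g e v
  ... | in-group w rewrite at-embed g e u w k | at-embed g e u w l =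
          let n , q = G.sound g (e , u) w nb in
          embed-different g n , trans (col-embed g _ _ n) (cong (lift g) q)
  ... | in-block d B p on a n =
          let a₁ , _ = F.outside B u (on⇒alive on) (a , n) k
              a₂ , _ = F.outside B u (on⇒alive on) (a , n) l
              n′ , q = F.sound B u (on⇒alive on) (a , n) (neighbours⇒≢ nb) in
          subst₂ (λ x y → DifferentFirst x y × col x y ≡ just (tt , c))
            (sym (at-place d u on a n k)) (sym (at-place d u on a n l))
            (place-different d {p = F.at B (g , u) p k} {q = F.at B (g , u) p l} a₁ a₂ n′ , col-place d a₁ a₂ n′ q on)

  Joined : V → V → Set
  Joined v w = Σ[ l ∈ ⊤ ] Σ[ c ∈ Colour ]
    (col v w ≡ just (l , c) × at c v (pos c w) ≡ w × Neighbours (pos c v) (pos c w))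

  complete-embed : ∀ g {w w′} → DifferentFirst w w′ → Joined (embed g w) (embed g w′)
  complete-embed g {w} {w′} n with G.complete g n
  ... | _ , (e , u) , q , r , nb = tt , ((g , e) , u) ,
    trans (col-embed g w w′ n) (cong (lift g) q) ,
    trans (cong (at c (embed g w)) (pos-embed g e u w′)) (trans (at-embed g e u w _) (cong (embed g) r)) ,
    subst₂ Neighbours (sym (pos-embed g e u w)) (sym (pos-embed g e u w′)) nb
    where c = (g , e) , u

  complete-place : ∀ d {B p q} → Alive B (group p) → Alive B (group q) → group p ≢ group q →
                   Joined (place d B p) (place d B q)
  complete-place d {B} {p} {q} a a′ n with F.complete B {p} {q} a a′ n
  ... | alive , p≢k , q≢k , r , s with F.col B p q in eq
  ...   | k , u with alive⇒on alive
  ...     | e , on = tt , ((k , e) , u) , col-place d a a′ n eq on ,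
    trans (cong (at c (place d B p)) (pos-place d u on a′ q≢k))
      (trans (at-place d u on a p≢k _) (cong (place d B) r)) ,
    ≢⇒neighbours (subst₂ _≢_ (sym (pos-place d u on a p≢k)) (sym (pos-place d u on a′ q≢k)) s)
    where c = (k , e) , u

  complete : ∀ {v w} → DifferentFirst v w → Joined v w
  complete {nothing , j} {nothing , j′} n = contradiction refl n
  complete {nothing , j} {just ((i , e) , b) , j′} n = complete-embed i {nothing , j} {just (e , b) , j′} λ ()
  complete {just ((i , e) , b) , j} {nothing , j′} n = complete-embed i {just (e , b) , j} {nothing , j′} λ ()
  complete {just ((i , e) , b) , j} {just ((i′ , e′) , b′) , j′} n = by-group (i Fin.≟ i′) n
    where
    by-group : Dec (i ≡ i′) → just ((i , e) , b) ≢ just ((i′ , e′) , b′) →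
               Joined (just ((i , e) , b) , j) (just ((i′ , e′) , b′) , j′)
    by-group (yes refl) n = complete-embed i {just (e , b) , j} {just (e′ , b′) , j′} λ { refl → n refl }
    by-group (no ¬e) _ = subst₂ Joined (place-on (i , e) b j on) (place-on (i , e) b′ j′ on′)
      (complete-place (i , e) {p = (i , b) , j} {q = (i′ , b′) , j′} (on⇒alive on) (on⇒alive on′) ¬e)
      where
      on = join-on₁ i i′ {e} {e′} ¬e
      on′ = join-on₂ i i′ {e} {e′} ¬e

  truncation : KirkmanGDD T
  truncation = record
    { col = col ; pos = pos ; at = at ; pos-at = pos-at ; at-pos = at-pos ; at-at = at-at
    ; sound = sound ; complete = complete }

-- Resolvable 3-GDDs of type 3^(2t + 1)

infix 0 _≅_
_≅_ : Set → ℕ → Set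
A ≅ n = A ↔ Fin n

Fin-≅ : ∀ n → Fin n ≅ n
Fin-≅ n = ↔-refl

×-≅ : ∀ {A B a b} → A ≅ a → B ≅ b → A × B ≅ a * b
×-≅ f g = ↔-trans (f ×-↔ g) (↔-sym Fin.*↔×)

⊎-≅ : ∀ {A B : Set} {a b} → A ≅ a → B ≅ b → A ⊎ B ≅ a + b
⊎-≅ f g = ↔-trans (f ⊎-↔ g) (↔-sym Fin.+↔⊎)

Bool-≅ : Bool ≅ 2
Bool-≅ = ↔-sym Fin.2↔Bool

Maybe-≅ : ∀ {A a} → A ≅ a → Maybe A ≅ suc a
Maybe-≅ f = mk↔ₛ′ (λ { nothing → zero ; (just x) → suc (to x) })
  (λ { zero → nothing ; (suc i) → just (from i) })
  (λ { zero → refl ; (suc i) → cong suc (strictlyInverseˡ i) })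
  (λ { nothing → refl ; (just x) → cong just (strictlyInverseʳ x) })
  where open Inverse f

-- Index types of designs are matched by cardinality alone, which leaves only arithmetic identities
-- to check.
same-size : ∀ {A B a b} → A ≅ a → B ≅ b → a ≡ b → A ↔ B
same-size f g refl = ↔-trans f (↔-sym g)

reindex-RGDD : ∀ {A A′ C C′} → A′ ↔ A → C ↔ C′ → RGDD A C → RGDD A′ C′
reindex-RGDD f g = reindex (f ×-↔ ↔-refl)
  (λ n e → n (trans (sym (strictlyInverseʳ _)) (trans (cong from e) (strictlyInverseʳ _))))
  (λ n e → n (trans (sym (strictlyInverseˡ _)) (trans (cong to e) (strictlyInverseˡ _))))
  (λ _ → g)
  where open Inverse f

vertices-≅ : ∀ {T t} → T ≅ t → Maybe (T × Bool) ≅ suc (t * 2)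
vertices-≅ f = Maybe-≅ (×-≅ f Bool-≅)

colours-≅ : ∀ {T t} → T ≅ t → T × Fin 3 ≅ t * 3
colours-≅ f = ×-≅ f ↔-refl

Kirkman : ℕ → Set
Kirkman t = KirkmanGDD (Fin t)

to-Kirkman : ∀ {A C a c} t → A ≅ a → C ≅ c → a ≡ suc (t * 2) → c ≡ t * 3 → RGDD A C → Kirkman t
to-Kirkman t f g p q = reindex-RGDD (same-size (vertices-≅ ↔-refl) f (sym p)) (same-size g (colours-≅ ↔-refl) q)

from-Kirkman : ∀ {A a} t → A ≅ a → a ≡ suc (t * 2) → Kirkman t → RGDD A (Fin t × Fin 3)
from-Kirkman t f p = reindex-RGDD (same-size f (vertices-≅ ↔-refl) p) ↔-refl

-- The numbers of groups multiply: (2 a + 1) (2 b + 1) = 2 (2 a b + a + b) + 1.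
Kirkman-product : ∀ a b → Kirkman a → Kirkman b → Kirkman (2 * (a * b) + (a + b))
Kirkman-product a b Ka Kb = to-Kirkman (2 * (a * b) + (a + b))
  (×-≅ ↔-refl ↔-refl) (⊎-≅ (×-≅ (colours-≅ ↔-refl) ↔-refl) (colours-≅ ↔-refl))
  (orders a b) (classes a b)
  (RGDD-product {h = b} (from-Kirkman a ↔-refl refl Ka) (from-Kirkman b (Fin-≅ (suc (b + b))) (double b) Kb))
  where
  double : ∀ b → 1 + (b + b) ≡ 1 + b * 2
  double = solve-∀
  orders : ∀ a b → (1 + a * 2) * (1 + (b + b)) ≡ 1 + (2 * (a * b) + (a + b)) * 2
  orders = solve-∀
  classes : ∀ a b → a * 3 * (1 + (b + b)) + b * 3 ≡ (2 * (a * b) + (a + b)) * 3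
  classes = solve-∀

-- A single group, with no edges and no classes; it is the filling when a group is deleted entirely.
Kirkman-zero : Kirkman 0
Kirkman-zero = record
  { col = λ _ _ → nothing ; pos = λ { (() , _) } ; at = λ { (() , _) }
  ; pos-at = λ { (() , _) } ; at-pos = λ { (() , _) } ; at-at = λ { (() , _) } ; sound = λ { (() , _) }
  ; complete = λ { {nothing , _} {nothing , _} n → contradiction refl n
                 ; {just (() , _) , _} ; {nothing , _} {just (() , _) , _} } }

module Existence (F₅ : Frame (λ _ → ⊤)) (F₄ : Frame (_≢ zero)) where

  Kirkman-truncation : ∀ {m} → TransversalDesign m → ∀ h → h ≤ m → Kirkman m → Kirkman h → Kirkman (h + 4 * m)
  Kirkman-truncation {m} D h h≤m Km Kh = to-Kirkman (h + 4 * m) (vertices-≅ groups) (colours-≅ groups) refl refl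
    (Truncation.truncation D h h≤m F₅ F₄ Km Kh)
    where
    open Truncation D h h≤m F₅ F₄ Km Kh using (size; T)
    groups : T ≅ h + 4 * m
    groups = ↔-trans (mk↔ₛ′ split unsplit (λ { (inj₁ _) → refl ; (inj₂ _) → refl })
        (λ { (zero , _) → refl ; (suc _ , _) → refl }))
      (⊎-≅ ↔-refl (×-≅ ↔-refl ↔-refl))
      where
      split : T → Fin h ⊎ (Fin 4 × Fin m)
      split (zero , e) = inj₁ e
      split (suc i , e) = inj₂ (i , e)
      unsplit : Fin h ⊎ (Fin 4 × Fin m) → T
      unsplit (inj₁ e) = zero , e
      unsplit (inj₂ (i , e)) = suc i , e

  -- The gaps between the windows [4 m, 5 m] for m = 1, 5, 7, 11, 13, 17; from m = 17 on consecutive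
  -- windows overlap or abut.
  exceptions : List ℕ
  exceptions = 0 ∷ 1 ∷ 2 ∷ 3 ∷ 6 ∷ 7 ∷ 8 ∷ 9 ∷ 10 ∷ 11 ∷ 12 ∷ 13 ∷ 14 ∷ 15 ∷ 16 ∷ 17 ∷ 18 ∷ 19 ∷ 26 ∷ 27 ∷
    36 ∷ 37 ∷ 38 ∷ 39 ∷ 40 ∷ 41 ∷ 42 ∷ 43 ∷ 66 ∷ 67 ∷ []

  -- t = h + 4m with 0 ≤ h ≤ m and m = 6q + 5, 6q − 1 or 6q + 1 respectively.
  Truncatable : ℕ → ℕ → Set
  Truncatable q r = 20 ≤ r ⊎ (r < 4 × 4 + r ≤ 6 * q ∸ 1) ⊎ (4 ≤ r × r ≤ 6 * q + 5)

  truncatable? : ∀ q r → Dec (Truncatable q r)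
  truncatable? q r = (20 ℕ.≤? r) ⊎-dec ((r ℕ.<? 4) ×-dec (4 + r ℕ.≤? 6 * q ∸ 1)) ⊎-dec
                     ((4 ℕ.≤? r) ×-dec (r ℕ.≤? 6 * q + 5))

  below-72 : ∀ (t : Fin 72) → toℕ t ∈ exceptions ⊎ Truncatable (toℕ t / 24) (toℕ t % 24)
  below-72 = toWitness {a? = Fin.all? λ t → (toℕ t ∈? exceptions) ⊎-dec truncatable? (toℕ t / 24) (toℕ t % 24)} _

  -- Raising m by 6 moves the start of its window by 24, whence the division by 24. For q ≥ 3 the
  -- windows are long enough to reach every remainder.
  from-72 : ∀ {q r} → 3 ≤ q → Truncatable q r
  from-72 {q} {r} 3≤q with r ℕ.<? 4 | 20 ℕ.≤? r
  ... | _ | yes 20≤r = inj₁ 20≤r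
  ... | yes r<4 | no _ = inj₂ (inj₁ (r<4 , ℕ.≤-trans (ℕ.≤-trans (ℕ.+-monoʳ-≤ 4 (ℕ.<⇒≤ r<4)) (ℕ.m≤m+n 8 9))
                           (ℕ.∸-monoˡ-≤ 1 (ℕ.*-monoʳ-≤ 6 3≤q))))
  ... | no r≮4 | no 20≰r = inj₂ (inj₂ (ℕ.≮⇒≥ r≮4 , ℕ.≤-trans (ℕ.<⇒≤ (ℕ.≰⇒> 20≰r))
                           (ℕ.≤-trans (ℕ.m≤m+n 20 3) (ℕ.+-monoˡ-≤ 5 (ℕ.*-monoʳ-≤ 6 3≤q)))))

  exceptional-or-truncatable : ∀ t → t ∈ exceptions ⊎ Truncatable (t / 24) (t % 24)
  exceptional-or-truncatable t with t ℕ.<? 72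
  ... | yes t<72 = subst (λ t → t ∈ exceptions ⊎ Truncatable (t / 24) (t % 24)) (Fin.toℕ-fromℕ< t<72)
                     (below-72 (Fin.fromℕ< t<72))
  ... | no t≮72 = inj₂ (from-72 (ℕ./-monoˡ-≤ 24 (ℕ.≮⇒≥ t≮72)))

  extend : ∀ {m h} t → TransversalDesign (suc m) → h ≤ suc m → t ≡ h + 4 * suc m →
           (∀ {u} → u < t → Kirkman u) → Kirkman t
  extend {m} {h} t D h≤m refl ih = Kirkman-truncation D h h≤m (ih m<t) (ih (ℕ.≤-<-trans h≤m m<t))
    where
    m<t : suc m < h + 4 * suc m
    m<t = ℕ.<-≤-trans (ℕ.m<m+n (suc m) (s≤s z≤n)) (ℕ.m≤n+m (4 * suc m) h)

  truncatable⇒Kirkman : ∀ t → Truncatable (t / 24) (t % 24) → (∀ {u} → u < t → Kirkman u) → Kirkman t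
  truncatable⇒Kirkman t = go (t / 24) (t % 24) (ℕ.m≡m%n+[m/n]*n t 24) (ℕ.m%n<n t 24)
    where
    go : ∀ q r → t ≡ r + q * 24 → r < 24 → Truncatable q r → (∀ {u} → u < t → Kirkman u) → Kirkman t
    go q r e r<24 (inj₁ 20≤r) = extend {h = r ∸ 20} t (TD-6q+5 q)
      (ℕ.≤-trans (ℕ.∸-monoˡ-≤ 20 (ℕ.≤-pred r<24)) (ℕ.m≤m+n 3 (2 + 6 * q)))
      (trans e (trans (cong (_+ q * 24) (sym (ℕ.m∸n+n≡m 20≤r))) (sum (r ∸ 20) q)))
      where
      sum : ∀ h q → h + 20 + q * 24 ≡ h + 4 * (5 + 6 * q)
      sum = solve-∀
    -- Remainders below 4 use the window of m = 6 q - 1, which begins in the preceding block of 24.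
    -- For q = 0 there is none, and the truncated difference makes the bound 0.
    go zero r e r<24 (inj₂ (inj₁ (_ , ())))
    go (suc q) r e r<24 (inj₂ (inj₁ (_ , h≤m))) = extend {h = 4 + r} t (TD-6q+5 q)
      (subst (4 + r ≤_) (cong (_∸ 1) (ℕ.*-suc 6 q)) h≤m)
      (trans e (sum r q))
      where
      sum : ∀ r q → r + (1 + q) * 24 ≡ 4 + r + 4 * (5 + 6 * q)
      sum = solve-∀
    go q r e r<24 (inj₂ (inj₂ (4≤r , r≤))) = extend {h = r ∸ 4} t (TD-6q+1 q)
      (ℕ.≤-trans (ℕ.∸-monoˡ-≤ 4 r≤) (ℕ.≤-reflexive (trans (ℕ.+-∸-assoc (6 * q) {5} {4} (ℕ.m≤m+n 4 1)) (ℕ.+-comm (6 * q) 1))))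
      (trans e (trans (cong (_+ q * 24) (sym (ℕ.m∸n+n≡m 4≤r))) (sum (r ∸ 4) q)))
      where
      sum : ∀ h q → h + 4 + q * 24 ≡ h + 4 * (1 + 6 * q)
      sum = solve-∀

  exists : All Kirkman exceptions → ∀ t → Kirkman t
  exists base = <-rec _ λ t ih → step t ih (exceptional-or-truncatable t)
    where
    step : ∀ t → (∀ {u} → u < t → Kirkman u) → t ∈ exceptions ⊎ Truncatable (t / 24) (t % 24) → Kirkman t
    step t ih (inj₁ t∈) = All.lookup base t∈
    step t ih (inj₂ T) = truncatable⇒Kirkman t T ih

-- Designs given by tables

nth : List ℕ → ℕ → ℕ
nth [] _ = 0
nth (x ∷ xs) zero = x
nth (x ∷ xs) (suc i) = nth xs i

indexOf : ℕ → List ℕ → ℕ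
indexOf x [] = 0
indexOf x (y ∷ ys) = if x ≡ᵇ y then 0 else suc (indexOf x ys)

row : List (List ℕ) → ℕ → List ℕ
row [] _ = []
row (r ∷ rs) zero = r
row (r ∷ rs) (suc i) = row rs i

neighbours? : ∀ {k} (i j : Fin k) → Dec (Neighbours i j)
neighbours? i j = (j Fin.≟ next i) ⊎-dec (i Fin.≟ next j)

-- A decomposition read off from a table; the row of a colour lists the vertices of its cycles one after the other.
module Table (s t : ℕ) {L : Set} (size : L → ℕ) (count : L → ℕ) (nonZero : ∀ l → NonZero (size l))
  (_≟_ : DecidableEquality L) (search : ((l : L) → Fin (count l) → Bool) → Maybe (Σ L λ l → Fin (count l)))
  (all-lengths? : ∀ {P : L → Set} → (∀ l → Dec (P l)) → Dec (∀ l → P l))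
  (rows : L → List (List ℕ))
  (E : Fin (suc s) × Fin (suc t) → Fin (suc s) × Fin (suc t) → Set) (E? : ∀ x y → Dec (E x y)) where

  private instance
    size-nonZero : ∀ {l} → NonZero (size l)
    size-nonZero {l} = nonZero l

  V : Set
  V = Fin (suc s) × Fin (suc t)

  C : L → Set
  C l = Fin (count l)

  decode : ℕ → V
  decode c = (c / suc t) mod suc s , c mod suc t

  encode : V → ℕ
  encode (a , b) = toℕ a * suc t + toℕ b

  cycles : ∀ {l} → C l → List ℕ
  cycles {l} c = row (rows l) (toℕ c)

  pos : ∀ {l} → C l → V → Fin (size l)
  pos {l} c x = indexOf (encode x) (cycles c) mod size l

  at : ∀ {l} → C l → V → Fin (size l) → V
  at {l} c x i = decode (nth (cycles c) (indexOf (encode x) (cycles c) / size l * size l + toℕ i))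

  adjacent : ∀ {l} → V → V → C l → Bool
  adjacent {l} x y c =
    let p = indexOf (encode x) (cycles c) ; q = indexOf (encode y) (cycles c) ; k = size l in
    (p / k ≡ᵇ q / k) ∧ ((suc p % k ≡ᵇ q % k) ∨ (suc q % k ≡ᵇ p % k))

  col : V → V → Maybe (Σ L C)
  col x y = search λ l → adjacent {l} x y

  Joined : V → V → Maybe (Σ L C) → Set
  Joined x y nothing = ⊥
  Joined x y (just (l , c)) = at c x (pos c y) ≡ y × Neighbours (pos c x) (pos c y)

  Step : ∀ l → C l → V → V → Set
  Step l c x y = (E x y × E y x) × col x y ≡ just (l , c) × col y x ≡ just (l , c)

  record IsTable : Set where
    field
      pos-at : ∀ l (c : C l) a b i → pos c (at c (a , b) i) ≡ i
      at-pos : ∀ l (c : C l) a b → at c (a , b) (pos c (a , b)) ≡ (a , b)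
      at-at  : ∀ l (c : C l) a b i j → at c (at c (a , b) i) j ≡ at c (a , b) j
      steps  : ∀ l (c : C l) a b → Step l c (a , b) (at c (a , b) (next (pos c (a , b))))
      joined : ∀ a b a′ b′ → E (a , b) (a′ , b′) → Joined (a , b) (a′ , b′) (col (a , b) (a′ , b′))

  private
    _≟V_ : DecidableEquality V
    _≟V_ = Product.≡-dec Fin._≟_ Fin._≟_

    _≟C_ : DecidableEquality (Maybe (Σ L C))
    _≟C_ = Maybe.≡-dec (Product.≡-dec _≟_ Fin._≟_)

    joined? : ∀ x y o → Dec (E x y → Joined x y o)
    joined? x y o with E? x y
    ... | no n = yes λ e → contradiction e n
    joined? x y nothing | yes e = no λ f → f e
    joined? x y (just (l , c)) | yes e =
      map′ (λ j _ → j) (λ f → f e) ((at c x (pos c y) ≟V y) ×-dec neighbours? (pos c x) (pos c y))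

  isTable? : Dec IsTable
  isTable? = map′
    (λ (a , b , c , d , e) → record { pos-at = a ; at-pos = b ; at-at = c ; steps = d ; joined = e })
    (λ S → let open IsTable S in pos-at , at-pos , at-at , steps , joined)
    ((all-lengths? λ l → Fin.all? λ c → Fin.all? λ a → Fin.all? λ b → Fin.all? λ i →
       pos c (at c (a , b) i) Fin.≟ i) ×-dec
     (all-lengths? λ l → Fin.all? λ c → Fin.all? λ a → Fin.all? λ b →
       at c (a , b) (pos c (a , b)) ≟V (a , b)) ×-dec
     (all-lengths? λ l → Fin.all? λ c → Fin.all? λ a → Fin.all? λ b → Fin.all? λ i → Fin.all? λ j →
       at c (at c (a , b) i) j ≟V at c (a , b) j) ×-dec
     (all-lengths? λ l → Fin.all? λ c → Fin.all? λ a → Fin.all? λ b →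
       let x = a , b ; y = at c x (next (pos c x)) in
       (E? x y ×-dec E? y x) ×-dec (col x y ≟C just (l , c)) ×-dec (col y x ≟C just (l , c))) ×-dec
     (Fin.all? λ a → Fin.all? λ b → Fin.all? λ a′ → Fin.all? λ b′ →
       joined? (a , b) (a′ , b′) (col (a , b) (a′ , b′))))

  decomposition : IsTable → Decomposition size V E C
  decomposition S = record
    { col = col ; pos = pos ; at = at
    ; pos-at = λ c (a , b) → pos-at _ c a b ; at-pos = λ c (a , b) → at-pos _ c a b
    ; at-at = λ c (a , b) → at-at _ c a b
    ; sound = sound ; complete = complete }
    where
    open IsTable S
    -- Each arc of a cycle starts at some vertex, so it is enough that the table was checked from
    -- every vertex to its successor.
    step : ∀ {l} (c : C l) x {i j} → j ≡ next i → Step l c (at c x i) (at c x j)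
    step {l} c x@(a , b) {i} {j} refl = subst (Step l c (at c x i))
      (trans (cong (λ k → at c (at c x i) (next k)) (pos-at l c a b i)) (at-at l c a b i j))
      (steps l c (proj₁ (at c x i)) (proj₂ (at c x i)))
    sound : ∀ {l} (c : C l) x {i j} → Neighbours i j →
            E (at c x i) (at c x j) × col (at c x i) (at c x j) ≡ just (l , c)
    sound c x (inj₁ e) = let (e₁ , _) , q , _ = step c x e in e₁ , q
    sound c x (inj₂ e) = let (_ , e₂) , _ , q = step c x e in e₂ , q
    complete : ∀ {x y} → E x y → Σ[ l ∈ L ] Σ[ c ∈ C l ]
               (col x y ≡ just (l , c) × at c x (pos c y) ≡ y × Neighbours (pos c x) (pos c y))
    complete {x@(a , b)} {y@(a′ , b′)} e with col x y | joined a b a′ b′ e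
    ... | just (l , c) | r , nb = l , c , refl , r , nb

first : ∀ {n} {A : Set} → (Fin n → Maybe A) → Maybe A
first {zero} f = nothing
first {suc n} f with f zero
... | just a = just a
... | nothing = first (λ i → f (suc i))

firstTrue : ∀ {n} → (Fin n → Bool) → Maybe (Fin n)
firstTrue f = first λ i → if f i then just i else nothing

module MixedTable (s t : ℕ) (r₃ r₇ : ℕ) (rows₃ rows₇ : List (List ℕ))
  (E : Fin (suc s) × Fin (suc t) → Fin (suc s) × Fin (suc t) → Set) (E? : ∀ x y → Dec (E x y)) where

  _≟_ : DecidableEquality Length
  triangle ≟ triangle = yes refl
  triangle ≟ heptagon = no λ ()
  heptagon ≟ triangle = no λ ()
  heptagon ≟ heptagon = yes refl

  search : ((l : Length) → Fin (counts r₃ r₇ l) → Bool) → Maybe (Σ Length λ l → Fin (counts r₃ r₇ l))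
  search f with firstTrue (f triangle)
  ... | just c = just (triangle , c)
  ... | nothing = Maybe.map (heptagon ,_) (firstTrue (f heptagon))

  all-lengths? : ∀ {P : Length → Set} → (∀ l → Dec (P l)) → Dec (∀ l → P l)
  all-lengths? P? = map′ (λ { (a , b) triangle → a ; (a , b) heptagon → b }) (λ f → f triangle , f heptagon)
    (P? triangle ×-dec P? heptagon)

  rows : Length → List (List ℕ)
  rows triangle = rows₃
  rows heptagon = rows₇

  len-nonZero : ∀ l → NonZero (len l)
  len-nonZero triangle = _
  len-nonZero heptagon = _

  open Table s t len (counts r₃ r₇) len-nonZero _≟_ search all-lengths? rows E E? public

-- The point (x, a) is coded as 3x + a; the k-th transversal class has offsets 0, offsets[2k], offsets[2k+1].
module StarterTable (n q : ℕ) (offsets triangles : List ℕ) where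

  offset : Fin q → Fin 3 → Fin (suc n)
  offset k zero = zero
  offset k (suc zero) = nth offsets (2 * toℕ k) mod suc n
  offset k (suc (suc _)) = nth offsets (suc (2 * toℕ k)) mod suc n

  vertex locate : Fin (suc n) × Fin 3 → Fin (suc n) × Fin 3
  vertex (t , i) = let c = nth triangles (3 * toℕ t + toℕ i) in c / 3 mod suc n , c mod 3
  locate (x , a) = let c = indexOf (3 * toℕ x + toℕ a) triangles in c / 3 mod suc n , c mod 3

  orbit : Fin 3 → Fin 3 → Fin (suc n) → Fin q ⊎ Fin (suc n)
  orbit i j d with firstTrue (λ k → toℕ d ≡ᵇ (toℕ (offset k j) + (suc n ∸ toℕ (offset k i))) % suc n)
  ... | just k = inj₁ k
  ... | nothing = inj₂ (scan triangles)
    where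
    hit : ℕ → ℕ → Bool
    hit p r = (p % 3 ≡ᵇ toℕ i) ∧ (r % 3 ≡ᵇ toℕ j) ∧ ((r / 3 + (suc n ∸ p / 3)) % suc n ≡ᵇ toℕ d)
    -- A base triangle containing (x, i) and (x + d, j) contains (0, i) and (d, j) after translation
    -- by -x, the value returned.
    scan : List ℕ → Fin (suc n)
    scan (p ∷ r ∷ s ∷ rest) =
      if hit p r ∨ hit p s then (suc n ∸ p / 3) mod suc n else
      if hit r p ∨ hit r s then (suc n ∸ r / 3) mod suc n else
      if hit s p ∨ hit s r then (suc n ∸ s / 3) mod suc n else scan rest
    scan _ = zero

  open Starter n q offset vertex locate orbit public

-- Row 3g + u lists the triangles of colour (g, u); the point ((i, b), j) is coded as 6i + 3b + j.
module FrameTable (Alive : Fin 5 → Set) (alive? : ∀ i → Dec (Alive i)) (rows : List (List ℕ)) where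

  encode : Point → ℕ
  encode ((i , b) , j) = 6 * toℕ i + (if b then 3 else 0) + toℕ j

  decode : ℕ → Point
  decode c = (c / 6 mod 5 , (c / 3 % 2 ≡ᵇ 1)) , c mod 3

  triangles : Fin 5 × Fin 3 → List ℕ
  triangles (g , u) = row rows (3 * toℕ g + toℕ u)

  pos : Fin 5 × Fin 3 → Point → Fin 3
  pos c p = indexOf (encode p) (triangles c) mod 3

  at : Fin 5 × Fin 3 → Point → Fin 3 → Point
  at c p i = decode (nth (triangles c) (indexOf (encode p) (triangles c) / 3 * 3 + toℕ i))

  joins : ℕ → ℕ → List ℕ → Bool
  joins p q (x ∷ y ∷ z ∷ rest) =
    ((p ≡ᵇ x) ∨ (p ≡ᵇ y) ∨ (p ≡ᵇ z)) ∧ ((q ≡ᵇ x) ∨ (q ≡ᵇ y) ∨ (q ≡ᵇ z)) ∨ joins p q rest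
  joins p q _ = false

  col : Point → Point → Fin 5 × Fin 3
  col p q = fromMaybe (zero , zero) (first λ g → Maybe.map (g ,_)
    (firstTrue λ u → joins (encode p) (encode q) (triangles (g , u))))

  Outside : Fin 5 → Point → Set
  Outside g p = Alive (group p) × group p ≢ g

  Law : (Fin 5 → Fin 3 → Point → Set) → Set
  Law P = ∀ g u i b j → Alive g × Outside g ((i , b) , j) → P g u ((i , b) , j)

  Joined : Point → Point → Fin 5 × Fin 3 → Set
  Joined p q c = Alive (proj₁ c) × group p ≢ proj₁ c × group q ≢ proj₁ c × at c p (pos c q) ≡ q × pos c p ≢ pos c q

  record IsFrame : Set where
    field
      outside : Law λ g u p → ∀ i → Outside g (at (g , u) p i)
      pos-at  : Law λ g u p → ∀ i → pos (g , u) (at (g , u) p i) ≡ i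
      at-pos  : Law λ g u p → at (g , u) p (pos (g , u) p) ≡ p
      at-at   : Law λ g u p → ∀ i j → at (g , u) (at (g , u) p i) j ≡ at (g , u) p j
      sound   : Law λ g u p → ∀ i j → i ≢ j →
                group (at (g , u) p i) ≢ group (at (g , u) p j) × col (at (g , u) p i) (at (g , u) p j) ≡ (g , u)
      joined  : ∀ i b j i′ b′ j′ → Alive i × Alive i′ × i ≢ i′ →
                Joined ((i , b) , j) ((i′ , b′) , j′) (col ((i , b) , j) ((i′ , b′) , j′))

  private
    _≟P_ : DecidableEquality Point
    _≟P_ = Product.≡-dec (Product.≡-dec Fin._≟_ Bool._≟_) Fin._≟_

    all-Bool? : ∀ {P : Bool → Set} → (∀ b → Dec (P b)) → Dec (∀ b → P b)
    all-Bool? P? = map′ (λ { (f , t) false → f ; (f , t) true → t }) (λ h → h false , h true)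
      (P? false ×-dec P? true)

    outside? : ∀ g p → Dec (Outside g p)
    outside? g p = alive? (group p) ×-dec ¬? (group p Fin.≟ g)

    law? : ∀ {P : Fin 5 → Fin 3 → Point → Set} → (∀ g u p → Dec (P g u p)) → Dec (Law P)
    law? P? = Fin.all? λ g → Fin.all? λ u → Fin.all? λ i → all-Bool? λ b → Fin.all? λ j →
      (alive? g ×-dec outside? g ((i , b) , j)) →-dec P? g u ((i , b) , j)

    joined? : ∀ p q c → Dec (Joined p q c)
    joined? p q c = alive? (proj₁ c) ×-dec ¬? (group p Fin.≟ proj₁ c) ×-dec ¬? (group q Fin.≟ proj₁ c) ×-dec
      (at c p (pos c q) ≟P q) ×-dec ¬? (pos c p Fin.≟ pos c q)

  isFrame? : Dec IsFrame
  isFrame? = map′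
    (λ (a , b , c , d , e , f) → record { outside = a ; pos-at = b ; at-pos = c ; at-at = d ; sound = e ; joined = f })
    (λ S → let open IsFrame S in outside , pos-at , at-pos , at-at , sound , joined)
    (law? (λ g u p → Fin.all? λ i → outside? g (at (g , u) p i)) ×-dec
     law? (λ g u p → Fin.all? λ i → pos (g , u) (at (g , u) p i) Fin.≟ i) ×-dec
     law? (λ g u p → at (g , u) p (pos (g , u) p) ≟P p) ×-dec
     law? (λ g u p → Fin.all? λ i → Fin.all? λ j → at (g , u) (at (g , u) p i) j ≟P at (g , u) p j) ×-dec
     law? (λ g u p → Fin.all? λ i → Fin.all? λ j → ¬? (i Fin.≟ j) →-dec
       (¬? (group (at (g , u) p i) Fin.≟ group (at (g , u) p j)) ×-dec
        Product.≡-dec Fin._≟_ Fin._≟_ (col (at (g , u) p i) (at (g , u) p j)) (g , u))) ×-dec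
     (Fin.all? λ i → all-Bool? λ b → Fin.all? λ j → Fin.all? λ i′ → all-Bool? λ b′ → Fin.all? λ j′ →
       (alive? i ×-dec alive? i′ ×-dec ¬? (i Fin.≟ i′)) →-dec
       joined? ((i , b) , j) ((i′ , b′) , j′) (col ((i , b) , j) ((i′ , b′) , j′))))

  frame : IsFrame → Frame Alive
  frame S = record
    { col = col ; pos = pos ; at = at
    ; outside = λ u a o → outside _ u _ _ _ (a , o)
    ; pos-at = λ u a o → pos-at _ u _ _ _ (a , o)
    ; at-pos = λ u a o → at-pos _ u _ _ _ (a , o)
    ; at-at = λ u a o → at-at _ u _ _ _ (a , o)
    ; sound = λ u a o {i} {j} n → sound _ u _ _ _ (a , o) i j n
    ; complete = λ a a′ n → joined _ _ _ _ _ _ (a , a′ , n) }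
    where open IsFrame S

-- These frames arise from 4-GDDs of type 3⁵ and 3⁴ by replacing every point by two and every block by a
-- Kirkman frame of type 2⁴.
module Frame-6⁵ = FrameTable (λ _ → ⊤) (λ _ → yes tt)
    ((6 ∷ 18 ∷ 16 ∷ 9 ∷ 21 ∷ 13 ∷ 19 ∷ 25 ∷ 11 ∷ 22 ∷ 28 ∷ 8 ∷ 14 ∷ 23 ∷ 27 ∷ 17 ∷ 20 ∷ 24 ∷ 26 ∷ 12 ∷ 7 ∷ 29 ∷ 15 ∷ 10 ∷ [])
    ∷ (12 ∷ 21 ∷ 28 ∷ 15 ∷ 18 ∷ 25 ∷ 24 ∷ 13 ∷ 8 ∷ 27 ∷ 16 ∷ 11 ∷ 7 ∷ 19 ∷ 17 ∷ 10 ∷ 22 ∷ 14 ∷ 20 ∷ 26 ∷ 9 ∷ 23 ∷ 29 ∷ 6 ∷ [])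
    ∷ (18 ∷ 24 ∷ 10 ∷ 21 ∷ 27 ∷ 7 ∷ 13 ∷ 22 ∷ 29 ∷ 16 ∷ 19 ∷ 26 ∷ 25 ∷ 14 ∷ 6 ∷ 28 ∷ 17 ∷ 9 ∷ 8 ∷ 20 ∷ 15 ∷ 11 ∷ 23 ∷ 12 ∷ [])
    ∷ (0 ∷ 18 ∷ 13 ∷ 3 ∷ 21 ∷ 16 ∷ 12 ∷ 24 ∷ 22 ∷ 15 ∷ 27 ∷ 19 ∷ 25 ∷ 2 ∷ 17 ∷ 28 ∷ 5 ∷ 14 ∷ 20 ∷ 29 ∷ 4 ∷ 23 ∷ 26 ∷ 1 ∷ [])
    ∷ (18 ∷ 27 ∷ 5 ∷ 21 ∷ 24 ∷ 2 ∷ 1 ∷ 19 ∷ 14 ∷ 4 ∷ 22 ∷ 17 ∷ 13 ∷ 25 ∷ 23 ∷ 16 ∷ 28 ∷ 20 ∷ 26 ∷ 0 ∷ 15 ∷ 29 ∷ 3 ∷ 12 ∷ [])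
    ∷ (24 ∷ 1 ∷ 16 ∷ 27 ∷ 4 ∷ 13 ∷ 19 ∷ 28 ∷ 3 ∷ 22 ∷ 25 ∷ 0 ∷ 2 ∷ 20 ∷ 12 ∷ 5 ∷ 23 ∷ 15 ∷ 14 ∷ 26 ∷ 21 ∷ 17 ∷ 29 ∷ 18 ∷ [])
    ∷ (6 ∷ 24 ∷ 19 ∷ 9 ∷ 27 ∷ 22 ∷ 18 ∷ 1 ∷ 28 ∷ 21 ∷ 4 ∷ 25 ∷ 2 ∷ 8 ∷ 23 ∷ 5 ∷ 11 ∷ 20 ∷ 26 ∷ 3 ∷ 10 ∷ 29 ∷ 0 ∷ 7 ∷ [])
    ∷ (0 ∷ 6 ∷ 21 ∷ 3 ∷ 9 ∷ 18 ∷ 24 ∷ 4 ∷ 11 ∷ 27 ∷ 1 ∷ 8 ∷ 7 ∷ 25 ∷ 20 ∷ 10 ∷ 28 ∷ 23 ∷ 19 ∷ 2 ∷ 29 ∷ 22 ∷ 5 ∷ 26 ∷ [])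
    ∷ (1 ∷ 7 ∷ 22 ∷ 4 ∷ 10 ∷ 19 ∷ 25 ∷ 5 ∷ 9 ∷ 28 ∷ 2 ∷ 6 ∷ 8 ∷ 26 ∷ 18 ∷ 11 ∷ 29 ∷ 21 ∷ 20 ∷ 0 ∷ 27 ∷ 23 ∷ 3 ∷ 24 ∷ [])
    ∷ (0 ∷ 9 ∷ 16 ∷ 3 ∷ 6 ∷ 13 ∷ 12 ∷ 1 ∷ 25 ∷ 15 ∷ 4 ∷ 28 ∷ 24 ∷ 7 ∷ 5 ∷ 27 ∷ 10 ∷ 2 ∷ 8 ∷ 14 ∷ 29 ∷ 11 ∷ 17 ∷ 26 ∷ [])
    ∷ (6 ∷ 12 ∷ 27 ∷ 9 ∷ 15 ∷ 24 ∷ 1 ∷ 10 ∷ 17 ∷ 4 ∷ 7 ∷ 14 ∷ 13 ∷ 2 ∷ 26 ∷ 16 ∷ 5 ∷ 29 ∷ 25 ∷ 8 ∷ 3 ∷ 28 ∷ 11 ∷ 0 ∷ [])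
    ∷ (7 ∷ 13 ∷ 28 ∷ 10 ∷ 16 ∷ 25 ∷ 2 ∷ 11 ∷ 15 ∷ 5 ∷ 8 ∷ 12 ∷ 14 ∷ 0 ∷ 24 ∷ 17 ∷ 3 ∷ 27 ∷ 26 ∷ 6 ∷ 4 ∷ 29 ∷ 9 ∷ 1 ∷ [])
    ∷ (6 ∷ 15 ∷ 22 ∷ 9 ∷ 12 ∷ 19 ∷ 18 ∷ 7 ∷ 2 ∷ 21 ∷ 10 ∷ 5 ∷ 1 ∷ 13 ∷ 11 ∷ 4 ∷ 16 ∷ 8 ∷ 14 ∷ 20 ∷ 3 ∷ 17 ∷ 23 ∷ 0 ∷ [])
    ∷ (12 ∷ 18 ∷ 4 ∷ 15 ∷ 21 ∷ 1 ∷ 7 ∷ 16 ∷ 23 ∷ 10 ∷ 13 ∷ 20 ∷ 19 ∷ 8 ∷ 0 ∷ 22 ∷ 11 ∷ 3 ∷ 2 ∷ 14 ∷ 9 ∷ 5 ∷ 17 ∷ 6 ∷ [])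
    ∷ (13 ∷ 19 ∷ 5 ∷ 16 ∷ 22 ∷ 2 ∷ 8 ∷ 17 ∷ 21 ∷ 11 ∷ 14 ∷ 18 ∷ 20 ∷ 6 ∷ 1 ∷ 23 ∷ 9 ∷ 4 ∷ 0 ∷ 12 ∷ 10 ∷ 3 ∷ 15 ∷ 7 ∷ []) ∷ [])

frame-6⁵ : Frame (λ _ → ⊤)
frame-6⁵ = Frame-6⁵.frame (toWitness {a? = Frame-6⁵.isFrame?} _)

module Frame-6⁴ = FrameTable (_≢ zero) (λ i → ¬? (i Fin.≟ zero))
    -- The deleted group zero owns no classes, so its three rows are empty.
    ([]
    ∷ []
    ∷ []
    ∷ (12 ∷ 18 ∷ 27 ∷ 15 ∷ 21 ∷ 24 ∷ 13 ∷ 19 ∷ 29 ∷ 16 ∷ 22 ∷ 26 ∷ 14 ∷ 20 ∷ 28 ∷ 17 ∷ 23 ∷ 25 ∷ [])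
    ∷ (12 ∷ 19 ∷ 28 ∷ 15 ∷ 22 ∷ 25 ∷ 13 ∷ 20 ∷ 27 ∷ 16 ∷ 23 ∷ 24 ∷ 14 ∷ 18 ∷ 29 ∷ 17 ∷ 21 ∷ 26 ∷ [])
    ∷ (12 ∷ 20 ∷ 29 ∷ 15 ∷ 23 ∷ 26 ∷ 13 ∷ 18 ∷ 28 ∷ 16 ∷ 21 ∷ 25 ∷ 14 ∷ 19 ∷ 27 ∷ 17 ∷ 22 ∷ 24 ∷ [])
    ∷ (6 ∷ 18 ∷ 24 ∷ 9 ∷ 21 ∷ 27 ∷ 7 ∷ 19 ∷ 25 ∷ 10 ∷ 22 ∷ 28 ∷ 8 ∷ 20 ∷ 26 ∷ 11 ∷ 23 ∷ 29 ∷ [])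
    ∷ (6 ∷ 19 ∷ 26 ∷ 9 ∷ 22 ∷ 29 ∷ 7 ∷ 20 ∷ 24 ∷ 10 ∷ 23 ∷ 27 ∷ 8 ∷ 18 ∷ 25 ∷ 11 ∷ 21 ∷ 28 ∷ [])
    ∷ (6 ∷ 20 ∷ 25 ∷ 9 ∷ 23 ∷ 28 ∷ 7 ∷ 18 ∷ 26 ∷ 10 ∷ 21 ∷ 29 ∷ 8 ∷ 19 ∷ 24 ∷ 11 ∷ 22 ∷ 27 ∷ [])
    ∷ (6 ∷ 15 ∷ 27 ∷ 9 ∷ 12 ∷ 24 ∷ 7 ∷ 17 ∷ 29 ∷ 10 ∷ 14 ∷ 26 ∷ 8 ∷ 16 ∷ 28 ∷ 11 ∷ 13 ∷ 25 ∷ [])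
    ∷ (6 ∷ 16 ∷ 29 ∷ 9 ∷ 13 ∷ 26 ∷ 7 ∷ 15 ∷ 28 ∷ 10 ∷ 12 ∷ 25 ∷ 8 ∷ 17 ∷ 27 ∷ 11 ∷ 14 ∷ 24 ∷ [])
    ∷ (6 ∷ 17 ∷ 28 ∷ 9 ∷ 14 ∷ 25 ∷ 7 ∷ 16 ∷ 27 ∷ 10 ∷ 13 ∷ 24 ∷ 8 ∷ 15 ∷ 29 ∷ 11 ∷ 12 ∷ 26 ∷ [])
    ∷ (6 ∷ 12 ∷ 21 ∷ 9 ∷ 15 ∷ 18 ∷ 7 ∷ 13 ∷ 23 ∷ 10 ∷ 16 ∷ 20 ∷ 8 ∷ 14 ∷ 22 ∷ 11 ∷ 17 ∷ 19 ∷ [])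
    ∷ (6 ∷ 14 ∷ 23 ∷ 9 ∷ 17 ∷ 20 ∷ 7 ∷ 12 ∷ 22 ∷ 10 ∷ 15 ∷ 19 ∷ 8 ∷ 13 ∷ 21 ∷ 11 ∷ 16 ∷ 18 ∷ [])
    ∷ (6 ∷ 13 ∷ 22 ∷ 9 ∷ 16 ∷ 19 ∷ 7 ∷ 14 ∷ 21 ∷ 10 ∷ 17 ∷ 18 ∷ 8 ∷ 12 ∷ 23 ∷ 11 ∷ 15 ∷ 20 ∷ []) ∷ [])

frame-6⁴ : Frame (_≢ zero)
frame-6⁴ = Frame-6⁴.frame (toWitness {a? = Frame-6⁴.isFrame?} _)

-- The lines of slopes 0, 1, i, 1 + i and ∞ over GF(9) = GF(3)(i); the number 3x + y stands for x + y i.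
TD-9 : TransversalDesign 9
TD-9 = record
  { f = f ; block = block
  ; f-block₁ = λ i j x y n → proj₁ (proj₁ laws i j x y n) ; f-block₂ = λ i j x y n → proj₂ (proj₁ laws i j x y n)
  ; block-f = λ { i j n (a , b) → cong₂ _,_ (proj₁ (proj₂ laws i j n a b)) (proj₂ (proj₂ laws i j n a b)) } }
  where
  -- This is a + (p + r i) b with i² = -1. Modulo 3 the code 3x + y can itself stand for y, and 2 r
  -- stands for -r.
  line : ℕ → ℕ → ℕ → ℕ → ℕ
  line p r a b = 3 * ((a / 3 + p * (b / 3) + 2 * r * b) % 3) + (a + p * b + r * (b / 3)) % 3
  value : Fin 5 → ℕ → ℕ → ℕ
  value zero a b = b
  value (suc zero) a b = a
  value (suc (suc zero)) a b = line 1 0 a b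
  value (suc (suc (suc zero))) a b = line 0 1 a b
  value (suc (suc (suc (suc zero)))) a b = line 1 1 a b
  f : Fin 5 → Fin 9 × Fin 9 → Fin 9
  f i (a , b) = value i (toℕ a) (toℕ b) mod 9
  solution : Fin 5 → Fin 5 → Fin 9 → Fin 9 → ℕ
  solution i j x y = toℕ (fromMaybe zero (firstTrue {81} λ c →
    (value i (toℕ c / 9) (toℕ c % 9) ≡ᵇ toℕ x) ∧ (value j (toℕ c / 9) (toℕ c % 9) ≡ᵇ toℕ y)))
  block : Fin 5 → Fin 5 → Fin 9 → Fin 9 → Fin 9 × Fin 9
  block i j x y = solution i j x y / 9 mod 9 , solution i j x y mod 9
  laws : (∀ i j x y → i ≢ j → f i (block i j x y) ≡ x × f j (block i j x y) ≡ y) ×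
         (∀ i j → i ≢ j → ∀ a b → proj₁ (block i j (f i (a , b)) (f j (a , b))) ≡ a ×
                                  proj₂ (block i j (f i (a , b)) (f j (a , b))) ≡ b)
  laws = toWitness {a? =
    (Fin.all? λ i → Fin.all? λ j → Fin.all? λ x → Fin.all? λ y → ¬? (i Fin.≟ j) →-dec
      ((f i (block i j x y) Fin.≟ x) ×-dec (f j (block i j x y) Fin.≟ y))) ×-dec
    (Fin.all? λ i → Fin.all? λ j → ¬? (i Fin.≟ j) →-dec Fin.all? λ a → Fin.all? λ b →
      (proj₁ (block i j (f i (a , b)) (f j (a , b))) Fin.≟ a) ×-dec
      (proj₂ (block i j (f i (a , b)) (f j (a , b))) Fin.≟ b))} _

-- Factorizations of K_{7,7,7} and K₂₁

K₂₁-vertex : Set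
K₂₁-vertex = Fin 3 × Fin 7

distinct? : (x y : K₂₁-vertex) → Dec (x ≢ y)
distinct? x y = ¬? (Product.≡-dec Fin._≟_ Fin._≟_ x y)

module Tripartite₀ = MixedTable 2 6 0 7
  []
  ((3 ∷ 18 ∷ 11 ∷ 16 ∷ 0 ∷ 7 ∷ 15 ∷ 1 ∷ 19 ∷ 4 ∷ 12 ∷ 20 ∷ 8 ∷ 17 ∷ 2 ∷ 14 ∷ 13 ∷ 6 ∷ 10 ∷ 5 ∷ 9 ∷ []) ∷
     (11 ∷ 14 ∷ 10 ∷ 1 ∷ 8 ∷ 18 ∷ 4 ∷ 15 ∷ 2 ∷ 16 ∷ 6 ∷ 20 ∷ 9 ∷ 0 ∷ 7 ∷ 3 ∷ 19 ∷ 13 ∷ 17 ∷ 12 ∷ 5 ∷ []) ∷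
     (18 ∷ 7 ∷ 16 ∷ 4 ∷ 17 ∷ 11 ∷ 0 ∷ 10 ∷ 2 ∷ 19 ∷ 6 ∷ 15 ∷ 13 ∷ 20 ∷ 5 ∷ 8 ∷ 3 ∷ 9 ∷ 1 ∷ 12 ∷ 14 ∷ []) ∷
     (6 ∷ 14 ∷ 4 ∷ 13 ∷ 0 ∷ 19 ∷ 11 ∷ 8 ∷ 15 ∷ 1 ∷ 7 ∷ 2 ∷ 12 ∷ 16 ∷ 20 ∷ 3 ∷ 10 ∷ 17 ∷ 9 ∷ 18 ∷ 5 ∷ []) ∷
     (18 ∷ 2 ∷ 20 ∷ 4 ∷ 9 ∷ 6 ∷ 12 ∷ 8 ∷ 14 ∷ 1 ∷ 13 ∷ 16 ∷ 10 ∷ 0 ∷ 3 ∷ 17 ∷ 7 ∷ 19 ∷ 5 ∷ 15 ∷ 11 ∷ []) ∷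
     (0 ∷ 12 ∷ 15 ∷ 10 ∷ 19 ∷ 9 ∷ 14 ∷ 3 ∷ 13 ∷ 18 ∷ 6 ∷ 17 ∷ 5 ∷ 16 ∷ 4 ∷ 8 ∷ 2 ∷ 11 ∷ 1 ∷ 20 ∷ 7 ∷ []) ∷
     (0 ∷ 17 ∷ 2 ∷ 13 ∷ 5 ∷ 11 ∷ 20 ∷ 1 ∷ 16 ∷ 9 ∷ 15 ∷ 4 ∷ 10 ∷ 18 ∷ 3 ∷ 12 ∷ 19 ∷ 8 ∷ 6 ∷ 7 ∷ 14 ∷ []) ∷ [])
  DifferentFirst differentFirst?

tripartite₀ : Decomposition len K₂₁-vertex DifferentFirst (mix 0 7)
tripartite₀ = Tripartite₀.decomposition (toWitness {a? = Tripartite₀.isTable?} _)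

module Tripartite₁ = MixedTable 2 6 1 6
  ((0 ∷ 9 ∷ 15 ∷ 1 ∷ 10 ∷ 16 ∷ 2 ∷ 11 ∷ 17 ∷ 3 ∷ 12 ∷ 18 ∷ 4 ∷ 13 ∷ 19 ∷ 5 ∷ 7 ∷ 20 ∷ 6 ∷ 8 ∷ 14 ∷ []) ∷ [])
  ((0 ∷ 20 ∷ 2 ∷ 19 ∷ 1 ∷ 8 ∷ 16 ∷ 12 ∷ 17 ∷ 7 ∷ 18 ∷ 4 ∷ 10 ∷ 5 ∷ 9 ∷ 14 ∷ 3 ∷ 13 ∷ 15 ∷ 11 ∷ 6 ∷ []) ∷
     (15 ∷ 4 ∷ 12 ∷ 14 ∷ 2 ∷ 18 ∷ 6 ∷ 7 ∷ 0 ∷ 10 ∷ 20 ∷ 8 ∷ 19 ∷ 3 ∷ 11 ∷ 5 ∷ 16 ∷ 13 ∷ 17 ∷ 9 ∷ 1 ∷ []) ∷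
     (4 ∷ 17 ∷ 8 ∷ 3 ∷ 11 ∷ 18 ∷ 9 ∷ 5 ∷ 19 ∷ 7 ∷ 2 ∷ 16 ∷ 12 ∷ 15 ∷ 10 ∷ 14 ∷ 0 ∷ 13 ∷ 1 ∷ 20 ∷ 6 ∷ []) ∷
     (1 ∷ 12 ∷ 6 ∷ 17 ∷ 10 ∷ 15 ∷ 7 ∷ 3 ∷ 20 ∷ 13 ∷ 5 ∷ 14 ∷ 4 ∷ 16 ∷ 2 ∷ 9 ∷ 19 ∷ 11 ∷ 0 ∷ 18 ∷ 8 ∷ []) ∷
     (8 ∷ 15 ∷ 1 ∷ 14 ∷ 11 ∷ 20 ∷ 4 ∷ 7 ∷ 16 ∷ 9 ∷ 3 ∷ 10 ∷ 19 ∷ 6 ∷ 12 ∷ 0 ∷ 17 ∷ 5 ∷ 18 ∷ 13 ∷ 2 ∷ []) ∷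
     (0 ∷ 8 ∷ 5 ∷ 9 ∷ 20 ∷ 12 ∷ 19 ∷ 1 ∷ 17 ∷ 3 ∷ 15 ∷ 2 ∷ 10 ∷ 18 ∷ 4 ∷ 11 ∷ 16 ∷ 6 ∷ 13 ∷ 14 ∷ 7 ∷ []) ∷ [])
  DifferentFirst differentFirst?

tripartite₁ : Decomposition len K₂₁-vertex DifferentFirst (mix 1 6)
tripartite₁ = Tripartite₁.decomposition (toWitness {a? = Tripartite₁.isTable?} _)

module Tripartite₃ = MixedTable 2 6 3 4
  ((0 ∷ 7 ∷ 18 ∷ 1 ∷ 8 ∷ 19 ∷ 2 ∷ 9 ∷ 20 ∷ 3 ∷ 10 ∷ 14 ∷ 4 ∷ 11 ∷ 15 ∷ 5 ∷ 12 ∷ 16 ∷ 6 ∷ 13 ∷ 17 ∷ []) ∷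
     (0 ∷ 9 ∷ 17 ∷ 1 ∷ 10 ∷ 18 ∷ 2 ∷ 11 ∷ 19 ∷ 3 ∷ 12 ∷ 20 ∷ 4 ∷ 13 ∷ 14 ∷ 5 ∷ 7 ∷ 15 ∷ 6 ∷ 8 ∷ 16 ∷ []) ∷
     (0 ∷ 8 ∷ 15 ∷ 1 ∷ 9 ∷ 16 ∷ 2 ∷ 10 ∷ 17 ∷ 3 ∷ 11 ∷ 18 ∷ 4 ∷ 12 ∷ 19 ∷ 5 ∷ 13 ∷ 20 ∷ 6 ∷ 7 ∷ 14 ∷ []) ∷ [])
  ((9 ∷ 6 ∷ 18 ∷ 12 ∷ 2 ∷ 8 ∷ 3 ∷ 15 ∷ 10 ∷ 4 ∷ 17 ∷ 7 ∷ 19 ∷ 13 ∷ 16 ∷ 0 ∷ 20 ∷ 1 ∷ 14 ∷ 5 ∷ 11 ∷ []) ∷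
     (2 ∷ 15 ∷ 12 ∷ 14 ∷ 8 ∷ 4 ∷ 7 ∷ 1 ∷ 11 ∷ 0 ∷ 13 ∷ 16 ∷ 3 ∷ 17 ∷ 20 ∷ 6 ∷ 19 ∷ 9 ∷ 18 ∷ 5 ∷ 10 ∷ []) ∷
     (11 ∷ 17 ∷ 8 ∷ 5 ∷ 9 ∷ 15 ∷ 6 ∷ 20 ∷ 7 ∷ 3 ∷ 19 ∷ 10 ∷ 16 ∷ 4 ∷ 12 ∷ 1 ∷ 13 ∷ 18 ∷ 2 ∷ 14 ∷ 0 ∷ []) ∷
     (0 ∷ 10 ∷ 6 ∷ 12 ∷ 17 ∷ 5 ∷ 19 ∷ 1 ∷ 15 ∷ 3 ∷ 13 ∷ 2 ∷ 16 ∷ 7 ∷ 4 ∷ 9 ∷ 14 ∷ 11 ∷ 20 ∷ 8 ∷ 18 ∷ []) ∷ [])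
  DifferentFirst differentFirst?

tripartite₃ : Decomposition len K₂₁-vertex DifferentFirst (mix 3 4)
tripartite₃ = Tripartite₃.decomposition (toWitness {a? = Tripartite₃.isTable?} _)

module Tripartite₅ = MixedTable 2 6 5 2
  ((0 ∷ 7 ∷ 17 ∷ 1 ∷ 8 ∷ 18 ∷ 2 ∷ 9 ∷ 19 ∷ 3 ∷ 10 ∷ 20 ∷ 4 ∷ 11 ∷ 14 ∷ 5 ∷ 12 ∷ 15 ∷ 6 ∷ 13 ∷ 16 ∷ []) ∷
     (0 ∷ 13 ∷ 19 ∷ 1 ∷ 7 ∷ 20 ∷ 2 ∷ 8 ∷ 14 ∷ 3 ∷ 9 ∷ 15 ∷ 4 ∷ 10 ∷ 16 ∷ 5 ∷ 11 ∷ 17 ∷ 6 ∷ 12 ∷ 18 ∷ []) ∷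
     (0 ∷ 8 ∷ 20 ∷ 1 ∷ 9 ∷ 14 ∷ 2 ∷ 10 ∷ 15 ∷ 3 ∷ 11 ∷ 16 ∷ 4 ∷ 12 ∷ 17 ∷ 5 ∷ 13 ∷ 18 ∷ 6 ∷ 7 ∷ 19 ∷ []) ∷
     (0 ∷ 11 ∷ 15 ∷ 4 ∷ 7 ∷ 18 ∷ 2 ∷ 12 ∷ 16 ∷ 5 ∷ 9 ∷ 20 ∷ 6 ∷ 10 ∷ 14 ∷ 1 ∷ 13 ∷ 17 ∷ 3 ∷ 8 ∷ 19 ∷ []) ∷
     (6 ∷ 8 ∷ 17 ∷ 4 ∷ 13 ∷ 15 ∷ 2 ∷ 11 ∷ 20 ∷ 1 ∷ 10 ∷ 19 ∷ 0 ∷ 9 ∷ 18 ∷ 3 ∷ 12 ∷ 14 ∷ 5 ∷ 7 ∷ 16 ∷ []) ∷ [])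
  ((10 ∷ 0 ∷ 12 ∷ 20 ∷ 13 ∷ 3 ∷ 17 ∷ 18 ∷ 11 ∷ 19 ∷ 5 ∷ 14 ∷ 7 ∷ 2 ∷ 4 ∷ 9 ∷ 6 ∷ 15 ∷ 1 ∷ 16 ∷ 8 ∷ []) ∷
     (0 ∷ 16 ∷ 9 ∷ 17 ∷ 2 ∷ 13 ∷ 14 ∷ 1 ∷ 11 ∷ 6 ∷ 20 ∷ 4 ∷ 19 ∷ 12 ∷ 3 ∷ 18 ∷ 10 ∷ 5 ∷ 8 ∷ 15 ∷ 7 ∷ []) ∷ [])
  DifferentFirst differentFirst?

tripartite₅ : Decomposition len K₂₁-vertex DifferentFirst (mix 5 2)
tripartite₅ = Tripartite₅.decomposition (toWitness {a? = Tripartite₅.isTable?} _)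

-- The design of `transversal 3`: row s lists the progressions x, x + s, x + 2s modulo 7.
module Tripartite₇ = MixedTable 2 6 7 0
  ((0 ∷ 7 ∷ 14 ∷ 1 ∷ 8 ∷ 15 ∷ 2 ∷ 9 ∷ 16 ∷ 3 ∷ 10 ∷ 17 ∷ 4 ∷ 11 ∷ 18 ∷ 5 ∷ 12 ∷ 19 ∷ 6 ∷ 13 ∷ 20 ∷ []) ∷
     (0 ∷ 8 ∷ 16 ∷ 1 ∷ 9 ∷ 17 ∷ 2 ∷ 10 ∷ 18 ∷ 3 ∷ 11 ∷ 19 ∷ 4 ∷ 12 ∷ 20 ∷ 5 ∷ 13 ∷ 14 ∷ 6 ∷ 7 ∷ 15 ∷ []) ∷
     (0 ∷ 9 ∷ 18 ∷ 1 ∷ 10 ∷ 19 ∷ 2 ∷ 11 ∷ 20 ∷ 3 ∷ 12 ∷ 14 ∷ 4 ∷ 13 ∷ 15 ∷ 5 ∷ 7 ∷ 16 ∷ 6 ∷ 8 ∷ 17 ∷ []) ∷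
     (0 ∷ 10 ∷ 20 ∷ 1 ∷ 11 ∷ 14 ∷ 2 ∷ 12 ∷ 15 ∷ 3 ∷ 13 ∷ 16 ∷ 4 ∷ 7 ∷ 17 ∷ 5 ∷ 8 ∷ 18 ∷ 6 ∷ 9 ∷ 19 ∷ []) ∷
     (0 ∷ 11 ∷ 15 ∷ 1 ∷ 12 ∷ 16 ∷ 2 ∷ 13 ∷ 17 ∷ 3 ∷ 7 ∷ 18 ∷ 4 ∷ 8 ∷ 19 ∷ 5 ∷ 9 ∷ 20 ∷ 6 ∷ 10 ∷ 14 ∷ []) ∷
     (0 ∷ 12 ∷ 17 ∷ 1 ∷ 13 ∷ 18 ∷ 2 ∷ 7 ∷ 19 ∷ 3 ∷ 8 ∷ 20 ∷ 4 ∷ 9 ∷ 14 ∷ 5 ∷ 10 ∷ 15 ∷ 6 ∷ 11 ∷ 16 ∷ []) ∷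
     (0 ∷ 13 ∷ 19 ∷ 1 ∷ 7 ∷ 20 ∷ 2 ∷ 8 ∷ 14 ∷ 3 ∷ 9 ∷ 15 ∷ 4 ∷ 10 ∷ 16 ∷ 5 ∷ 11 ∷ 17 ∷ 6 ∷ 12 ∷ 18 ∷ []) ∷ [])
  []
  DifferentFirst differentFirst?

tripartite₇ : Decomposition len K₂₁-vertex DifferentFirst (mix 7 0)
tripartite₇ = Tripartite₇.decomposition (toWitness {a? = Tripartite₇.isTable?} _)

-- The KTS(21) developed from the starter of `Starter-7`, with the groups as first class.
module Complete₁₀ = MixedTable 2 6 10 0
  ((0 ∷ 7 ∷ 14 ∷ 1 ∷ 8 ∷ 15 ∷ 2 ∷ 9 ∷ 16 ∷ 3 ∷ 10 ∷ 17 ∷ 4 ∷ 11 ∷ 18 ∷ 5 ∷ 12 ∷ 19 ∷ 6 ∷ 13 ∷ 20 ∷ []) ∷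
     (0 ∷ 9 ∷ 15 ∷ 1 ∷ 10 ∷ 16 ∷ 2 ∷ 11 ∷ 17 ∷ 3 ∷ 12 ∷ 18 ∷ 4 ∷ 13 ∷ 19 ∷ 5 ∷ 7 ∷ 20 ∷ 6 ∷ 8 ∷ 14 ∷ []) ∷
     (0 ∷ 12 ∷ 17 ∷ 1 ∷ 13 ∷ 18 ∷ 2 ∷ 7 ∷ 19 ∷ 3 ∷ 8 ∷ 20 ∷ 4 ∷ 9 ∷ 14 ∷ 5 ∷ 10 ∷ 15 ∷ 6 ∷ 11 ∷ 16 ∷ []) ∷
     (0 ∷ 4 ∷ 5 ∷ 6 ∷ 12 ∷ 15 ∷ 2 ∷ 10 ∷ 14 ∷ 1 ∷ 11 ∷ 19 ∷ 3 ∷ 7 ∷ 16 ∷ 8 ∷ 9 ∷ 13 ∷ 17 ∷ 18 ∷ 20 ∷ []) ∷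
     (1 ∷ 5 ∷ 6 ∷ 0 ∷ 13 ∷ 16 ∷ 3 ∷ 11 ∷ 15 ∷ 2 ∷ 12 ∷ 20 ∷ 4 ∷ 8 ∷ 17 ∷ 9 ∷ 10 ∷ 7 ∷ 18 ∷ 19 ∷ 14 ∷ []) ∷
     (2 ∷ 6 ∷ 0 ∷ 1 ∷ 7 ∷ 17 ∷ 4 ∷ 12 ∷ 16 ∷ 3 ∷ 13 ∷ 14 ∷ 5 ∷ 9 ∷ 18 ∷ 10 ∷ 11 ∷ 8 ∷ 19 ∷ 20 ∷ 15 ∷ []) ∷
     (3 ∷ 0 ∷ 1 ∷ 2 ∷ 8 ∷ 18 ∷ 5 ∷ 13 ∷ 17 ∷ 4 ∷ 7 ∷ 15 ∷ 6 ∷ 10 ∷ 19 ∷ 11 ∷ 12 ∷ 9 ∷ 20 ∷ 14 ∷ 16 ∷ []) ∷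
     (4 ∷ 1 ∷ 2 ∷ 3 ∷ 9 ∷ 19 ∷ 6 ∷ 7 ∷ 18 ∷ 5 ∷ 8 ∷ 16 ∷ 0 ∷ 11 ∷ 20 ∷ 12 ∷ 13 ∷ 10 ∷ 14 ∷ 15 ∷ 17 ∷ []) ∷
     (5 ∷ 2 ∷ 3 ∷ 4 ∷ 10 ∷ 20 ∷ 0 ∷ 8 ∷ 19 ∷ 6 ∷ 9 ∷ 17 ∷ 1 ∷ 12 ∷ 14 ∷ 13 ∷ 7 ∷ 11 ∷ 15 ∷ 16 ∷ 18 ∷ []) ∷
     (6 ∷ 3 ∷ 4 ∷ 5 ∷ 11 ∷ 14 ∷ 1 ∷ 9 ∷ 20 ∷ 0 ∷ 10 ∷ 18 ∷ 2 ∷ 13 ∷ 15 ∷ 7 ∷ 8 ∷ 12 ∷ 16 ∷ 17 ∷ 19 ∷ []) ∷ [])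
  []
  _≢_ distinct?

complete₁₀ : Decomposition len K₂₁-vertex _≢_ (mix 10 0)
complete₁₀ = Complete₁₀.decomposition (toWitness {a? = Complete₁₀.isTable?} _)

-- Invariant under adding 1 modulo 7 in all three columns: two triangle factors are fixed, the other
-- seven form one orbit, and the heptagons have step 3. `Complete₈` is built alike, with one fixed
-- triangle factor.
module Complete₉ = MixedTable 2 6 9 1
  ((0 ∷ 7 ∷ 14 ∷ 1 ∷ 8 ∷ 15 ∷ 2 ∷ 9 ∷ 16 ∷ 3 ∷ 10 ∷ 17 ∷ 4 ∷ 11 ∷ 18 ∷ 5 ∷ 12 ∷ 19 ∷ 6 ∷ 13 ∷ 20 ∷ []) ∷
     (0 ∷ 9 ∷ 19 ∷ 1 ∷ 10 ∷ 20 ∷ 2 ∷ 11 ∷ 14 ∷ 3 ∷ 12 ∷ 15 ∷ 4 ∷ 13 ∷ 16 ∷ 5 ∷ 7 ∷ 17 ∷ 6 ∷ 8 ∷ 18 ∷ []) ∷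
     (0 ∷ 6 ∷ 11 ∷ 12 ∷ 13 ∷ 14 ∷ 2 ∷ 8 ∷ 10 ∷ 9 ∷ 15 ∷ 20 ∷ 4 ∷ 7 ∷ 19 ∷ 1 ∷ 17 ∷ 18 ∷ 3 ∷ 5 ∷ 16 ∷ []) ∷
     (1 ∷ 0 ∷ 12 ∷ 13 ∷ 7 ∷ 15 ∷ 3 ∷ 9 ∷ 11 ∷ 10 ∷ 16 ∷ 14 ∷ 5 ∷ 8 ∷ 20 ∷ 2 ∷ 18 ∷ 19 ∷ 4 ∷ 6 ∷ 17 ∷ []) ∷
     (2 ∷ 1 ∷ 13 ∷ 7 ∷ 8 ∷ 16 ∷ 4 ∷ 10 ∷ 12 ∷ 11 ∷ 17 ∷ 15 ∷ 6 ∷ 9 ∷ 14 ∷ 3 ∷ 19 ∷ 20 ∷ 5 ∷ 0 ∷ 18 ∷ []) ∷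
     (3 ∷ 2 ∷ 7 ∷ 8 ∷ 9 ∷ 17 ∷ 5 ∷ 11 ∷ 13 ∷ 12 ∷ 18 ∷ 16 ∷ 0 ∷ 10 ∷ 15 ∷ 4 ∷ 20 ∷ 14 ∷ 6 ∷ 1 ∷ 19 ∷ []) ∷
     (4 ∷ 3 ∷ 8 ∷ 9 ∷ 10 ∷ 18 ∷ 6 ∷ 12 ∷ 7 ∷ 13 ∷ 19 ∷ 17 ∷ 1 ∷ 11 ∷ 16 ∷ 5 ∷ 14 ∷ 15 ∷ 0 ∷ 2 ∷ 20 ∷ []) ∷
     (5 ∷ 4 ∷ 9 ∷ 10 ∷ 11 ∷ 19 ∷ 0 ∷ 13 ∷ 8 ∷ 7 ∷ 20 ∷ 18 ∷ 2 ∷ 12 ∷ 17 ∷ 6 ∷ 15 ∷ 16 ∷ 1 ∷ 3 ∷ 14 ∷ []) ∷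
     (6 ∷ 5 ∷ 10 ∷ 11 ∷ 12 ∷ 20 ∷ 1 ∷ 7 ∷ 9 ∷ 8 ∷ 14 ∷ 19 ∷ 3 ∷ 13 ∷ 18 ∷ 0 ∷ 16 ∷ 17 ∷ 2 ∷ 4 ∷ 15 ∷ []) ∷ [])
  ((0 ∷ 3 ∷ 6 ∷ 2 ∷ 5 ∷ 1 ∷ 4 ∷ 7 ∷ 10 ∷ 13 ∷ 9 ∷ 12 ∷ 8 ∷ 11 ∷ 14 ∷ 17 ∷ 20 ∷ 16 ∷ 19 ∷ 15 ∷ 18 ∷ []) ∷ [])
  _≢_ distinct?

complete₉ : Decomposition len K₂₁-vertex _≢_ (mix 9 1)
complete₉ = Complete₉.decomposition (toWitness {a? = Complete₉.isTable?} _)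

module Complete₈ = MixedTable 2 6 8 2
  ((0 ∷ 7 ∷ 14 ∷ 1 ∷ 8 ∷ 15 ∷ 2 ∷ 9 ∷ 16 ∷ 3 ∷ 10 ∷ 17 ∷ 4 ∷ 11 ∷ 18 ∷ 5 ∷ 12 ∷ 19 ∷ 6 ∷ 13 ∷ 20 ∷ []) ∷
     (6 ∷ 7 ∷ 16 ∷ 0 ∷ 9 ∷ 20 ∷ 5 ∷ 14 ∷ 17 ∷ 4 ∷ 10 ∷ 15 ∷ 1 ∷ 2 ∷ 12 ∷ 3 ∷ 8 ∷ 18 ∷ 11 ∷ 13 ∷ 19 ∷ []) ∷
     (0 ∷ 8 ∷ 17 ∷ 1 ∷ 10 ∷ 14 ∷ 6 ∷ 15 ∷ 18 ∷ 5 ∷ 11 ∷ 16 ∷ 2 ∷ 3 ∷ 13 ∷ 4 ∷ 9 ∷ 19 ∷ 12 ∷ 7 ∷ 20 ∷ []) ∷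
     (1 ∷ 9 ∷ 18 ∷ 2 ∷ 11 ∷ 15 ∷ 0 ∷ 16 ∷ 19 ∷ 6 ∷ 12 ∷ 17 ∷ 3 ∷ 4 ∷ 7 ∷ 5 ∷ 10 ∷ 20 ∷ 13 ∷ 8 ∷ 14 ∷ []) ∷
     (2 ∷ 10 ∷ 19 ∷ 3 ∷ 12 ∷ 16 ∷ 1 ∷ 17 ∷ 20 ∷ 0 ∷ 13 ∷ 18 ∷ 4 ∷ 5 ∷ 8 ∷ 6 ∷ 11 ∷ 14 ∷ 7 ∷ 9 ∷ 15 ∷ []) ∷
     (3 ∷ 11 ∷ 20 ∷ 4 ∷ 13 ∷ 17 ∷ 2 ∷ 18 ∷ 14 ∷ 1 ∷ 7 ∷ 19 ∷ 5 ∷ 6 ∷ 9 ∷ 0 ∷ 12 ∷ 15 ∷ 8 ∷ 10 ∷ 16 ∷ []) ∷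
     (4 ∷ 12 ∷ 14 ∷ 5 ∷ 7 ∷ 18 ∷ 3 ∷ 19 ∷ 15 ∷ 2 ∷ 8 ∷ 20 ∷ 6 ∷ 0 ∷ 10 ∷ 1 ∷ 13 ∷ 16 ∷ 9 ∷ 11 ∷ 17 ∷ []) ∷
     (5 ∷ 13 ∷ 15 ∷ 6 ∷ 8 ∷ 19 ∷ 4 ∷ 20 ∷ 16 ∷ 3 ∷ 9 ∷ 14 ∷ 0 ∷ 1 ∷ 11 ∷ 2 ∷ 7 ∷ 17 ∷ 10 ∷ 12 ∷ 18 ∷ []) ∷ [])
  ((0 ∷ 2 ∷ 4 ∷ 6 ∷ 1 ∷ 3 ∷ 5 ∷ 7 ∷ 8 ∷ 9 ∷ 10 ∷ 11 ∷ 12 ∷ 13 ∷ 14 ∷ 15 ∷ 16 ∷ 17 ∷ 18 ∷ 19 ∷ 20 ∷ []) ∷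
     (0 ∷ 3 ∷ 6 ∷ 2 ∷ 5 ∷ 1 ∷ 4 ∷ 7 ∷ 10 ∷ 13 ∷ 9 ∷ 12 ∷ 8 ∷ 11 ∷ 14 ∷ 16 ∷ 18 ∷ 20 ∷ 15 ∷ 17 ∷ 19 ∷ []) ∷ [])
  _≢_ distinct?

complete₈ : Decomposition len K₂₁-vertex _≢_ (mix 8 2)
complete₈ = Complete₈.decomposition (toWitness {a? = Complete₈.isTable?} _)

SameFirst : K₂₁-vertex → K₂₁-vertex → Set
SameFirst x y = proj₁ x ≡ proj₁ y × proj₂ x ≢ proj₂ y

-- K₇ splits into the Hamilton cycles of steps 1, 2 and 3 modulo 7.
module Columns = MixedTable 2 6 0 3 []
  ((0 ∷ 1 ∷ 2 ∷ 3 ∷ 4 ∷ 5 ∷ 6 ∷ 7 ∷ 8 ∷ 9 ∷ 10 ∷ 11 ∷ 12 ∷ 13 ∷ 14 ∷ 15 ∷ 16 ∷ 17 ∷ 18 ∷ 19 ∷ 20 ∷ []) ∷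
     (0 ∷ 2 ∷ 4 ∷ 6 ∷ 1 ∷ 3 ∷ 5 ∷ 7 ∷ 9 ∷ 11 ∷ 13 ∷ 8 ∷ 10 ∷ 12 ∷ 14 ∷ 16 ∷ 18 ∷ 20 ∷ 15 ∷ 17 ∷ 19 ∷ []) ∷
     (0 ∷ 3 ∷ 6 ∷ 2 ∷ 5 ∷ 1 ∷ 4 ∷ 7 ∷ 10 ∷ 13 ∷ 9 ∷ 12 ∷ 8 ∷ 11 ∷ 14 ∷ 17 ∷ 20 ∷ 16 ∷ 19 ∷ 15 ∷ 18 ∷ []) ∷ [])
  SameFirst (λ x y → (proj₁ x Fin.≟ proj₁ y) ×-dec ¬? (proj₂ x Fin.≟ proj₂ y))

columns : Decomposition len K₂₁-vertex SameFirst (mix 0 3)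
columns = Columns.decomposition (toWitness {a? = Columns.isTable?} _)

-- Resolvable 3-GDDs of small order

module Fifteen = Table 4 2 three (λ _ → 6) (λ _ → _) (λ _ _ → yes refl)
  (λ f → Maybe.map (tt ,_) (firstTrue (f tt))) (λ P? → map′ (λ p _ → p) (λ h → h tt) (P? tt))
  (λ _ → ((0 ∷ 5 ∷ 13 ∷ 1 ∷ 6 ∷ 9 ∷ 2 ∷ 11 ∷ 14 ∷ 3 ∷ 8 ∷ 12 ∷ 4 ∷ 7 ∷ 10 ∷ []) ∷
            (0 ∷ 8 ∷ 14 ∷ 1 ∷ 5 ∷ 7 ∷ 2 ∷ 10 ∷ 13 ∷ 3 ∷ 6 ∷ 11 ∷ 4 ∷ 9 ∷ 12 ∷ []) ∷
            (0 ∷ 6 ∷ 12 ∷ 1 ∷ 4 ∷ 14 ∷ 2 ∷ 3 ∷ 9 ∷ 5 ∷ 8 ∷ 10 ∷ 7 ∷ 11 ∷ 13 ∷ []) ∷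
            (0 ∷ 4 ∷ 11 ∷ 1 ∷ 10 ∷ 12 ∷ 2 ∷ 5 ∷ 6 ∷ 3 ∷ 7 ∷ 14 ∷ 8 ∷ 9 ∷ 13 ∷ []) ∷
            (0 ∷ 7 ∷ 9 ∷ 1 ∷ 3 ∷ 13 ∷ 2 ∷ 4 ∷ 8 ∷ 5 ∷ 11 ∷ 12 ∷ 6 ∷ 10 ∷ 14 ∷ []) ∷
            (0 ∷ 3 ∷ 10 ∷ 1 ∷ 8 ∷ 11 ∷ 2 ∷ 7 ∷ 12 ∷ 4 ∷ 6 ∷ 13 ∷ 5 ∷ 9 ∷ 14 ∷ []) ∷ []))
  DifferentFirst differentFirst?

-- A solution of the fifteen schoolgirls problem; the groups are the seventh day.
RGDD-5 : RGDD (Fin 5) (Fin 6)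
RGDD-5 = Fifteen.decomposition (toWitness {a? = Fifteen.isTable?} _)

module Starter-3 = StarterTable 2 0
  []
  (3 ∷ 6 ∷ 2 ∷ 0 ∷ 4 ∷ 7 ∷ 1 ∷ 5 ∷ 8 ∷ [])

RGDD-3 : RGDD (Fin 3) (Fin 0 ⊎ Fin 3)
RGDD-3 = Starter-3.develop (toWitness {a? = Starter-3.isStarter?} _)

module Starter-7 = StarterTable 6 2
  (2 ∷ 1 ∷ 5 ∷ 3 ∷ [])
  (0 ∷ 12 ∷ 15 ∷ 18 ∷ 16 ∷ 5 ∷ 6 ∷ 10 ∷ 2 ∷ 3 ∷ 13 ∷ 17 ∷ 9 ∷ 1 ∷ 8 ∷ 4 ∷ 7 ∷ 19 ∷ 11 ∷ 14 ∷ 20 ∷ [])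

RGDD-7 : RGDD (Fin 7) (Fin 2 ⊎ Fin 7)
RGDD-7 = Starter-7.develop (toWitness {a? = Starter-7.isStarter?} _)

module Starter-13 = StarterTable 12 5
  (11 ∷ 8 ∷ 4 ∷ 12 ∷ 7 ∷ 9 ∷ 1 ∷ 4 ∷ 12 ∷ 6 ∷ [])
  (1 ∷ 4 ∷ 16 ∷ 3 ∷ 13 ∷ 19 ∷ 7 ∷ 37 ∷ 26 ∷ 10 ∷ 28 ∷ 23 ∷ 22 ∷ 20 ∷ 38 ∷ 9 ∷ 15 ∷ 34 ∷ 24 ∷ 31 ∷ 35 ∷ 33 ∷
   36 ∷ 25 ∷ 6 ∷ 21 ∷ 29 ∷ 18 ∷ 11 ∷ 14 ∷ 0 ∷ 12 ∷ 30 ∷ 27 ∷ 5 ∷ 32 ∷ 2 ∷ 8 ∷ 17 ∷ [])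

RGDD-13 : RGDD (Fin 13) (Fin 5 ⊎ Fin 13)
RGDD-13 = Starter-13.develop (toWitness {a? = Starter-13.isStarter?} _)

module Starter-17 = StarterTable 16 7
  (12 ∷ 5 ∷ 3 ∷ 2 ∷ 16 ∷ 12 ∷ 11 ∷ 8 ∷ 13 ∷ 11 ∷ 10 ∷ 15 ∷ 14 ∷ 3 ∷ [])
  (19 ∷ 22 ∷ 34 ∷ 21 ∷ 16 ∷ 37 ∷ 4 ∷ 46 ∷ 17 ∷ 30 ∷ 43 ∷ 49 ∷ 3 ∷ 7 ∷ 25 ∷ 13 ∷ 40 ∷ 47 ∷ 24 ∷ 45 ∷ 1 ∷ 6 ∷
   31 ∷ 35 ∷ 10 ∷ 20 ∷ 38 ∷ 28 ∷ 2 ∷ 14 ∷ 39 ∷ 8 ∷ 44 ∷ 26 ∷ 29 ∷ 50 ∷ 12 ∷ 5 ∷ 11 ∷ 42 ∷ 23 ∷ 32 ∷ 18 ∷ 27 ∷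
   41 ∷ 9 ∷ 15 ∷ 33 ∷ 0 ∷ 36 ∷ 48 ∷ [])

RGDD-17 : RGDD (Fin 17) (Fin 7 ⊎ Fin 17)
RGDD-17 = Starter-17.develop (toWitness {a? = Starter-17.isStarter?} _)

module Starter-19 = StarterTable 18 8
  (8 ∷ 10 ∷ 18 ∷ 6 ∷ 4 ∷ 13 ∷ 11 ∷ 7 ∷ 14 ∷ 11 ∷ 1 ∷ 5 ∷ 17 ∷ 16 ∷ 7 ∷ 15 ∷ [])
  (6 ∷ 12 ∷ 17 ∷ 27 ∷ 42 ∷ 51 ∷ 21 ∷ 24 ∷ 31 ∷ 3 ∷ 39 ∷ 22 ∷ 9 ∷ 36 ∷ 48 ∷ 0 ∷ 16 ∷ 26 ∷ 30 ∷ 4 ∷ 38 ∷ 45 ∷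
   34 ∷ 37 ∷ 33 ∷ 13 ∷ 32 ∷ 18 ∷ 46 ∷ 5 ∷ 54 ∷ 11 ∷ 50 ∷ 15 ∷ 44 ∷ 53 ∷ 20 ∷ 23 ∷ 56 ∷ 28 ∷ 2 ∷ 8 ∷ 14 ∷ 29 ∷
   41 ∷ 40 ∷ 49 ∷ 35 ∷ 7 ∷ 43 ∷ 47 ∷ 10 ∷ 25 ∷ 55 ∷ 1 ∷ 19 ∷ 52 ∷ [])

RGDD-19 : RGDD (Fin 19) (Fin 8 ⊎ Fin 19)
RGDD-19 = Starter-19.develop (toWitness {a? = Starter-19.isStarter?} _)

module Starter-23 = StarterTable 22 10
  (6 ∷ 7 ∷ 17 ∷ 5 ∷ 9 ∷ 3 ∷ 7 ∷ 15 ∷ 12 ∷ 11 ∷ 13 ∷ 4 ∷ 10 ∷ 14 ∷ 3 ∷ 22 ∷ 8 ∷ 10 ∷ 4 ∷ 17 ∷ [])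
  (46 ∷ 55 ∷ 23 ∷ 4 ∷ 49 ∷ 35 ∷ 10 ∷ 43 ∷ 64 ∷ 24 ∷ 40 ∷ 67 ∷ 1 ∷ 31 ∷ 50 ∷ 39 ∷ 19 ∷ 37 ∷ 51 ∷ 16 ∷ 28 ∷ 7 ∷
   13 ∷ 29 ∷ 58 ∷ 61 ∷ 53 ∷ 42 ∷ 34 ∷ 62 ∷ 36 ∷ 22 ∷ 32 ∷ 21 ∷ 30 ∷ 25 ∷ 45 ∷ 63 ∷ 52 ∷ 15 ∷ 54 ∷ 60 ∷ 6 ∷
   18 ∷ 33 ∷ 12 ∷ 48 ∷ 38 ∷ 9 ∷ 57 ∷ 65 ∷ 0 ∷ 3 ∷ 41 ∷ 27 ∷ 8 ∷ 56 ∷ 66 ∷ 2 ∷ 59 ∷ 26 ∷ 44 ∷ 68 ∷ 14 ∷ 17 ∷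
   47 ∷ 5 ∷ 11 ∷ 20 ∷ [])

RGDD-23 : RGDD (Fin 23) (Fin 10 ⊎ Fin 23)
RGDD-23 = Starter-23.develop (toWitness {a? = Starter-23.isStarter?} _)

module Starter-29 = StarterTable 28 13
  (7 ∷ 6 ∷ 22 ∷ 8 ∷ 12 ∷ 26 ∷ 15 ∷ 18 ∷ 24 ∷ 3 ∷ 1 ∷ 7 ∷ 6 ∷ 2 ∷ 14 ∷ 19 ∷ 23 ∷ 15 ∷ 10 ∷ 4 ∷ 20 ∷ 17 ∷ 19 ∷
   1 ∷ 4 ∷ 22 ∷ [])
  (12 ∷ 19 ∷ 52 ∷ 70 ∷ 82 ∷ 35 ∷ 10 ∷ 55 ∷ 58 ∷ 4 ∷ 73 ∷ 86 ∷ 34 ∷ 43 ∷ 65 ∷ 15 ∷ 7 ∷ 67 ∷ 31 ∷ 37 ∷ 17 ∷ 16 ∷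
   40 ∷ 77 ∷ 28 ∷ 49 ∷ 85 ∷ 51 ∷ 46 ∷ 61 ∷ 25 ∷ 29 ∷ 32 ∷ 75 ∷ 13 ∷ 71 ∷ 30 ∷ 79 ∷ 20 ∷ 48 ∷ 64 ∷ 26 ∷ 0 ∷
   78 ∷ 76 ∷ 45 ∷ 81 ∷ 22 ∷ 33 ∷ 54 ∷ 1 ∷ 36 ∷ 39 ∷ 66 ∷ 6 ∷ 69 ∷ 68 ∷ 9 ∷ 84 ∷ 47 ∷ 24 ∷ 42 ∷ 59 ∷ 21 ∷ 27 ∷
   60 ∷ 3 ∷ 44 ∷ 74 ∷ 57 ∷ 72 ∷ 14 ∷ 18 ∷ 63 ∷ 50 ∷ 38 ∷ 62 ∷ 83 ∷ 5 ∷ 11 ∷ 23 ∷ 2 ∷ 53 ∷ 80 ∷ 8 ∷ 41 ∷ 56 ∷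
   [])

RGDD-29 : RGDD (Fin 29) (Fin 13 ⊎ Fin 29)
RGDD-29 = Starter-29.develop (toWitness {a? = Starter-29.isStarter?} _)

module Starter-31 = StarterTable 30 14
  (8 ∷ 12 ∷ 3 ∷ 20 ∷ 28 ∷ 7 ∷ 20 ∷ 5 ∷ 27 ∷ 15 ∷ 10 ∷ 28 ∷ 1 ∷ 9 ∷ 6 ∷ 4 ∷ 5 ∷ 29 ∷ 29 ∷ 3 ∷ 17 ∷ 6 ∷ 30 ∷ 2 ∷
   23 ∷ 13 ∷ 9 ∷ 21 ∷ [])
  (4 ∷ 64 ∷ 38 ∷ 34 ∷ 73 ∷ 79 ∷ 37 ∷ 55 ∷ 77 ∷ 87 ∷ 28 ∷ 40 ∷ 48 ∷ 10 ∷ 13 ∷ 22 ∷ 43 ∷ 29 ∷ 7 ∷ 91 ∷ 26 ∷ 81 ∷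
   1 ∷ 25 ∷ 19 ∷ 49 ∷ 2 ∷ 66 ∷ 46 ∷ 88 ∷ 60 ∷ 31 ∷ 67 ∷ 61 ∷ 76 ∷ 65 ∷ 16 ∷ 82 ∷ 59 ∷ 75 ∷ 58 ∷ 56 ∷ 30 ∷ 70 ∷
   62 ∷ 9 ∷ 78 ∷ 52 ∷ 6 ∷ 36 ∷ 85 ∷ 3 ∷ 18 ∷ 51 ∷ 21 ∷ 72 ∷ 71 ∷ 33 ∷ 69 ∷ 20 ∷ 15 ∷ 42 ∷ 54 ∷ 0 ∷ 84 ∷ 90 ∷
   24 ∷ 45 ∷ 8 ∷ 39 ∷ 57 ∷ 92 ∷ 12 ∷ 80 ∷ 83 ∷ 63 ∷ 68 ∷ 89 ∷ 27 ∷ 17 ∷ 86 ∷ 23 ∷ 35 ∷ 50 ∷ 14 ∷ 32 ∷ 74 ∷ 5 ∷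
   44 ∷ 53 ∷ 11 ∷ 41 ∷ 47 ∷ [])

RGDD-31 : RGDD (Fin 31) (Fin 14 ⊎ Fin 31)
RGDD-31 = Starter-31.develop (toWitness {a? = Starter-31.isStarter?} _)

module Starter-37 = StarterTable 36 17
  (33 ∷ 2 ∷ 25 ∷ 7 ∷ 14 ∷ 8 ∷ 3 ∷ 20 ∷ 30 ∷ 14 ∷ 34 ∷ 5 ∷ 31 ∷ 29 ∷ 5 ∷ 30 ∷ 22 ∷ 13 ∷ 7 ∷ 25 ∷ 10 ∷ 22 ∷ 17 ∷
   10 ∷ 11 ∷ 31 ∷ 28 ∷ 32 ∷ 32 ∷ 17 ∷ 12 ∷ 1 ∷ 24 ∷ 33 ∷ [])
  (24 ∷ 64 ∷ 70 ∷ 93 ∷ 1 ∷ 47 ∷ 33 ∷ 58 ∷ 88 ∷ 75 ∷ 105 ∷ 103 ∷ 63 ∷ 10 ∷ 110 ∷ 99 ∷ 49 ∷ 106 ∷ 9 ∷ 84 ∷ 22 ∷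
   87 ∷ 46 ∷ 62 ∷ 30 ∷ 34 ∷ 104 ∷ 51 ∷ 19 ∷ 101 ∷ 54 ∷ 7 ∷ 31 ∷ 72 ∷ 67 ∷ 71 ∷ 108 ∷ 79 ∷ 11 ∷ 40 ∷ 52 ∷ 73 ∷
   55 ∷ 82 ∷ 91 ∷ 43 ∷ 94 ∷ 109 ∷ 4 ∷ 97 ∷ 26 ∷ 13 ∷ 16 ∷ 85 ∷ 28 ∷ 76 ∷ 38 ∷ 61 ∷ 53 ∷ 59 ∷ 100 ∷ 23 ∷ 86 ∷
   37 ∷ 14 ∷ 68 ∷ 25 ∷ 32 ∷ 74 ∷ 41 ∷ 50 ∷ 80 ∷ 90 ∷ 17 ∷ 83 ∷ 8 ∷ 20 ∷ 44 ∷ 29 ∷ 56 ∷ 107 ∷ 2 ∷ 5 ∷ 95 ∷ 21 ∷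
   77 ∷ 92 ∷ 60 ∷ 78 ∷ 89 ∷ 0 ∷ 66 ∷ 35 ∷ 6 ∷ 45 ∷ 65 ∷ 15 ∷ 102 ∷ 98 ∷ 3 ∷ 36 ∷ 57 ∷ 39 ∷ 42 ∷ 48 ∷ 18 ∷ 69 ∷
   81 ∷ 12 ∷ 27 ∷ 96 ∷ [])

RGDD-37 : RGDD (Fin 37) (Fin 17 ⊎ Fin 37)
RGDD-37 = Starter-37.develop (toWitness {a? = Starter-37.isStarter?} _)

module Starter-53 = StarterTable 52 25
  (4 ∷ 11 ∷ 38 ∷ 51 ∷ 47 ∷ 36 ∷ 50 ∷ 41 ∷ 24 ∷ 21 ∷ 2 ∷ 28 ∷ 14 ∷ 39 ∷ 1 ∷ 40 ∷ 42 ∷ 12 ∷ 26 ∷ 50 ∷ 39 ∷ 34 ∷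
   23 ∷ 5 ∷ 44 ∷ 38 ∷ 15 ∷ 19 ∷ 7 ∷ 24 ∷ 49 ∷ 33 ∷ 25 ∷ 3 ∷ 37 ∷ 14 ∷ 52 ∷ 31 ∷ 22 ∷ 25 ∷ 30 ∷ 35 ∷ 29 ∷ 47 ∷
   43 ∷ 44 ∷ 3 ∷ 1 ∷ 21 ∷ 49 ∷ [])
  (12 ∷ 52 ∷ 61 ∷ 69 ∷ 114 ∷ 55 ∷ 51 ∷ 1 ∷ 112 ∷ 132 ∷ 94 ∷ 109 ∷ 36 ∷ 75 ∷ 130 ∷ 30 ∷ 58 ∷ 127 ∷ 144 ∷ 19 ∷
   68 ∷ 42 ∷ 48 ∷ 79 ∷ 156 ∷ 13 ∷ 16 ∷ 78 ∷ 147 ∷ 73 ∷ 33 ∷ 91 ∷ 62 ∷ 45 ∷ 96 ∷ 148 ∷ 60 ∷ 25 ∷ 92 ∷ 90 ∷ 37 ∷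
   71 ∷ 18 ∷ 43 ∷ 80 ∷ 6 ∷ 88 ∷ 95 ∷ 135 ∷ 115 ∷ 44 ∷ 22 ∷ 49 ∷ 100 ∷ 76 ∷ 121 ∷ 142 ∷ 10 ∷ 70 ∷ 134 ∷ 4 ∷
   28 ∷ 86 ∷ 40 ∷ 103 ∷ 157 ∷ 145 ∷ 151 ∷ 101 ∷ 7 ∷ 133 ∷ 110 ∷ 34 ∷ 118 ∷ 154 ∷ 64 ∷ 136 ∷ 125 ∷ 67 ∷ 85 ∷
   97 ∷ 82 ∷ 139 ∷ 23 ∷ 106 ∷ 131 ∷ 152 ∷ 46 ∷ 8 ∷ 77 ∷ 124 ∷ 104 ∷ 143 ∷ 31 ∷ 29 ∷ 59 ∷ 27 ∷ 54 ∷ 53 ∷ 111 ∷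
   98 ∷ 158 ∷ 66 ∷ 38 ∷ 74 ∷ 93 ∷ 107 ∷ 149 ∷ 123 ∷ 5 ∷ 56 ∷ 138 ∷ 2 ∷ 116 ∷ 35 ∷ 47 ∷ 113 ∷ 65 ∷ 122 ∷ 140 ∷
   32 ∷ 119 ∷ 128 ∷ 83 ∷ 89 ∷ 137 ∷ 126 ∷ 20 ∷ 146 ∷ 14 ∷ 17 ∷ 41 ∷ 81 ∷ 129 ∷ 50 ∷ 72 ∷ 11 ∷ 26 ∷ 84 ∷ 105 ∷
   155 ∷ 9 ∷ 87 ∷ 102 ∷ 21 ∷ 108 ∷ 117 ∷ 39 ∷ 63 ∷ 99 ∷ 0 ∷ 57 ∷ 141 ∷ 3 ∷ 15 ∷ 120 ∷ 24 ∷ 150 ∷ 153 ∷ [])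

RGDD-53 : RGDD (Fin 53) (Fin 25 ⊎ Fin 53)
RGDD-53 = Starter-53.develop (toWitness {a? = Starter-53.isStarter?} _)

-- The construction

open Existence frame-6⁵ frame-6⁴

-- The 2 t + 1 translates leave t - 1 of the 3 t classes to be transversal.
from-starter : ∀ {h q} t → h ≡ suc (t * 2) → q + h ≡ t * 3 → RGDD (Fin h) (Fin q ⊎ Fin h) → Kirkman t
from-starter t e e′ = to-Kirkman t ↔-refl (⊎-≅ ↔-refl ↔-refl) e e′

K₁ : Kirkman 1
K₁ = from-starter 1 refl refl RGDD-3
K₂ : Kirkman 2
K₂ = to-Kirkman 2 ↔-refl ↔-refl refl refl RGDD-5
K₃ : Kirkman 3
K₃ = from-starter 3 refl refl RGDD-7
-- TD(5, 1) has a single block, so this and `K₅` are just the frames of type 6⁴ and 6⁵ with filled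
-- groups.
K₄ : Kirkman 4
K₄ = Kirkman-truncation (TD-6q+1 0) 0 z≤n K₁ Kirkman-zero
K₅ : Kirkman 5
K₅ = Kirkman-truncation (TD-6q+1 0) 1 ℕ.≤-refl K₁ K₁
K₆ : Kirkman 6
K₆ = from-starter 6 refl refl RGDD-13
K₇ : Kirkman 7
K₇ = Kirkman-product 1 2 K₁ K₂
K₈ : Kirkman 8
K₈ = from-starter 8 refl refl RGDD-17
K₉ : Kirkman 9
K₉ = from-starter 9 refl refl RGDD-19
K₁₂ : Kirkman 12
K₁₂ = Kirkman-product 2 2 K₂ K₂
K₁₃ : Kirkman 13
K₁₃ = Kirkman-product 1 4 K₁ K₄
K₁₄ : Kirkman 14
K₁₄ = from-starter 14 refl refl RGDD-29
K₂₂ : Kirkman 22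
K₂₂ = Kirkman-product 1 7 K₁ K₇

-- Here composite 2 t + 1 come from products. The prime values come from starters or, for 5, from a
-- table; only 73, 79 and 83, that is t = 36, 39, 41, use the window [36, 45] of TD(5, 9).
base : All Kirkman exceptions
base = Kirkman-zero ∷ K₁ ∷ K₂ ∷ K₃ ∷ K₆ ∷ K₇ ∷ K₈ ∷ K₉
  ∷ Kirkman-product 1 3 K₁ K₃
  ∷ from-starter 11 refl refl RGDD-23
  ∷ K₁₂ ∷ K₁₃ ∷ K₁₄
  ∷ from-starter 15 refl refl RGDD-31
  ∷ Kirkman-product 1 5 K₁ K₅
  ∷ Kirkman-product 2 3 K₂ K₃
  ∷ from-starter 18 refl refl RGDD-37
  ∷ Kirkman-product 1 6 K₁ K₆
  ∷ from-starter 26 refl refl RGDD-53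
  ∷ Kirkman-product 2 5 K₂ K₅
  ∷ Kirkman-truncation TD-9 0 z≤n K₉ Kirkman-zero
  ∷ Kirkman-product 1 12 K₁ K₁₂
  ∷ Kirkman-product 3 5 K₃ K₅
  ∷ Kirkman-truncation TD-9 3 (ℕ.m≤m+n 3 6) K₉ K₃
  ∷ Kirkman-product 1 13 K₁ K₁₃
  ∷ Kirkman-truncation TD-9 5 (ℕ.m≤m+n 5 4) K₉ K₅
  ∷ Kirkman-product 2 8 K₂ K₈
  ∷ Kirkman-product 1 14 K₁ K₁₄
  ∷ Kirkman-product 3 9 K₃ K₉
  ∷ Kirkman-product 1 22 K₁ K₂₂
  ∷ []

kirkman : ∀ t → Kirkman t
kirkman = exists base

-- Realizing every number of triangle factors

τ : Fin 5 → ℕ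
τ 0F = 0
τ 1F = 1
τ 2F = 3
τ 3F = 5
τ 4F = 7

tripartite : ∀ k → Decomposition len K₂₁-vertex DifferentFirst (mix (τ k) (7 ∸ τ k))
tripartite 0F = tripartite₀
tripartite 1F = tripartite₁
tripartite 2F = tripartite₃
tripartite 3F = tripartite₅
tripartite 4F = tripartite₇

κ : Fin 8 → ℕ
κ 0F = 0
κ 1F = 1
κ 2F = 3
κ 3F = 5
κ 4F = 7
κ 5F = 8
κ 6F = 9
κ 7F = 10

-- K₂₁ is K_{7,7,7} together with three copies of K₇, which add three heptagon factors; so every τ
-- is also a κ.
with-columns : ∀ {r s} → Decomposition len K₂₁-vertex DifferentFirst (mix r s) →
               Decomposition len K₂₁-vertex _≢_ (mix r (s + 3))
with-columns {r} {s} D = reindex ↔-refl (λ e → e) (λ e → e) recolour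
  (union differentFirst? split (λ n e → n (cong proj₁ e)) (λ { (_ , n) e → n (cong proj₂ e) }) (λ n (e , _) → n e) D columns)
  where
  split : ∀ {x y : K₂₁-vertex} → x ≢ y → DifferentFirst x y ⊎ SameFirst x y
  split {x} {y} n with proj₁ x Fin.≟ proj₁ y
  ... | yes e = inj₂ (e , λ e′ → n (cong₂ _,_ e e′))
  ... | no ¬e = inj₁ ¬e
  recolour : ∀ l → (mix r s l ⊎ mix 0 3 l) ↔ mix r (s + 3) l
  recolour triangle = same-size (⊎-≅ ↔-refl ↔-refl) ↔-refl (ℕ.+-identityʳ r)
  recolour heptagon = ⊎-≅ ↔-refl ↔-refl

complete : ∀ k → Decomposition len K₂₁-vertex _≢_ (mix (κ k) (10 ∸ κ k))
complete 0F = with-columns tripartite₀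
complete 1F = with-columns tripartite₁
complete 2F = with-columns tripartite₃
complete 3F = with-columns tripartite₅
complete 4F = with-columns tripartite₇
complete 5F = complete₈
complete 6F = complete₉
complete 7F = complete₁₀

total : ∀ {N} → (Fin N → ℕ) → ℕ
total {zero} f = 0
total {suc N} f = f zero + total (f ∘ suc)

Σ-≅ : ∀ {N} (f : Fin N → ℕ) → Σ[ i ∈ Fin N ] Fin (f i) ≅ total f
Σ-≅ {zero} f = mk↔ₛ′ (λ { (() , _) }) (λ ()) (λ ()) (λ { (() , _) })
Σ-≅ {suc N} f = ↔-trans (mk↔ₛ′
    (λ { (zero , x) → inj₁ x ; (suc i , x) → inj₂ (i , x) })
    (λ { (inj₁ x) → zero , x ; (inj₂ (i , x)) → suc i , x })
    (λ { (inj₁ _) → refl ; (inj₂ _) → refl }) (λ { (zero , _) → refl ; (suc _ , _) → refl }))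
  (⊎-≅ ↔-refl (Σ-≅ (f ∘ suc)))

-- Every triangle class of the RGDD contributes τ triangle factors and 7 − τ heptagon factors, the K₂₁ on
-- the groups contribute κ and 10 − κ.
assemble : ∀ t (k : Fin 8) (ρ : Fin (t * 3) → Fin 5) {r s} →
  total (τ ∘ ρ) + κ k ≡ r → total (λ c → 7 ∸ τ (ρ c)) + (10 ∸ κ k) ≡ s → 1 ≤ r →
  HW (suc (t * 2) * 21) r s 3 7
assemble t k ρ {r} {s} r-total s-total 1≤r = decomposition⇒HW 1≤r
  (reindex (↔-sym vertices) (λ n e → n (trans (sym (strictlyInverseˡ _)) (trans (cong to e) (strictlyInverseˡ _))))
    (λ n e → n (trans (sym (strictlyInverseʳ _)) (trans (cong from e) (strictlyInverseʳ _)))) recolour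
    (union differentFirst? split (λ n e → n (cong proj₁ e)) (λ { (refl , n) e → n (cong proj₂ e) }) (λ n (e , _) → n e)
      (inflate (reindex-RGDD ↔-refl (colours-≅ ↔-refl) (from-Kirkman t ↔-refl refl (kirkman t))) (tripartite ∘ ρ))
      (copies Blocks (complete k))))
  where
  Blocks = Fin (suc (t * 2))
  vertices : Blocks × K₂₁-vertex ≅ suc (t * 2) * 21
  vertices = ×-≅ ↔-refl (×-≅ ↔-refl ↔-refl)
  open Inverse vertices
  split : ∀ {x y : Blocks × K₂₁-vertex} → x ≢ y →
          DifferentFirst x y ⊎ (proj₁ x ≡ proj₁ y × proj₂ x ≢ proj₂ y)
  split {x} {y} n with proj₁ x Fin.≟ proj₁ y
  ... | yes e = inj₂ (e , λ e′ → n (cong₂ _,_ e e′))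
  ... | no ¬e = inj₁ ¬e
  amount : ∀ l → total (λ c → counts (τ (ρ c)) (7 ∸ τ (ρ c)) l) + counts (κ k) (10 ∸ κ k) l ≡ counts r s l
  amount triangle = r-total
  amount heptagon = s-total
  recolour : ∀ l → ((Σ[ c ∈ Fin (t * 3) ] mix (τ (ρ c)) (7 ∸ τ (ρ c)) l) ⊎ mix (κ k) (10 ∸ κ k) l) ↔ mix r s l
  recolour l = same-size (⊎-≅ (Σ-≅ λ c → counts (τ (ρ c)) (7 ∸ τ (ρ c)) l) ↔-refl) ↔-refl (amount l)

-- Each class yields seven factors whatever its type, so once r is attained s is attained too.
total-complement : ∀ {N} (ρ : Fin N → Fin 5) → total (τ ∘ ρ) + total (λ c → 7 ∸ τ (ρ c)) ≡ N * 7
total-complement {zero} ρ = refl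
total-complement {suc N} ρ = trans
  (interchange (τ (ρ zero)) (total (τ ∘ ρ ∘ suc)) (7 ∸ τ (ρ zero)) (total (λ c → 7 ∸ τ (ρ (suc c)))))
  (cong₂ _+_ (τ≤7 (ρ zero)) (total-complement (ρ ∘ suc)))
  where
  interchange : ∀ a b c d → a + b + (c + d) ≡ a + c + (b + d)
  interchange = solve-∀
  τ≤7 : ∀ k → τ k + (7 ∸ τ k) ≡ 7
  τ≤7 = toWitness {a? = Fin.all? λ k → τ k + (7 ∸ τ k) ℕ.≟ 7} _

construct : ∀ t (k : Fin 8) (ρ : Fin (t * 3) → Fin 5) {r s} →
  total (τ ∘ ρ) + κ k ≡ r → 1 ≤ r → r + s ≡ 10 + t * 21 → HW (suc (t * 2) * 21) r s 3 7
construct t k ρ {r} {s} r-total 1≤r e = assemble t k ρ r-total (ℕ.+-cancelˡ-≡ r _ _ (begin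
  r + (B + (10 ∸ κ k))                    ≡⟨ cong (_+ (B + (10 ∸ κ k))) r-total ⟨
  A + κ k + (B + (10 ∸ κ k))              ≡⟨ interchange A (κ k) B (10 ∸ κ k) ⟩
  κ k + (10 ∸ κ k) + (A + B)              ≡⟨ cong₂ _+_ (κ≤10 k) (total-complement ρ) ⟩
  10 + t * 3 * 7                          ≡⟨ cong (10 +_) (ℕ.*-assoc t 3 7) ⟩
  10 + t * 21                             ≡⟨ e ⟨
  r + s                                   ∎)) 1≤r
  where
  open ≡-Reasoning
  A = total (τ ∘ ρ)
  B = total (λ c → 7 ∸ τ (ρ c))
  interchange : ∀ a b c d → a + b + (c + d) ≡ b + d + (a + c)
  interchange = solve-∀
  κ≤10 : ∀ k → κ k + (10 ∸ κ k) ≡ 10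
  κ≤10 = toWitness {a? = Fin.all? λ k → κ k + (10 ∸ κ k) ℕ.≟ 10} _

-- An exhaustive search provides the witnesses; `abstract` keeps it from being unfolded where they
-- are used.
abstract
  reachable-with-three : ∀ (r : Fin 31) → ∃[ k ] ∃[ a ] ∃[ b ] ∃[ c ] τ a + (τ b + (τ c + 0)) + κ k ≡ toℕ r
  reachable-with-three = toWitness {a? = Fin.all? λ r → Fin.any? λ k → Fin.any? λ a → Fin.any? λ b → Fin.any? λ c →
    τ a + (τ b + (τ c + 0)) + κ k ℕ.≟ toℕ r} _

-- A class beyond the first three takes τ = 0 if r is already in reach without it, and τ = 7
-- otherwise. The bound is one below the number 7 N + 31 of all factors, because s ≥ 1.
reachable : ∀ N r → r ≤ N * 7 + 30 → ∃[ k ] Σ[ ρ ∈ (Fin (3 + N) → Fin 5) ] total (τ ∘ ρ) + κ k ≡ r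
reachable zero r r≤30 = let k , a , b , c , e = reachable-with-three (Fin.fromℕ< (s≤s r≤30)) in
  k , (λ { 0F → a ; 1F → b ; 2F → c }) , trans e (Fin.toℕ-fromℕ< (s≤s r≤30))
reachable (suc N) r r≤ with r ℕ.≤? N * 7 + 30
... | yes r≤′ = let k , ρ , e = reachable N r r≤′ in
  k , (λ { zero → 0F ; (suc i) → ρ i }) , e
... | no r≰ = let k , ρ , e = reachable N (r ∸ 7) (ℕ.m≤n+o⇒m∸n≤o r 7 r≤) in
  k , (λ { zero → 4F ; (suc i) → ρ i }) , trans (cong (7 +_) e) (ℕ.m+[n∸m]≡n 7≤r)
  where
  7≤r : 7 ≤ r
  7≤r = ℕ.≤-trans (ℕ.m≤m+n 7 23) (ℕ.≤-trans (ℕ.m≤n+m 30 (N * 7)) (ℕ.<⇒≤ (ℕ.≰⇒> r≰)))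

-- For t = 0 there is no class to adjust with, so r itself has to be a value of κ.
reachable-at-21 : ∀ (r : Fin 10) → toℕ r ≡ 0 ⊎ (toℕ r ≡ 2 ⊎ toℕ r ≡ 4 ⊎ toℕ r ≡ 6) ⊎ (∃[ k ] κ k ≡ toℕ r)
reachable-at-21 = toWitness {a? = Fin.all? λ r → (toℕ r ℕ.≟ 0) ⊎-dec
  ((toℕ r ℕ.≟ 2) ⊎-dec (toℕ r ℕ.≟ 4) ⊎-dec (toℕ r ℕ.≟ 6)) ⊎-dec Fin.any? λ k → κ k ℕ.≟ toℕ r} _

r<total : ∀ {r s N} → 1 ≤ s → r + s ≡ N → r < N
r<total {r} 1≤s refl = ℕ.m<m+n r 1≤s

HW-exists : ∀ t {r s} → 1 ≤ r → 1 ≤ s → r + s ≡ 10 + t * 21 → ¬ (t ≡ 0 × (r ≡ 2 ⊎ r ≡ 4 ⊎ r ≡ 6)) →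
            HW (suc (t * 2) * 21) r s 3 7
HW-exists zero {r} {s} 1≤r 1≤s e no-exception = cases (Fin.toℕ-fromℕ< r<10) (reachable-at-21 (Fin.fromℕ< r<10))
  where
  r<10 = r<total 1≤s e
  cases : ∀ {r′} → r′ ≡ r → r′ ≡ 0 ⊎ (r′ ≡ 2 ⊎ r′ ≡ 4 ⊎ r′ ≡ 6) ⊎ (∃[ k ] κ k ≡ r′) → HW 21 r s 3 7
  cases refl (inj₁ refl) = contradiction 1≤r λ ()
  cases refl (inj₂ (inj₁ r∈)) = contradiction (refl , r∈) no-exception
  cases refl (inj₂ (inj₂ (k , κ≡r))) = construct 0 k (λ ()) κ≡r 1≤r e
HW-exists (suc t) {r} {s} 1≤r 1≤s e _ =
  let k , ρ , r-total = reachable (t * 3) r (ℕ.≤-pred (subst (r <_) (size t) (r<total 1≤s e)))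
  in construct (suc t) k ρ r-total 1≤r e
  where
  size : ∀ t → 10 + (1 + t) * 21 ≡ 1 + (t * 3 * 7 + 30)
  size = solve-∀

theorem1p1 : (n r s : ℕ) → n % 2 ≡ 1 → 1 ≤ r → 1 ≤ s → r + s ≡ (n ∸ 1) / 2 →
    ¬ (n ≡ 21 × (r ≡ 2 ⊎ r ≡ 4 ⊎ r ≡ 6)) →
    (HW n r s 3 7 ⇔ n % 42 ≡ 21)
theorem1p1 n r s n-odd 1≤r 1≤s r+s no-exception = mk⇔ (HW⇒order n-odd 1≤r 1≤s) λ n≡21 →
  let t = n / 42
      n≡ : n ≡ 21 + t * 42
      n≡ = trans (ℕ.m≡m%n+[m/n]*n n 42) (cong (_+ t * 42) n≡21)
  in subst (λ n → HW n r s 3 7) (trans (order t) (sym n≡))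
    (HW-exists t 1≤r 1≤s (trans r+s (trans (cong (λ z → (z ∸ 1) / 2) n≡) (half t)))
      λ { (t≡0 , r∈) → no-exception (trans n≡ (cong (λ z → 21 + z * 42) t≡0) , r∈) })
  where
  order : ∀ t → (1 + t * 2) * 21 ≡ 21 + t * 42
  order = solve-∀
  half : ∀ t → (20 + t * 42) / 2 ≡ 10 + t * 21
  half t = trans (cong (_/ 2) (regroup t)) (ℕ.m*n/n≡m (10 + t * 21) 2)
    where
    regroup : ∀ t → 20 + t * 42 ≡ (10 + t * 21) * 2
    regroup = solve-∀
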